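{- Let $k > \ell \geq 2$ be integers. There exists $t_0$ such that for every integer $t \geq t_0$ and every integer $n > \frac{1}{4}(t+1)^2\binom{t-1}{\ell-2} + 2t$, there exists an extremal $\ell$-graph on $n$ vertices (with respect to $k,\ell,t$, as defined in the context) that contains an isolated copy of $K^{\ell}_{t+1}$.
   Context: An $\ell$-graph $G$ is a pair $(V,E)$ with $V$ a finite set and $E$ a family of $\ell$-element subsets of $V$. A copy of $K^{\ell}_{s}$ in $G$ is an $s$-element set $S\subseteq V$ such that every $\ell$-subset of $S$ is an edge of $G$; a vertex $v$ is contained in the copy if $v\in S$. Given integers $k>\ell\ge 2$, $t$ and $n$, an $\ell$-graph $G$ on $n$ vertices is called extremal if every vertex of $G$ is contained in at least $\binom{t}{k-1}$ copies of $K^{\ell}_k$, and $G$ has the minimum number of edges among all $\ell$-graphs on $n$ vertices with this property. A copy $S$ of $K^\ell_{t+1}$ in $G$ is isolated if no edge of $G$ intersects both $S$ and $V\setminus S$. -}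

module Defs where

open import Data.Nat using (ℕ; zero; suc; _+_; _*_; _≤_; _≡ᵇ_)
open import Data.Bool using (Bool; true; false; _∧_; _∨_; not; T)
open import Data.Fin using (Fin)
open import Data.Vec using (Vec; []; _∷_; lookup)
open import Data.List using (List; []; _∷_; map; _++_; filter; length)
open import Data.Fin.Subset using (Subset; ∣_∣)
open import Relation.Binary.PropositionalEquality using (_≡_)
open import Relation.Nullary.Decidable using (T?)
open import Data.Product using (Σ; _×_)

allSubsets : (n : ℕ) → List (Subset n)
allSubsets zero = [] ∷ []
allSubsets (suc n) = map (true ∷_) (allSubsets n) ++ map (false ∷_) (allSubsets n)

allᵇ : {A : Set} → (A → Bool) → List A → Bool
allᵇ p [] = true
allᵇ p (x ∷ xs) = p x ∧ allᵇ p xs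

_⊆ᵇ_ : {n : ℕ} → Subset n → Subset n → Bool
[] ⊆ᵇ [] = true
(x ∷ xs) ⊆ᵇ (y ∷ ys) = (not x ∨ y) ∧ (xs ⊆ᵇ ys)

meets : {n : ℕ} → Subset n → Subset n → Bool
meets [] [] = false
meets (x ∷ xs) (y ∷ ys) = (x ∧ y) ∨ meets xs ys

complement : {n : ℕ} → Subset n → Subset n
complement [] = []
complement (x ∷ xs) = not x ∷ complement xs

record Graph (ℓ n : ℕ) : Set where
  field
    edge : Subset n → Bool
    uniform : ∀ (e : Subset n) → T (edge e) → ∣ e ∣ ≡ ℓ
open Graph public

numEdges : {ℓ n : ℕ} → Graph ℓ n → ℕ
numEdges {ℓ} {n} G = length (filter (λ e → T? (edge G e)) (allSubsets n))

isClique : {ℓ n : ℕ} → Graph ℓ n → Subset n → Bool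
isClique {ℓ} {n} G S =
  allᵇ (λ e → not ((e ⊆ᵇ S) ∧ (∣ e ∣ ≡ᵇ ℓ)) ∨ edge G e) (allSubsets n)

cliqueCount : {ℓ n : ℕ} → Graph ℓ n → (k : ℕ) → Fin n → ℕ
cliqueCount {ℓ} {n} G k v =
  length (filter (λ S → T? ((∣ S ∣ ≡ᵇ k) ∧ lookup S v ∧ isClique G S)) (allSubsets n))

Covered : {ℓ n : ℕ} → (k m : ℕ) → Graph ℓ n → Set
Covered {ℓ} {n} k m G = ∀ (v : Fin n) → m ≤ cliqueCount G k v

-- extremal with respect to k, ℓ, t, where m = C(t, k-1) is passed in
Extremal : (k ℓ n m : ℕ) → Graph ℓ n → Set
Extremal k ℓ n m G = Covered k m G × (∀ (H : Graph ℓ n) → Covered k m H → numEdges G ≤ numEdges H)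

IsolatedCopy : {ℓ n : ℕ} → Graph ℓ n → (s : ℕ) → Subset n → Set
IsolatedCopy {ℓ} {n} G s S =
  (∣ S ∣ ≡ s) × T (isClique G S) ×
  (∀ (e : Subset n) → T (edge G e) → T (not (meets e S ∧ meets e (complement S))))

{-# OPTIONS --safe #-}

-- In a covered graph the (ℓ - 1)-uniform link of a vertex has at least C(t, k - 1) cliques of size k - 1, hence by
-- Kruskal–Katona at least D = C(t, ℓ - 1) edges, and if it has exactly D then it is complete on t vertices: a vertex
-- of least degree D lies in a clique on t + 1 vertices that contains all of its edges. Disjoint cliques on t + 1
-- vertices, the last two overlapping, bound the sum of the degrees in an extremal graph by n D + E₀ where
-- 4 E₀ ≤ (t + 1)² C(t - 1, ℓ - 2). Since a vertex outside such a clique S₁ whose own clique meets S₁ adds to the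
-- degrees in S₁, the hypothesis on n leaves a vertex of least degree whose clique S₂ is disjoint from S₁, and for
-- ℓ > 2 many vertices of least degree whose cliques avoid S₁ ∪ S₂; let X be the set of the latter.
--
-- Now isolate S₁: for each set Y of other vertices replace the sets Q ⊆ S₁ ∪ S₂ such that Y ∪ Q is an edge by equally
-- many sets Q ⊆ S₂ ∪ X forming an initial segment of the colexicographic order that starts with S₂. This does not
-- increase the number of edges. A vertex y outside S₁ ∪ S₂ in none of the cliques of X stays covered: either it is now
-- joined to all of S₂, or, by Kruskal–Katona, each set K ∋ y of other vertices has at least as many extensions to a
-- clique by vertices of S₂ ∪ X as it had by vertices of S₁ ∪ S₂.

module Submission where

open import Data.Bool using (Bool; true; false; _∧_; _∨_; not; T)
open import Data.Empty using (⊥-elim)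
open import Data.Unit using (tt)
open import Data.Fin using (Fin; zero; suc)
import Data.Fin as Fin
import Data.Fin.Properties as Fin
open import Data.Fin.Subset hiding (⊥)
open import Data.Fin.Subset.Properties
open import Data.List using (List; []; _∷_; map; _++_; filter; length; cartesianProductWith)
open import Data.List.Membership.Propositional using () renaming (_∈_ to _∈ˡ_)
open import Data.List.Membership.Propositional.Properties using (∈-++⁺ˡ; ∈-++⁺ʳ; ∈-map⁺; ∈-cartesianProductWith⁺)
open import Data.List.Relation.Unary.Any using () renaming (here to hereˡ; there to thereˡ)
open import Data.Nat hiding (∣_-_∣)
open import Data.Nat.Properties
open import Data.Nat.Combinatorics using (_C_; nCk+nC[k+1]≡[n+1]C[k+1]; nC1≡n; k>n⇒nCk≡0)
open import Data.Product using (Σ; ∃; _×_; _,_; proj₁; proj₂)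
open import Data.Sum using (_⊎_; inj₁; inj₂; [_,_]′)
open import Data.Vec using ([]; _∷_; lookup; here; there; tabulate; take; drop) renaming (_++_ to _++ᵛ_)
open import Data.Vec.Properties using (≡-dec; lookup∘tabulate; []=⇒lookup; lookup⇒[]=; take++drop≡id)
open import Level using (Level)
open import Function using (_∘_; id)
open import Relation.Binary.PropositionalEquality hiding ([_])
open import Relation.Nullary
open import Relation.Nullary.Decidable using (_×-dec_; _⊎-dec_; ¬?; _→-dec_; T?)
import Data.Bool.Properties as Bool
open import Data.Nat.Solver using (module +-*-Solver)
open import Defs

-- Kruskal-Katona is needed in two forms. For the degrees only binomial thresholds matter, but
-- equality must be characterised; a bound on the cliques that is linear in the size of the family
-- does this, because it can be summed over the links of all vertices. In the exchange of edges the
-- number of extensions of a set is arbitrary, so the exact colexicographic form is used. The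
-- obstacle in the exchange is room for the initial segment. Consider a set Y of other vertices and
-- its extensions by s vertices of S₁ ∪ S₂. If s ≥ ℓ - 1, few attachments at y mean at most C(t + 1,
-- s) extensions, and S₂ has room for them. For smaller s there is no such bound. But extensions use
-- only those vertices of S₁ ∪ S₂ that exceed the least degree, and X is there to make S₂ ∪ X at
-- least as large as their set. For ℓ = 2 only s = 0 remains. In E₀ the factor (t + 1)² / 4 bounds
-- the product of the overlap and the remainder of the last clique, which sum to t + 1. The term 2t
-- is the margin that survives the removal of S₁, and of S₁ ∪ S₂ up to one vertex. The size of t is
-- chosen so that C(t - 1, ℓ - 2) ≥ 3 (ℓ - 1) when ℓ > 2.

private variable
  A B : Set
  m n : ℕ

∅ : ∀ {n} → Subset n
∅ = Data.Fin.Subset.⊥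

-- Unpacking by application, unlike a with-abstraction, does not normalise the goal.
unpack : {a b c : Level} {X : Set a} {P : X → Set b} {R : Set c} → ∃ P → (∀ x → P x → R) → R
unpack (x , p) f = f x p

-- Finite sums and counting

∑ : List A → (A → ℕ) → ℕ
∑ []       f = 0
∑ (x ∷ xs) f = f x + ∑ xs f

∑-mono : (xs : List A) {f g : A → ℕ} → (∀ x → f x ≤ g x) → ∑ xs f ≤ ∑ xs g
∑-mono []       f≤g = z≤n
∑-mono (x ∷ xs) f≤g = +-mono-≤ (f≤g x) (∑-mono xs f≤g)

∑-cong : (xs : List A) {f g : A → ℕ} → (∀ x → f x ≡ g x) → ∑ xs f ≡ ∑ xs g
∑-cong []       f≡g = refl
∑-cong (x ∷ xs) f≡g = cong₂ _+_ (f≡g x) (∑-cong xs f≡g)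

+-interchange : ∀ a b c d → (a + b) + (c + d) ≡ (a + c) + (b + d)
+-interchange a b c d = solve 4 (λ a b c d → (a :+ b) :+ (c :+ d) := (a :+ c) :+ (b :+ d)) refl a b c d
  where open +-*-Solver

∑-+ : (xs : List A) (f g : A → ℕ) → ∑ xs (λ x → f x + g x) ≡ ∑ xs f + ∑ xs g
∑-+ []       f g = refl
∑-+ (x ∷ xs) f g rewrite ∑-+ xs f g = +-interchange (f x) (g x) (∑ xs f) (∑ xs g)

∑-*ˡ : (xs : List A) (c : ℕ) (f : A → ℕ) → ∑ xs (λ x → c * f x) ≡ c * ∑ xs f
∑-*ˡ []       c f = sym (*-zeroʳ c)
∑-*ˡ (x ∷ xs) c f rewrite ∑-*ˡ xs c f = sym (*-distribˡ-+ c (f x) (∑ xs f))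

∑-0 : (xs : List A) → ∑ xs (λ _ → 0) ≡ 0
∑-0 []       = refl
∑-0 (x ∷ xs) = ∑-0 xs

∑-swap : (xs : List A) (ys : List B) (f : A → B → ℕ) →
         ∑ xs (λ x → ∑ ys (f x)) ≡ ∑ ys (λ y → ∑ xs (λ x → f x y))
∑-swap []       ys f = sym (∑-0 ys)
∑-swap (x ∷ xs) ys f rewrite ∑-swap xs ys f = sym (∑-+ ys (f x) _)

∑-++ : (xs ys : List A) (f : A → ℕ) → ∑ (xs ++ ys) f ≡ ∑ xs f + ∑ ys f
∑-++ []       ys f = refl
∑-++ (x ∷ xs) ys f rewrite ∑-++ xs ys f = sym (+-assoc (f x) _ _)

∑-map : (g : A → B) (xs : List A) (f : B → ℕ) → ∑ (map g xs) f ≡ ∑ xs (f ∘ g)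
∑-map g []       f = refl
∑-map g (x ∷ xs) f = cong (f (g x) +_) (∑-map g xs f)

ind : Dec A → ℕ
ind (yes _) = 1
ind (no  _) = 0

ind-mono : (a? : Dec A) (b? : Dec B) → (A → B) → ind a? ≤ ind b?
ind-mono (yes a) (yes b) f = ≤-refl
ind-mono (yes a) (no ¬b) f = ⊥-elim (¬b (f a))
ind-mono (no ¬a) b?      f = z≤n

ind-no : (a? : Dec A) → ¬ A → ind a? ≡ 0
ind-no (yes a) ¬a = ⊥-elim (¬a a)
ind-no (no _)  ¬a = refl

ind-× : (a? : Dec A) (b? : Dec B) → ind (a? ×-dec b?) ≡ ind a? * ind b?
ind-× (yes _) (yes _) = refl
ind-× (yes _) (no _)  = refl
ind-× (no _)  b?      = refl

ind-⊎ : (a? : Dec A) (b? : Dec B) → ind (a? ⊎-dec b?) ≤ ind a? + ind b?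
ind-⊎ (yes _) b?      = s≤s z≤n
ind-⊎ (no _)  (yes _) = ≤-refl
ind-⊎ (no _)  (no _)  = z≤n

ind-split : (a? : Dec A) (b? : Dec B) →
            ind a? ≡ ind (a? ×-dec b?) + ind (a? ×-dec (¬? b?))
ind-split (yes _) (yes _) = refl
ind-split (yes _) (no _)  = refl
ind-split (no _)  b?      = refl

ind-*-≤ : (a? : Dec A) {x y : ℕ} → (A → x ≤ y) → ind a? * x ≤ ind a? * y
ind-*-≤ (yes a) x≤y = *-monoʳ-≤ 1 (x≤y a)
ind-*-≤ (no _)  _   = z≤n

∑ˢ : (Subset n → ℕ) → ℕ
∑ˢ {n} = ∑ (allSubsets n)

vertices : ∀ n → List (Fin n)
vertices zero    = []
vertices (suc n) = zero ∷ map suc (vertices n)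

∑ᵛ : (Fin n → ℕ) → ℕ
∑ᵛ {n} = ∑ (vertices n)

∑ˢ-suc : (f : Subset (suc n) → ℕ) → ∑ˢ f ≡ ∑ˢ (f ∘ (inside ∷_)) + ∑ˢ (f ∘ (outside ∷_))
∑ˢ-suc {n} f = trans (∑-++ (map (inside ∷_) (allSubsets n)) _ f)
  (cong₂ _+_ (∑-map (inside ∷_) (allSubsets n) f) (∑-map (outside ∷_) (allSubsets n) f))

∑ᵛ-suc : (f : Fin (suc n) → ℕ) → ∑ᵛ f ≡ f zero + ∑ᵛ (f ∘ suc)
∑ᵛ-suc {n} f = cong (f zero +_) (∑-map suc (vertices n) f)

_≟ˢ_ : (S T : Subset n) → Dec (S ≡ T)
_≟ˢ_ = ≡-dec Bool._≟_

∑ˢ-single : (S : Subset n) → ∑ˢ (λ T → ind (S ≟ˢ T)) ≡ 1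
∑ˢ-single []            = refl
∑ˢ-single {suc n} (b ∷ S) = trans (∑ˢ-suc (λ T → ind ((b ∷ S) ≟ˢ T))) (go b)
  where
  same : ∀ b → ∑ˢ (λ T → ind ((b ∷ S) ≟ˢ (b ∷ T))) ≡ 1
  same b = trans (∑-cong (allSubsets n) λ T →
    ≤-antisym (ind-mono ((b ∷ S) ≟ˢ (b ∷ T)) (S ≟ˢ T) λ { refl → refl })
              (ind-mono (S ≟ˢ T) ((b ∷ S) ≟ˢ (b ∷ T)) λ { refl → refl })) (∑ˢ-single S)
  diff : ∀ b c → b ≢ c → ∑ˢ (λ T → ind ((b ∷ S) ≟ˢ (c ∷ T))) ≡ 0
  diff b c b≢c = trans (∑-cong (allSubsets n) λ T →
    ind-no ((b ∷ S) ≟ˢ (c ∷ T)) λ { refl → b≢c refl }) (∑-0 (allSubsets n))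
  go : ∀ b → ∑ˢ (λ T → ind ((b ∷ S) ≟ˢ (true ∷ T))) + ∑ˢ (λ T → ind ((b ∷ S) ≟ˢ (false ∷ T))) ≡ 1
  go true  = cong₂ _+_ (same true) (diff true false λ ())
  go false = cong₂ _+_ (diff false true λ ()) (same false)

∑ᵛ-single : (v : Fin n) → ∑ᵛ (λ w → ind (v Fin.≟ w)) ≡ 1
∑ᵛ-single {suc n} zero = trans (∑ᵛ-suc {n} (λ w → ind (zero Fin.≟ w)))
  (cong suc (trans (∑-cong (vertices n) λ w → ind-no (zero Fin.≟ suc w) λ ()) (∑-0 (vertices n))))
∑ᵛ-single {suc n} (suc v) = trans (∑ᵛ-suc {n} (λ w → ind (suc v Fin.≟ w)))
  (trans (∑-cong (vertices n) λ w →
    ≤-antisym (ind-mono (suc v Fin.≟ suc w) (v Fin.≟ w) λ { refl → refl })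
              (ind-mono (v Fin.≟ w) (suc v Fin.≟ suc w) λ { refl → refl })) (∑ᵛ-single v))

# : {P : Subset n → Set} → (∀ S → Dec (P S)) → ℕ
# P? = ∑ˢ λ S → ind (P? S)

#-mono : {P Q : Subset n → Set} (P? : ∀ S → Dec (P S)) (Q? : ∀ S → Dec (Q S)) →
         (∀ S → P S → Q S) → # P? ≤ # Q?
#-mono {n} P? Q? P⇒Q = ∑-mono (allSubsets n) λ S → ind-mono (P? S) (Q? S) (P⇒Q S)

#-cong : {P Q : Subset n → Set} (P? : ∀ S → Dec (P S)) (Q? : ∀ S → Dec (Q S)) →
         (∀ S → P S → Q S) → (∀ S → Q S → P S) → # P? ≡ # Q?
#-cong P? Q? P⇒Q Q⇒P = ≤-antisym (#-mono P? Q? P⇒Q) (#-mono Q? P? Q⇒P)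

#-split : {P Q : Subset n → Set} (P? : ∀ S → Dec (P S)) (Q? : ∀ S → Dec (Q S)) →
          # P? ≡ # (λ S → P? S ×-dec Q? S) + # (λ S → P? S ×-dec ¬? (Q? S))
#-split {n} P? Q? = trans (∑-cong (allSubsets n) λ S → ind-split (P? S) (Q? S)) (∑-+ (allSubsets n) _ _)

#-⊎ : {P Q : Subset n → Set} (P? : ∀ S → Dec (P S)) (Q? : ∀ S → Dec (Q S)) →
      # (λ S → P? S ⊎-dec Q? S) ≤ # P? + # Q?
#-⊎ {n} P? Q? = ≤-trans (∑-mono (allSubsets n) λ S → ind-⊎ (P? S) (Q? S))
                    (≤-reflexive (∑-+ (allSubsets n) _ _))

#-none : {P : Subset n → Set} (P? : ∀ S → Dec (P S)) → (∀ S → ¬ P S) → # P? ≡ 0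
#-none {n} P? ¬P = trans (∑-cong (allSubsets n) λ S → ind-no (P? S) (¬P S)) (∑-0 (allSubsets n))

#-pos : {P : Subset n → Set} (P? : ∀ S → Dec (P S)) (S : Subset n) → P S → 0 < # P?
#-pos P? S p = ≤-trans (≤-reflexive (sym (∑ˢ-single S)))
  (#-mono (S ≟ˢ_) P? λ { _ refl → p })

#-∃ : {P : Subset n → Set} (P? : ∀ S → Dec (P S)) → 0 < # P? → ∃ P
#-∃ P? 0<# with anySubset? P?
... | yes h = h
... | no ¬h = ⊥-elim (<-irrefl (sym (#-none P? λ S p → ¬h (S , p))) 0<#)

-- Recovers a pointwise statement from an equality of counts; both extremal structures, the complete
-- link and the clique around it, are recognised in this way.
#-full : {P Q : Subset n → Set} (P? : ∀ S → Dec (P S)) (Q? : ∀ S → Dec (Q S)) →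
         (∀ S → P S → Q S) → # Q? ≤ # P? → ∀ S → Q S → P S
#-full P? Q? P⇒Q #Q≤#P S q with P? S
... | yes p = p
... | no ¬p = ⊥-elim (<-irrefl refl (subst (_≤ # P?) (+-comm (# P?) 1) (begin
    # P? + 1 ≤⟨ +-mono-≤ (#-mono P? (λ S → Q? S ×-dec P? S) λ S p → P⇒Q S p , p)
                          (#-pos (λ S → Q? S ×-dec ¬? (P? S)) S (q , ¬p)) ⟩
    # (λ S → Q? S ×-dec P? S) + # (λ S → Q? S ×-dec ¬? (P? S)) ≡⟨ #-split Q? P? ⟨
    # Q?     ≤⟨ #Q≤#P ⟩
    # P?     ∎)))
  where open ≤-Reasoning

-- A left inverse on `P` replaces injectivity: the fibre of `f` over `T` contains at most the set
-- `g T`, so the sum over pairs can be taken in the other order.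
#-inj : {P : Subset m → Set} {Q : Subset n → Set} (P? : ∀ S → Dec (P S)) (Q? : ∀ S → Dec (Q S))
        (f : Subset m → Subset n) (g : Subset n → Subset m) →
        (∀ S → P S → Q (f S)) → (∀ S → P S → g (f S) ≡ S) → # P? ≤ # Q?
#-inj {m} {n} P? Q? f g P⇒Q gf = begin
  ∑ˢ (λ S → ind (P? S))                                ≡⟨ ∑-cong (allSubsets m) (λ S → sym (one S)) ⟩
  ∑ˢ (λ S → ∑ˢ (λ T → ind (P? S) * ind (f S ≟ˢ T)))    ≡⟨ ∑-swap (allSubsets m) (allSubsets n) _ ⟩
  ∑ˢ (λ T → ∑ˢ (λ S → ind (P? S) * ind (f S ≟ˢ T)))    ≤⟨ ∑-mono (allSubsets n) fibre ⟩
  ∑ˢ (λ T → ind (Q? T)) ∎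
  where
  open ≤-Reasoning
  one : ∀ S → ∑ˢ (λ T → ind (P? S) * ind (f S ≟ˢ T)) ≡ ind (P? S)
  one S = trans (∑-*ˡ (allSubsets n) (ind (P? S)) _)
                (trans (cong (ind (P? S) *_) (∑ˢ-single (f S))) (*-identityʳ _))
  fibre : ∀ T → ∑ˢ (λ S → ind (P? S) * ind (f S ≟ˢ T)) ≤ ind (Q? T)
  fibre T = begin
    ∑ˢ (λ S → ind (P? S) * ind (f S ≟ˢ T))    ≤⟨ ∑-mono (allSubsets m) (λ S →
      ≤-trans (≤-reflexive (sym (ind-× (P? S) (f S ≟ˢ T))))
      (≤-trans (ind-mono (P? S ×-dec (f S ≟ˢ T)) (Q? T ×-dec (g T ≟ˢ S))
                  λ { (p , refl) → P⇒Q S p , gf S p })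
               (≤-reflexive (ind-× (Q? T) (g T ≟ˢ S))))) ⟩
    ∑ˢ (λ S → ind (Q? T) * ind (g T ≟ˢ S))    ≡⟨ ∑-*ˡ (allSubsets m) (ind (Q? T)) _ ⟩
    ind (Q? T) * ∑ˢ (λ S → ind (g T ≟ˢ S))    ≡⟨ cong (ind (Q? T) *_) (∑ˢ-single (g T)) ⟩
    ind (Q? T) * 1                            ≡⟨ *-identityʳ _ ⟩
    ind (Q? T) ∎

#-fibres : {P : Subset m → Set} (P? : ∀ S → Dec (P S)) (f : Subset m → Subset n) →
           # P? ≡ ∑ˢ (λ T → # (λ S → P? S ×-dec (f S ≟ˢ T)))
#-fibres {m} {n} P? f = sym (trans (∑-swap (allSubsets n) (allSubsets m) _)
  (∑-cong (allSubsets m) λ S → trans (∑-cong (allSubsets n) λ T → ind-× (P? S) (f S ≟ˢ T))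
     (trans (∑-*ˡ (allSubsets n) (ind (P? S)) _)
        (trans (cong (ind (P? S) *_) (∑ˢ-single (f S))) (*-identityʳ _)))))

-- Sizes of subsets and binomial coefficients

∑ᵛ-∈ : (S : Subset n) → ∑ᵛ (λ v → ind (v ∈? S)) ≡ ∣ S ∣
∑ᵛ-∈ []      = refl
∑ᵛ-∈ {suc n} (b ∷ S) = trans (∑ᵛ-suc (λ v → ind (v ∈? (b ∷ S)))) (go b)
  where
  tl : ∑ᵛ (λ v → ind (suc v ∈? (b ∷ S))) ≡ ∣ S ∣
  tl = trans (∑-cong (vertices n) λ v →
    ≤-antisym (ind-mono (suc v ∈? (b ∷ S)) (v ∈? S) λ { (there p) → p })
              (ind-mono (v ∈? S) (suc v ∈? (b ∷ S)) there)) (∑ᵛ-∈ S)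
  go : ∀ c → ind (zero ∈? (c ∷ S)) + ∑ᵛ (λ v → ind (suc v ∈? (b ∷ S))) ≡ ∣ c ∷ S ∣
  go true  = cong suc tl
  go false = tl

x∈p─q⇒x∉q : ∀ (p q : Subset n) {x} → x ∈ p ─ q → x ∉ q
x∈p─q⇒x∉q (b ∷ p) (false ∷ q) (there h) (there h') = x∈p─q⇒x∉q p q h h'
x∈p─q⇒x∉q (b ∷ p) (true ∷ q)  (there h) (there h') = x∈p─q⇒x∉q p q h h'

x∉p-x : ∀ (p : Subset n) x → x ∉ p - x
x∉p-x p x h = x∈p─q⇒x∉q p ⁅ x ⁆ h (x∈⁅x⁆ x)

∈-remove : ∀ (p : Subset n) x {y} → y ∈ p - x → y ∈ p
∈-remove p x = p─q⊆p p ⁅ x ⁆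

∈-add : ∀ (p : Subset n) x → x ∈ p ∪ ⁅ x ⁆
∈-add p x = q⊆p∪q p ⁅ x ⁆ (x∈⁅x⁆ x)

∈-add⁻ : ∀ (p : Subset n) x {y} → y ∈ p ∪ ⁅ x ⁆ → y ≢ x → y ∈ p
∈-add⁻ p x h y≢x with x∈p∪q⁻ p ⁅ x ⁆ h
... | inj₁ y∈p = y∈p
... | inj₂ y∈x = ⊥-elim (y≢x (x∈⁅y⁆⇒x≡y x y∈x))

add-remove : ∀ (p : Subset n) x → x ∈ p → (p - x) ∪ ⁅ x ⁆ ≡ p
add-remove p x x∈p = ⊆-antisym to from
  where
  to : (p - x) ∪ ⁅ x ⁆ ⊆ p
  to {y} h with y Fin.≟ x
  ... | yes refl = x∈p
  ... | no y≢x = ∈-remove p x (∈-add⁻ (p - x) x h y≢x)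
  from : p ⊆ (p - x) ∪ ⁅ x ⁆
  from {y} h with y Fin.≟ x
  ... | yes refl = ∈-add (p - x) x
  ... | no y≢x = p⊆p∪q ⁅ x ⁆ (x∈p∧x≢y⇒x∈p-y h y≢x)

remove-add : ∀ (p : Subset n) x → x ∉ p → (p ∪ ⁅ x ⁆) - x ≡ p
remove-add p x x∉p = ⊆-antisym to from
  where
  to : (p ∪ ⁅ x ⁆) - x ⊆ p
  to {y} h with y Fin.≟ x
  ... | yes refl = ⊥-elim (x∉p-x (p ∪ ⁅ x ⁆) x h)
  ... | no y≢x = ∈-add⁻ p x (∈-remove (p ∪ ⁅ x ⁆) x h) y≢x
  from : p ⊆ (p ∪ ⁅ x ⁆) - x
  from h = x∈p∧x≢y⇒x∈p-y (p⊆p∪q ⁅ x ⁆ h) λ { refl → x∉p h }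

∣p∪q∣+∣p∩q∣ : ∀ (p q : Subset n) → ∣ p ∪ q ∣ + ∣ p ∩ q ∣ ≡ ∣ p ∣ + ∣ q ∣
∣p∪q∣+∣p∩q∣ [] [] = refl
∣p∪q∣+∣p∩q∣ (true ∷ p)  (true ∷ q)  = cong suc (trans (+-suc _ _) (trans (cong suc (∣p∪q∣+∣p∩q∣ p q)) (sym (+-suc _ _))))
∣p∪q∣+∣p∩q∣ (true ∷ p)  (false ∷ q) = cong suc (∣p∪q∣+∣p∩q∣ p q)
∣p∪q∣+∣p∩q∣ (false ∷ p) (true ∷ q)  = trans (cong suc (∣p∪q∣+∣p∩q∣ p q)) (sym (+-suc _ _))
∣p∪q∣+∣p∩q∣ (false ∷ p) (false ∷ q) = ∣p∪q∣+∣p∩q∣ p q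

∣p∪q∣-disjoint : ∀ (p q : Subset n) → (∀ {x} → x ∈ p → x ∉ q) → ∣ p ∪ q ∣ ≡ ∣ p ∣ + ∣ q ∣
∣p∪q∣-disjoint {n} p q disj = trans (sym (+-identityʳ _)) (trans (cong (∣ p ∪ q ∣ +_) (sym empty)) (∣p∪q∣+∣p∩q∣ p q))
  where
  empty : ∣ p ∩ q ∣ ≡ 0
  empty = trans (cong ∣_∣ (Empty-unique λ (x , h) → let (a , b) = x∈p∩q⁻ p q h in disj a b)) (∣⊥∣≡0 n)

∣add∣ : ∀ (p : Subset n) x → x ∉ p → ∣ p ∪ ⁅ x ⁆ ∣ ≡ suc ∣ p ∣
∣add∣ p x x∉p = trans (∣p∪q∣-disjoint p ⁅ x ⁆ λ h h' → x∉p (subst (_∈ p) (x∈⁅y⁆⇒x≡y x h') h))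
  (trans (cong (∣ p ∣ +_) (∣⁅x⁆∣≡1 x)) (+-comm _ 1))

∣remove∣ : ∀ (p : Subset n) x → x ∈ p → suc ∣ p - x ∣ ≡ ∣ p ∣
∣remove∣ p x x∈p = trans (sym (∣add∣ (p - x) x (x∉p-x p x))) (cong ∣_∣ (add-remove p x x∈p))

∣S∣≡0⇒x∉S : (S : Subset n) → ∣ S ∣ ≡ 0 → ∀ {x} → x ∉ S
∣S∣≡0⇒x∉S (false ∷ S) h (there x∈S) = ∣S∣≡0⇒x∉S S h x∈S

nonempty : (S : Subset n) → 0 < ∣ S ∣ → Nonempty S
nonempty {n} S 0<∣S∣ with nonempty? S
... | yes h = h
... | no ¬h = ⊥-elim (<-irrefl (sym (trans (cong ∣_∣ (Empty-unique ¬h)) (∣⊥∣≡0 n))) 0<∣S∣)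

⊆∧∣∣≥⇒⊇ : (A B : Subset n) → A ⊆ B → ∣ B ∣ ≤ ∣ A ∣ → B ⊆ A
⊆∧∣∣≥⇒⊇ A B A⊆B B≤A {x} x∈B with x ∈? A
... | yes x∈A = x∈A
... | no x∉A = ⊥-elim (<-irrefl refl (≤-trans (p⊂q⇒∣p∣<∣q∣ (A⊆B , x , x∈B , x∉A)) B≤A))

between : (A U : Subset n) → A ⊆ U → ∀ m → ∣ A ∣ ≤ m → m ≤ ∣ U ∣ →
          ∃ λ B → A ⊆ B × B ⊆ U × ∣ B ∣ ≡ m
between [] [] _ zero _ _ = [] , id , id , refl
between (true ∷ A) (false ∷ U) A⊆U m _ _ with A⊆U here
... | ()
between (true ∷ A) (true ∷ U) A⊆U (suc m) (s≤s A≤m) (s≤s m≤U) =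
  let (B , A⊆B , B⊆U , ∣B∣) = between A U (drop-∷-⊆ A⊆U) m A≤m m≤U
  in true ∷ B , in⊆in A⊆B , in⊆in B⊆U , cong suc ∣B∣
between (false ∷ A) (false ∷ U) A⊆U m A≤m m≤U =
  let (B , A⊆B , B⊆U , ∣B∣) = between A U (drop-∷-⊆ A⊆U) m A≤m m≤U
  in false ∷ B , s⊆s A⊆B , s⊆s B⊆U , ∣B∣
between (false ∷ A) (true ∷ U) A⊆U m A≤m m≤U with m ≤? ∣ U ∣
... | yes m≤U' =
  let (B , A⊆B , B⊆U , ∣B∣) = between A U (drop-∷-⊆ A⊆U) m A≤m m≤U'
  in false ∷ B , s⊆s A⊆B , out⊆ B⊆U , ∣B∣
... | no m≰U' = true ∷ U , A⊆U , id , ≤-antisym (≰⇒> m≰U') m≤U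

-- Binomial coefficients and the number of sets between two given ones

pascal : ∀ n k → suc n C suc k ≡ n C k + n C suc k
pascal n k = sym (nCk+nC[k+1]≡[n+1]C[k+1] n k)

C-zero : ∀ n → n C 0 ≡ 1
C-zero zero    = refl
C-zero (suc n) = refl

C-zeroˡ : ∀ k → 0 C suc k ≡ 0
C-zeroˡ k = k>n⇒nCk≡0 {0} {suc k} (s≤s z≤n)

C-pos : ∀ n k → k ≤ n → 0 < n C k
C-pos n       zero    _         = ≤-reflexive (sym (C-zero n))
C-pos (suc n) (suc k) (s≤s k≤n) = ≤-trans (C-pos n k k≤n) (≤-trans (m≤m+n _ _) (≤-reflexive (sym (pascal n k))))

C-suc : ∀ n k → n C k ≤ suc n C k
C-suc n zero    = ≤-reflexive (trans (C-zero n) (sym (C-zero (suc n))))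
C-suc n (suc k) = ≤-trans (m≤n+m _ _) (≤-reflexive (sym (pascal n k)))

C-mono : ∀ {m n} k → m ≤ n → m C k ≤ n C k
C-mono {m} k m≤n with m≤n⇒∃[o]m+o≡n m≤n
... | o , refl = go o
  where
  go : ∀ o → m C k ≤ (m + o) C k
  go zero    = ≤-reflexive (cong (_C k) (sym (+-identityʳ m)))
  go (suc o) = ≤-trans (go o) (≤-trans (C-suc (m + o) k) (≤-reflexive (cong (_C k) (sym (+-suc m o)))))

absorption : ∀ n k → suc k * (suc n C suc k) ≡ suc n * (n C k)
absorption zero zero = refl
absorption zero (suc k) = begin
  suc (suc k) * (1 C suc (suc k)) ≡⟨ cong (suc (suc k) *_) (k>n⇒nCk≡0 {1} {suc (suc k)} (s≤s (s≤s z≤n))) ⟩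
  suc (suc k) * 0                 ≡⟨ *-zeroʳ (suc (suc k)) ⟩
  0                               ≡⟨ cong (1 *_) (C-zeroˡ k) ⟨
  1 * (0 C suc k)                 ∎ where open ≡-Reasoning
absorption (suc n) zero = begin
  1 * (suc (suc n) C 1)           ≡⟨ cong (1 *_) (nC1≡n (suc (suc n))) ⟩
  1 * suc (suc n)                 ≡⟨ *-comm 1 (suc (suc n)) ⟩
  suc (suc n) * 1                 ∎ where open ≡-Reasoning
absorption (suc n) (suc k) = begin
  suc (suc k) * (suc (suc n) C suc (suc k))
    ≡⟨ cong (suc (suc k) *_) (pascal (suc n) (suc k)) ⟩
  suc (suc k) * (a + b)
    ≡⟨ solve 3 (λ k a b → (con 2 :+ k) :* (a :+ b) := a :+ (con 1 :+ k) :* a :+ (con 2 :+ k) :* b) refl k a b ⟩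
  a + suc k * a + suc (suc k) * b
    ≡⟨ cong₂ (λ x y → a + x + y) (absorption n k) (absorption n (suc k)) ⟩
  a + suc n * (n C k) + suc n * (n C suc k)
    ≡⟨ solve 4 (λ n a x y → a :+ (con 1 :+ n) :* x :+ (con 1 :+ n) :* y := a :+ (con 1 :+ n) :* (x :+ y)) refl n a (n C k) (n C suc k) ⟩
  a + suc n * (n C k + n C suc k)
    ≡⟨ cong (λ x → a + suc n * x) (pascal n k) ⟨
  suc (suc n) * a ∎
  where
  open ≡-Reasoning
  open +-*-Solver
  a = suc n C suc k
  b = suc n C suc (suc k)

-- The ratio `c` to `suc j` is that of the cliques on `suc j` vertices to the edges in the complete
-- `j`-uniform family on `j + c` vertices; it is the constant of the linear clique bound.
absorption′ : ∀ j c → suc j * ((j + c) C suc j) ≡ c * ((j + c) C j)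
absorption′ j c = +-cancelˡ-≡ (suc j * x) _ _ (begin
  suc j * x + suc j * y       ≡⟨ *-distribˡ-+ (suc j) x y ⟨
  suc j * (x + y)             ≡⟨ cong (suc j *_) (pascal (j + c) j) ⟨
  suc j * (suc (j + c) C suc j) ≡⟨ absorption (j + c) j ⟩
  suc (j + c) * x             ≡⟨ *-distribʳ-+ x (suc j) c ⟩
  suc j * x + c * x           ∎)
  where
  open ≡-Reasoning
  x = (j + c) C j
  y = (j + c) C suc j

in⊈out : {p q : Subset n} → ¬ (inside ∷ p ⊆ outside ∷ q)
in⊈out h with h here
... | ()

Between : (A U : Subset n) (s : ℕ) → Subset n → Set
Between A U s S = A ⊆ S × S ⊆ U × ∣ S ∣ ≡ s

between? : (A U : Subset n) (s : ℕ) → ∀ S → Dec (Between A U s S)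
between? A U s S = (A ⊆? S) ×-dec (S ⊆? U) ×-dec (∣ S ∣ ≟ s)

#-between : (A U : Subset n) → A ⊆ U → ∀ r → ∣ U ∣ ≡ ∣ A ∣ + r → ∀ s →
            # (between? A U (∣ A ∣ + s)) ≡ r C s
#-between [] [] _ zero _ zero    = refl
#-between [] [] _ zero _ (suc s) = sym (C-zeroˡ s)
#-between {suc n} (a ∷ A) (u ∷ U) A⊆U r e s =
  trans (∑ˢ-suc (λ S → ind (between? (a ∷ A) (u ∷ U) (∣ a ∷ A ∣ + s) S))) (go a u A⊆U e)
  where
  half : ∀ a u b t → ℕ
  half a u b t = # (λ S → between? (a ∷ A) (u ∷ U) t (b ∷ S))
  f-part : ∀ t u → half false u false t ≡ # (between? A U t)
  f-part t u = #-cong _ (between? A U t)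
    (λ S (h , h' , q) → drop-∷-⊆ h , drop-∷-⊆ h' , q)
    (λ S (h , h' , q) → s⊆s h , out⊆ h' , q)
  go : ∀ a' u' → a' ∷ A ⊆ u' ∷ U → ∣ u' ∷ U ∣ ≡ ∣ a' ∷ A ∣ + r →
       half a' u' true (∣ a' ∷ A ∣ + s) + half a' u' false (∣ a' ∷ A ∣ + s) ≡ r C s
  go true false h e = ⊥-elim (in⊈out h)
  go true true h e = trans (cong₂ _+_
      (trans (#-cong _ (between? A U (∣ A ∣ + s))
        (λ S (h , h' , q) → drop-∷-⊆ h , drop-∷-⊆ h' , suc-injective q)
        (λ S (h , h' , q) → in⊆in h , in⊆in h' , cong suc q))
        (#-between A U (drop-∷-⊆ h) r (suc-injective e) s))
      (#-none (λ S → between? (true ∷ A) (true ∷ U) (∣ true ∷ A ∣ + s) (false ∷ S)) λ S (h , _) → in⊈out {p = A} {q = S} h))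
    (+-identityʳ _)
  go false false h e = trans (cong₂ _+_
      (#-none (λ S → between? (false ∷ A) (false ∷ U) (∣ false ∷ A ∣ + s) (true ∷ S)) λ S (_ , h , _) → in⊈out {p = S} {q = U} h)
      (trans (f-part _ false) (#-between A U (drop-∷-⊆ h) r e s))) refl
  go false true h e = rec r s e
    where
    A⊆U' = drop-∷-⊆ h
    rec : ∀ r s → suc ∣ U ∣ ≡ ∣ A ∣ + r →
          half false true true (∣ A ∣ + s) + half false true false (∣ A ∣ + s) ≡ r C s
    rec zero s e = ⊥-elim (<-irrefl refl (≤-trans (≤-reflexive (trans e (+-identityʳ _))) (p⊆q⇒∣p∣≤∣q∣ A⊆U')))
    rec (suc r) zero e = cong₂ _+_
      (#-none (λ S → between? (false ∷ A) (true ∷ U) (∣ A ∣ + 0) (true ∷ S)) λ S (h , h' , q) →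
          <-irrefl refl (≤-trans (≤-reflexive (trans q (+-identityʳ _))) (p⊆q⇒∣p∣≤∣q∣ (drop-∷-⊆ h))))
      (trans (f-part _ true) (trans (#-between A U A⊆U' r (suc-injective (trans e (+-suc _ r))) 0) (C-zero r)))
    rec (suc r) (suc s) e = trans (cong₂ _+_
      (trans (#-cong _ (between? A U (∣ A ∣ + s))
        (λ S (h , h' , q) → drop-∷-⊆ h , drop-∷-⊆ h' , suc-injective (trans q (+-suc ∣ A ∣ s)))
        (λ S (h , h' , q) → out⊆ h , in⊆in h' , trans (cong suc q) (sym (+-suc ∣ A ∣ s))))
        (#-between A U A⊆U' r e' s))
      (trans (f-part _ true) (#-between A U A⊆U' r e' (suc s))))
      (sym (pascal r s))
      where e' = suc-injective (trans e (+-suc _ r))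

#-⊆ : (U : Subset n) (s : ℕ) → # (λ S → (S ⊆? U) ×-dec (∣ S ∣ ≟ s)) ≡ ∣ U ∣ C s
#-⊆ {n} U s = trans (#-cong _ (between? ∅ U (∣ ∅ {n} ∣ + s))
    (λ S (h , q) → ⊆-min S , h , trans q (cong (_+ s) (sym (∣⊥∣≡0 n))))
    (λ S (_ , h , q) → h , trans q (cong (_+ s) (∣⊥∣≡0 n))))
  (#-between ∅ U (⊆-min U) ∣ U ∣ (cong (_+ ∣ U ∣) (sym (∣⊥∣≡0 n))) s)

∑ᵛ-∋ : {P : Subset n → Set} (P? : ∀ S → Dec (P S)) (s : ℕ) → (∀ S → P S → ∣ S ∣ ≡ s) →
       ∑ᵛ (λ v → # (λ S → (v ∈? S) ×-dec P? S)) ≡ s * # P?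
∑ᵛ-∋ {n} P? s size = trans (∑-swap (vertices n) (allSubsets n) _)
  (trans (∑-cong (allSubsets n) λ S → trans (∑-cong (vertices n) λ v → trans (ind-× (v ∈? S) (P? S)) (*-comm (ind (v ∈? S)) _))
    (trans (∑-*ˡ (vertices n) (ind (P? S)) _) (trans (cong (ind (P? S) *_) (∑ᵛ-∈ S)) (lem S))))
  (∑-*ˡ (allSubsets n) s _))
  where
  lem : ∀ S → ind (P? S) * ∣ S ∣ ≡ s * ind (P? S)
  lem S with P? S
  ... | yes p = trans (+-identityʳ _) (trans (size S p) (sym (*-identityʳ s)))
  ... | no _  = sym (*-zeroʳ s)

-- Uniform families and their cliques

⟪_⟫ : {P : Fin n → Set} → (∀ v → Dec (P v)) → Subset n
⟪ P? ⟫ = tabulate (λ v → does (P? v))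

∈⟪⟫⁺ : {P : Fin n → Set} (P? : ∀ v → Dec (P v)) {v : Fin n} → P v → v ∈ ⟪ P? ⟫
∈⟪⟫⁺ P? {v} p = lookup⇒[]= v _ (trans (lookup∘tabulate (λ v → does (P? v)) v) (Relation.Nullary.Decidable.dec-true (P? v) p))

∈⟪⟫⁻ : {P : Fin n → Set} (P? : ∀ v → Dec (P v)) {v : Fin n} → v ∈ ⟪ P? ⟫ → P v
∈⟪⟫⁻ P? {v} h with P? v | trans (sym (lookup∘tabulate (λ v → does (P? v)) v)) ([]=⇒lookup h)
... | yes p | _ = p

∣⟪⟫∣ : {P : Fin n → Set} (P? : ∀ v → Dec (P v)) → ∣ ⟪ P? ⟫ ∣ ≡ ∑ᵛ (λ v → ind (P? v))
∣⟪⟫∣ {n} P? = trans (sym (∑ᵛ-∈ ⟪ P? ⟫)) (∑-cong (vertices n) λ v →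
  ≤-antisym (ind-mono (v ∈? ⟪ P? ⟫) (P? v) (∈⟪⟫⁻ P?)) (ind-mono (P? v) (v ∈? ⟪ P? ⟫) (∈⟪⟫⁺ P?)))

∀ˢ? : {P : Subset n → Set} → (∀ S → Dec (P S)) → Dec (∀ S → P S)
∀ˢ? P? with anySubset? (λ S → ¬? (P? S))
... | yes (S , ¬p) = no λ p → ¬p (p S)
... | no h = yes λ S → Relation.Nullary.Decidable.decidable-stable (P? S) λ ¬p → h (S , ¬p)

Uniform : ℕ → (Subset n → Set) → Set
Uniform j D = ∀ S → D S → ∣ S ∣ ≡ j

Link : Fin n → (Subset n → Set) → Subset n → Set
Link v D S = v ∉ S × D (S ∪ ⁅ v ⁆)

-- The copies of the complete `j`-uniform family on `suc j` vertices, one more than an edge has.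
-- Describing them by deletion of a vertex lets the notion pass to links and be iterated.
Cl : ℕ → (Subset n → Set) → Subset n → Set
Cl j D S = ∣ S ∣ ≡ suc j × (∀ v → v ∈ S → D (S - v))

∑ᵛ-mono-< : {f g : Fin n → ℕ} → (∀ v → f v ≤ g v) → (v : Fin n) → f v < g v → ∑ᵛ f < ∑ᵛ g
∑ᵛ-mono-< {n} {f} {g} f≤g v f<g = begin-strict
  ∑ᵛ f                                    <⟨ n<1+n _ ⟩
  suc (∑ᵛ f)                              ≡⟨ +-comm 1 _ ⟩
  ∑ᵛ f + 1                                ≡⟨ cong (∑ᵛ f +_) (∑ᵛ-single v) ⟨
  ∑ᵛ f + ∑ᵛ (λ w → ind (v Fin.≟ w))       ≡⟨ ∑-+ (vertices n) f _ ⟨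
  ∑ᵛ (λ w → f w + ind (v Fin.≟ w))        ≤⟨ ∑-mono (vertices n) pt ⟩
  ∑ᵛ g                                    ∎
  where
  open ≤-Reasoning
  pt : ∀ w → f w + ind (v Fin.≟ w) ≤ g w
  pt w with v Fin.≟ w
  ... | yes refl = ≤-trans (≤-reflexive (+-comm (f v) 1)) f<g
  ... | no _     = ≤-trans (≤-reflexive (+-identityʳ (f w))) (f≤g w)

module _ {D : Subset n → Set} (D? : ∀ S → Dec (D S)) where

  link? : (v : Fin n) → ∀ S → Dec (Link v D S)
  link? v S = ¬? (v ∈? S) ×-dec D? (S ∪ ⁅ v ⁆)

  cl? : (j : ℕ) → ∀ S → Dec (Cl j D S)
  cl? j S = (∣ S ∣ ≟ suc j) ×-dec Fin.all? (λ v → (v ∈? S) →-dec D? (S - v))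

  #-link : (v : Fin n) → # (λ S → (v ∈? S) ×-dec D? S) ≡ # (link? v)
  #-link v = ≤-antisym
    (#-inj _ (link? v) (_- v) (_∪ ⁅ v ⁆)
      (λ S (v∈S , d) → x∉p-x S v , subst D (sym (add-remove S v v∈S)) d)
      (λ S (v∈S , d) → add-remove S v v∈S))
    (#-inj (link? v) _ (_∪ ⁅ v ⁆) (_- v)
      (λ S (v∉S , d) → ∈-add S v , d)
      (λ S (v∉S , d) → remove-add S v v∉S))

module Shadow {D : Subset n → Set} (D? : ∀ S → Dec (D S)) (j : ℕ) (unif : Uniform (suc j) D) (v : Fin n) where

  deg cliques : ℕ
  deg     = # (link? D? v)
  cliques = # (λ S → (v ∈? S) ×-dec cl? D? (suc j) S)

  link-uniform : Uniform j (Link v D)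
  link-uniform S (v∉S , d) = suc-injective (trans (sym (∣add∣ S v v∉S)) (unif _ d))

  cliques≤link : cliques ≤ # (cl? (link? D? v) j)
  cliques≤link = #-inj _ (cl? (link? D? v) j) (_- v) (_∪ ⁅ v ⁆) to (λ S (v∈S , _) → add-remove S v v∈S)
    where
    to : ∀ S → v ∈ S × Cl (suc j) D S → Cl j (Link v D) (S - v)
    to S (v∈S , ∣S∣ , d) = suc-injective (trans (∣remove∣ S v v∈S) ∣S∣) , λ w w∈ →
      (λ h → x∉p-x S v (∈-remove (S - v) w h)) ,
      subst D (sym (trans (cong (_∪ ⁅ v ⁆) (p─x─y≡p─y─x S v w))
          (add-remove (S - w) v (x∈p∧x≢y⇒x∈p-y v∈S λ { refl → x∉p-x S v w∈ }))))
        (d w (∈-remove S v w∈))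

  -- Deleting `v` embeds the cliques at `v` into the members of `D` that avoid `v`, and the degree
  -- counts all the others.
  cliques+deg≤ : cliques + deg ≤ # D?
  cliques+deg≤ = begin
    cliques + deg                             ≤⟨ +-monoˡ-≤ deg (#-inj _ (λ S → D? S ×-dec ¬? (v ∈? S)) (_- v) (_∪ ⁅ v ⁆)
      (λ S (v∈S , _ , d) → d v v∈S , x∉p-x S v) (λ S (v∈S , _) → add-remove S v v∈S)) ⟩
    # (λ S → D? S ×-dec ¬? (v ∈? S)) + deg    ≡⟨ +-comm _ deg ⟩
    deg + # (λ S → D? S ×-dec ¬? (v ∈? S))    ≡⟨ cong (_+ # (λ S → D? S ×-dec ¬? (v ∈? S))) (trans (sym (#-link D? v)) (#-cong _ (λ S → D? S ×-dec v ∈? S) (λ _ (a , b) → b , a) (λ _ (a , b) → b , a))) ⟩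
    # (λ S → D? S ×-dec v ∈? S) + # (λ S → D? S ×-dec ¬? (v ∈? S)) ≡⟨ #-split D? (v ∈?_) ⟨
    # D?                                      ∎
    where open ≤-Reasoning

  cliques≡0 : deg ≡ 0 → cliques ≡ 0
  cliques≡0 deg≡0 = n≤0⇒n≡0 (≤-trans cliques≤link (≤-reflexive (#-none (cl? (link? D? v) j) λ S (∣S∣ , d) →
    let (w , w∈S) = nonempty S (≤-trans (s≤s z≤n) (≤-reflexive (sym ∣S∣)))
    in <-irrefl (sym deg≡0) (#-pos (link? D? v) (S - w) (d w w∈S)))))

  -- If the degree of v is less than that in a clique on suc j + c vertices, the bound on the cliques
  -- at v comes from the link (the hypothesis ih), and otherwise from cliques+deg≤.
  module _ (c : ℕ) (ih : 0 < deg → deg < (j + c) C j → suc j * # (cl? (link? D? v) j) < c * deg) where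

    -- By Pascal's rule a large degree leaves at most `(j + c) C suc j` members of `D` avoiding `v`,
    -- which bounds the cliques at `v`. The slack `x` is 1 where a strict bound is wanted and 0
    -- otherwise.
    large : ∀ x → # D? + x ≤ (suc j + c) C suc j → (j + c) C j ≤ deg → suc j * (cliques + x) ≤ c * ((j + c) C j)
    large x D+x≤ deg≥ = begin
      suc j * (cliques + x)        ≤⟨ *-monoʳ-≤ (suc j) (+-cancelʳ-≤ ((j + c) C j) _ _ (begin
         cliques + x + (j + c) C j     ≤⟨ +-monoʳ-≤ (cliques + x) deg≥ ⟩
         cliques + x + deg             ≡⟨ solve 3 (λ a b c → a :+ b :+ c := a :+ c :+ b) refl cliques x deg ⟩
         cliques + deg + x             ≤⟨ +-monoˡ-≤ x cliques+deg≤ ⟩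
         # D? + x                      ≤⟨ D+x≤ ⟩
         (suc j + c) C suc j           ≡⟨ pascal (j + c) j ⟩
         (j + c) C j + (j + c) C suc j ≡⟨ +-comm ((j + c) C j) _ ⟩
         (j + c) C suc j + (j + c) C j ∎)) ⟩
      suc j * ((j + c) C suc j)    ≡⟨ absorption′ j c ⟩
      c * ((j + c) C j)            ∎
      where
      open ≤-Reasoning
      open +-*-Solver

    cliques< : 0 < deg → (# D? < (suc j + c) C suc j) ⊎ (# D? ≤ (suc j + c) C suc j × deg ≢ (j + c) C j × 0 < c) →
               suc j * cliques < c * deg
    cliques< 0<deg h with deg <? (j + c) C j
    ... | yes deg< = ≤-<-trans (*-monoʳ-≤ (suc j) cliques≤link) (ih 0<deg deg<)
    ... | no deg≮ with h
    ...   | inj₁ D< = <-≤-trans (*-monoʳ-< (suc j) (≤-reflexive (+-comm 1 cliques)))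
      (≤-trans (large 1 (≤-trans (≤-reflexive (+-comm _ 1)) D<) (≮⇒≥ deg≮)) (*-monoʳ-≤ c (≮⇒≥ deg≮)))
    ...   | inj₂ (D≤ , deg≢ , s≤s _) = ≤-<-trans (*-monoʳ-≤ (suc j) (≤-reflexive (sym (+-identityʳ cliques))))
      (≤-<-trans (large 0 (≤-trans (≤-reflexive (+-identityʳ _)) D≤) (≮⇒≥ deg≮))
        (*-monoʳ-< c (≤∧≢⇒< (≮⇒≥ deg≮) (deg≢ ∘ sym))))

    cliques≤ : # D? ≤ (suc j + c) C suc j → suc j * cliques ≤ c * deg
    cliques≤ D≤ with deg ≟ 0
    ... | yes deg≡0 = ≤-trans (≤-reflexive (trans (cong (suc j *_) (cliques≡0 deg≡0)) (*-zeroʳ (suc j)))) z≤n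
    ... | no deg≢0 with deg <? (j + c) C j
    ...   | yes deg< = <⇒≤ (≤-<-trans (*-monoʳ-≤ (suc j) cliques≤link) (ih (n≢0⇒n>0 deg≢0) deg<))
    ...   | no deg≮ = ≤-trans (*-monoʳ-≤ (suc j) (≤-reflexive (sym (+-identityʳ cliques))))
      (≤-trans (large 0 (≤-trans (≤-reflexive (+-identityʳ _)) D≤) (≮⇒≥ deg≮)) (*-monoʳ-≤ c (≮⇒≥ deg≮)))

∑-cliques : {D : Subset n → Set} (D? : ∀ S → Dec (D S)) (j : ℕ) →
            ∑ᵛ (λ v → suc j * # (λ S → (v ∈? S) ×-dec cl? D? (suc j) S)) ≡ suc j * (suc (suc j) * # (cl? D? (suc j)))
∑-cliques {n} D? j = trans (∑-*ˡ (vertices n) (suc j) _) (cong (suc j *_) (∑ᵛ-∋ (cl? D? (suc j)) (suc (suc j)) λ _ → proj₁))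

∑-deg : {D : Subset n → Set} (D? : ∀ S → Dec (D S)) (j : ℕ) → Uniform j D →
        ∑ᵛ (λ v → # (link? D? v)) ≡ j * # D?
∑-deg {n} D? j unif = trans (∑-cong (vertices n) λ v → sym (#-link D? v)) (∑ᵛ-∋ D? j unif)

*-swap : ∀ a b c → a * (b * c) ≡ b * (a * c)
*-swap = solve 3 (λ a b c → a :* (b :* c) := b :* (a :* c)) refl
  where open +-*-Solver

-- The bound is linear in the size of the family, so it holds for `D` once it holds for the cliques
-- and the degree at every vertex: summing over the vertices counts each clique and each member by
-- its size. Equality occurs for the complete family on `j + c` vertices; below that size a vertex
-- of positive degree already loses.
#-cl-< : ∀ j c {D : Subset n → Set} (D? : ∀ S → Dec (D S)) → Uniform j D → 0 < # D? → # D? < (j + c) C j →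
         suc j * # (cl? D? j) < c * # D?
#-cl-< zero c D? unif 0<D D< = ⊥-elim (<-irrefl refl (<-≤-trans (≤-<-trans 0<D D<) (≤-reflexive (C-zero c))))
#-cl-< {n} (suc j) c {D} D? unif 0<D D< with #-∃ D? 0<D
... | S , d with nonempty S (≤-trans (s≤s z≤n) (≤-reflexive (sym (unif S d))))
... | v , v∈S = *-cancelˡ-< (suc j) _ _ (begin-strict
  suc j * (suc (suc j) * # (cl? D? (suc j)))          ≡⟨ ∑-cliques D? j ⟨
  ∑ᵛ (λ v → suc j * Shadow.cliques D? j unif v)       <⟨ ∑ᵛ-mono-< (λ w → Shadow.cliques≤ D? j unif w c (ih w) (<⇒≤ D<)) v
                                                           (Shadow.cliques< D? j unif v c (ih v) 0<deg (inj₁ D<)) ⟩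
  ∑ᵛ (λ v → c * # (link? D? v))                       ≡⟨ ∑-*ˡ (vertices n) c _ ⟩
  c * ∑ᵛ (λ v → # (link? D? v))                       ≡⟨ cong (c *_) (∑-deg D? (suc j) unif) ⟩
  c * (suc j * # D?)                                  ≡⟨ *-swap c (suc j) (# D?) ⟩
  suc j * (c * # D?)                                  ∎)
  where
  open ≤-Reasoning
  ih : ∀ w → 0 < # (link? D? w) → # (link? D? w) < (j + c) C j → suc j * # (cl? (link? D? w) j) < c * # (link? D? w)
  ih w = #-cl-< j c (link? D? w) (Shadow.link-uniform D? j unif w)
  0<deg : 0 < # (link? D? v)
  0<deg = ≤-trans (#-pos (λ S → (v ∈? S) ×-dec D? S) S (v∈S , d)) (≤-reflexive (#-link D? v))

-- The sum over the vertices now leaves no loss, so every nonzero degree equals `(j + c) C j`.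
-- Counting incidences then gives the number of vertices in the support `U`, and `D` has as many
-- members as `U` has subsets of that size.
#-cl-equality : ∀ j c {D : Subset n → Set} (D? : ∀ S → Dec (D S)) → Uniform (suc j) D → 0 < c →
                # D? ≡ (suc j + c) C suc j → (suc j + c) C suc (suc j) ≤ # (cl? D? (suc j)) →
                ∃ λ U → ∣ U ∣ ≡ suc j + c × (∀ S → D S → S ⊆ U) × (∀ S → S ⊆ U → ∣ S ∣ ≡ suc j → D S)
#-cl-equality {n} j c {D} D? unif 0<c D≡ cl≥ = U , ∣U∣ , D⊆U , λ S S⊆U ∣S∣ →
    #-full D? (λ S → (S ⊆? U) ×-dec (∣ S ∣ ≟ suc j)) (λ S d → (λ {x} → D⊆U S d {x}) , unif S d)
      (≤-reflexive (trans (#-⊆ U (suc j)) (trans (cong (_C suc j) ∣U∣) (sym D≡)))) S (S⊆U , ∣S∣)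
  where
  open ≤-Reasoning
  deg : Fin n → ℕ
  deg v = # (link? D? v)
  ih : ∀ w → 0 < deg w → deg w < (j + c) C j → suc j * # (cl? (link? D? w) j) < c * deg w
  ih w = #-cl-< j c (link? D? w) (Shadow.link-uniform D? j unif w)
  deg≡ : ∀ v → 0 < deg v → deg v ≡ (j + c) C j
  deg≡ v 0<deg with deg v ≟ (j + c) C j
  ... | yes h = h
  ... | no deg≢ = ⊥-elim (<-irrefl refl (begin-strict
    suc j * (suc (suc j) * # (cl? D? (suc j)))          ≡⟨ ∑-cliques D? j ⟨
    ∑ᵛ (λ v → suc j * Shadow.cliques D? j unif v)       <⟨ ∑ᵛ-mono-< (λ w → Shadow.cliques≤ D? j unif w c (ih w) (≤-reflexive D≡)) v
                                                             (Shadow.cliques< D? j unif v c (ih v) 0<deg (inj₂ (≤-reflexive D≡ , deg≢ , 0<c))) ⟩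
    ∑ᵛ (λ v → c * # (link? D? v))                       ≡⟨ ∑-*ˡ (vertices n) c _ ⟩
    c * ∑ᵛ (λ v → # (link? D? v))                       ≡⟨ cong (c *_) (∑-deg D? (suc j) unif) ⟩
    c * (suc j * # D?)                                  ≡⟨ *-swap c (suc j) (# D?) ⟩
    suc j * (c * # D?)                                  ≡⟨ cong (λ x → suc j * (c * x)) D≡ ⟩
    suc j * (c * ((suc j + c) C suc j))                 ≡⟨ cong (suc j *_) (absorption′ (suc j) c) ⟨
    suc j * (suc (suc j) * ((suc j + c) C suc (suc j))) ≤⟨ *-monoʳ-≤ (suc j) (*-monoʳ-≤ (suc (suc j)) cl≥) ⟩
    suc j * (suc (suc j) * # (cl? D? (suc j)))          ∎))
  support? : ∀ v → Dec (0 < deg v)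
  support? v = 0 <? deg v
  U : Subset n
  U = ⟪ support? ⟫
  D⊆U : ∀ S → D S → S ⊆ U
  D⊆U S d {v} v∈S = ∈⟪⟫⁺ support? (≤-trans (#-pos (λ S → (v ∈? S) ×-dec D? S) S (v∈S , d)) (≤-reflexive (#-link D? v)))
  term : ∀ v → ((j + c) C j) * ind (support? v) ≡ deg v
  term v with support? v
  ... | yes 0<deg = trans (*-identityʳ _) (sym (deg≡ v 0<deg))
  ... | no ¬0<deg = trans (*-zeroʳ ((j + c) C j)) (sym (n≤0⇒n≡0 (≮⇒≥ ¬0<deg)))
  ∣U∣ : ∣ U ∣ ≡ suc j + c
  ∣U∣ = *-cancelˡ-≡ ∣ U ∣ (suc j + c) ((j + c) C j) {{>-nonZero (C-pos (j + c) j (m≤m+n j c))}} (begin-equality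
    ((j + c) C j) * ∣ U ∣                        ≡⟨ cong (((j + c) C j) *_) (∣⟪⟫∣ support?) ⟩
    ((j + c) C j) * ∑ᵛ (λ v → ind (support? v))  ≡⟨ ∑-*ˡ (vertices n) ((j + c) C j) _ ⟨
    ∑ᵛ (λ v → ((j + c) C j) * ind (support? v))  ≡⟨ ∑-cong (vertices n) term ⟩
    ∑ᵛ deg                                     ≡⟨ ∑-deg D? (suc j) unif ⟩
    suc j * # D?                               ≡⟨ cong (suc j *_) D≡ ⟩
    suc j * (suc (j + c) C suc j)              ≡⟨ absorption (j + c) j ⟩
    suc (j + c) * ((j + c) C j)                ≡⟨ *-comm (suc (j + c)) _ ⟩
    ((j + c) C j) * (suc j + c)                  ∎)

-- Kruskal–Katona in Lovász's form, with the case of equality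

Complete : ℕ → (Subset n → Set) → ℕ → Subset n → Set
Complete j D s S = ∣ S ∣ ≡ s × (∀ T → T ⊆ S × ∣ T ∣ ≡ j → D T)

complete? : (j : ℕ) {D : Subset n → Set} (D? : ∀ S → Dec (D S)) (s : ℕ) → ∀ S → Dec (Complete j D s S)
complete? j D? s S = (∣ S ∣ ≟ s) ×-dec ∀ˢ? (λ T → ((T ⊆? S) ×-dec (∣ T ∣ ≟ j)) →-dec D? T)

complete-suc : ∀ j {D : Subset n → Set} s S → Complete j D (suc s) S → Cl s (Complete j D s) S
complete-suc j s S (∣S∣ , d) = ∣S∣ , λ v v∈S → suc-injective (trans (∣remove∣ S v v∈S) ∣S∣) ,
  λ T (T⊆ , ∣T∣) → d T ((λ x∈T → ∈-remove S v (T⊆ x∈T)) , ∣T∣)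

#-cl-C : ∀ j t {D : Subset n → Set} (D? : ∀ S → Dec (D S)) → Uniform j D → j < t → # D? < t C j → # (cl? D? j) < t C suc j
#-cl-C j t D? unif j<t D< with m≤n⇒∃[o]m+o≡n j<t
... | c , refl with # D? ≟ 0
-- The linear bound is strict for nonempty families only.
...   | yes D≡0 = ≤-<-trans (≤-reflexive (#-none (cl? D? j) λ S (∣S∣ , d) →
          let (v , v∈S) = nonempty S (≤-trans (s≤s z≤n) (≤-reflexive (sym ∣S∣)))
          in <-irrefl (sym D≡0) (#-pos D? (S - v) (d v v∈S)))) (C-pos (suc j + c) (suc j) (m≤m+n (suc j) c))
...   | no D≢0 = *-cancelˡ-< (suc j) _ _ (begin-strict
  suc j * # (cl? D? j)              <⟨ #-cl-< j (suc c) D? unif (n≢0⇒n>0 D≢0) (<-≤-trans D< (≤-reflexive (cong (_C j) (sym (+-suc j c))))) ⟩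
  suc c * # D?                      ≤⟨ *-monoʳ-≤ (suc c) (<⇒≤ D<) ⟩
  suc c * ((suc j + c) C j)         ≡⟨ cong (λ x → suc c * (x C j)) (+-suc j c) ⟨
  suc c * ((j + suc c) C j)         ≡⟨ absorption′ j (suc c) ⟨
  suc j * ((j + suc c) C suc j)     ≡⟨ cong (λ x → suc j * (x C suc j)) (+-suc j c) ⟩
  suc j * ((suc j + c) C suc j)     ∎)
  where open ≤-Reasoning

-- Climbs one size at a time: the complete sets of size `s + 1` are cliques of the family of
-- complete sets of size `s`, so a deficit against `t C s` is inherited.
#-complete-< : ∀ j s t {D : Subset n → Set} (D? : ∀ S → Dec (D S)) → j ≤ s → s ≤ t → Uniform j D →
               # D? < t C j → # (complete? j D? s) < t C s
#-complete-< j s t {D} D? j≤s s≤t unif D< with m≤n⇒∃[o]m+o≡n j≤s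
... | o , refl = go o s≤t
  where
  go : ∀ o → j + o ≤ t → # (complete? j D? (j + o)) < t C (j + o)
  go zero _ = subst (λ s → # (complete? j D? s) < t C s) (sym (+-identityʳ j))
    (≤-<-trans (#-mono (complete? j D? j) D? λ S (∣S∣ , d) → d S (id , ∣S∣)) D<)
  go (suc o) h = subst (λ s → # (complete? j D? s) < t C s) (sym (+-suc j o))
    (≤-<-trans (#-mono (complete? j D? (suc (j + o))) (cl? (complete? j D? (j + o)) (j + o)) (complete-suc j (j + o)))
      (#-cl-C (j + o) t (complete? j D? (j + o)) (λ _ → proj₁) h' (go o (<⇒≤ h'))))
    where
    h' : j + o < t
    h' = ≤-trans (≤-reflexive (sym (+-suc j o))) h

-- A deficit among the cliques just one size above `D` would climb to size `s`. Hence there is none,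
-- and the case of equality applies at that first step, which exists because `s` exceeds `suc j`.
lovász : ∀ j s t {D : Subset n → Set} (D? : ∀ S → Dec (D S)) → suc j < s → s ≤ t → Uniform (suc j) D →
         # D? ≡ t C suc j → t C s ≤ # (complete? (suc j) D? s) →
         ∃ λ U → ∣ U ∣ ≡ t × (∀ S → D S → S ⊆ U) × (∀ S → S ⊆ U → ∣ S ∣ ≡ suc j → D S)
lovász j s t {D} D? j<s s≤t unif D≡ s≥ with m≤n⇒∃[o]m+o≡n (≤-trans j<s s≤t)
... | c , eq with t C suc (suc j) ≤? # (cl? D? (suc j))
...   | yes cl≥ = subst (λ t → ∃ λ U → ∣ U ∣ ≡ t × (∀ S → D S → S ⊆ U) × (∀ S → S ⊆ U → ∣ S ∣ ≡ suc j → D S)) eq'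
          (#-cl-equality j (suc c) D? unif (s≤s z≤n) (trans D≡ (cong (_C suc j) (sym eq'))) (subst (λ t → t C suc (suc j) ≤ _) (sym eq') cl≥))
  where
  eq' : suc j + suc c ≡ t
  eq' = trans (+-suc (suc j) c) eq
...   | no cl≱ = ⊥-elim (<-irrefl refl (≤-<-trans s≥ (≤-<-trans
  (#-mono (complete? (suc j) D? s) (complete? (suc (suc j)) (cl? D? (suc j)) s)
    λ S (∣S∣ , d) → ∣S∣ , λ T (T⊆S , ∣T∣) → ∣T∣ , λ v v∈T → d (T - v) ((λ x∈ → T⊆S (∈-remove T v x∈)) , suc-injective (trans (∣remove∣ T v v∈T) ∣T∣)))
  (#-complete-< (suc (suc j)) s t (cl? D? (suc j)) j<s s≤t (λ _ → proj₁) (≰⇒> cl≱)))))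

-- Colexicographic ranks and the Kruskal–Katona theorem

-- The entry at the head of a vector stands for the largest element, so that rank q R is the sum of the
-- binomial coefficients r₁ C q + r₂ C (q - 1) + … over the q largest elements r₁ > r₂ > … of R.
rank : ℕ → Subset m → ℕ
rank zero    R                 = 0
rank (suc q) []                = 0
rank (suc q) (_∷_ {m} true  R) = m C suc q + rank q R
rank (suc q) (false ∷ R)       = rank (suc q) R

rank-[] : ∀ q → rank q [] ≡ 0
rank-[] zero    = refl
rank-[] (suc q) = refl

rank-≤C : ∀ q (R : Subset m) → rank q R ≤ m C q
rank-≤C         zero    R           = z≤n
rank-≤C         (suc q) []          = z≤n
rank-≤C {suc m} (suc q) (true ∷ R)  = ≤-trans (+-monoʳ-≤ (m C suc q) (rank-≤C q R))
  (≤-reflexive (trans (+-comm (m C suc q) _) (sym (pascal m q))))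
rank-≤C {suc m} (suc q) (false ∷ R) = ≤-trans (rank-≤C (suc q) R) (C-suc m (suc q))

rank-<C : ∀ q (R : Subset m) → ∣ R ∣ ≡ q → rank q R < m C q
rank-<C {m}     zero    R           _ = C-pos m 0 z≤n
rank-<C {suc m} (suc q) (true ∷ R)  e = <-≤-trans (+-monoʳ-< (m C suc q) (rank-<C q R (suc-injective e)))
  (≤-reflexive (trans (+-comm (m C suc q) _) (sym (pascal m q))))
rank-<C {suc m} (suc q) (false ∷ R) e = <-≤-trans (rank-<C (suc q) R e) (C-suc m (suc q))

rank-mono : ∀ q (Q R : Subset m) → Q ⊆ R → rank q Q ≤ rank q R
rank-mono zero    Q           R           _   = z≤n
rank-mono (suc q) []          []          _   = z≤n
rank-mono (suc q) (true ∷ Q)  (true ∷ R)  Q⊆R = +-monoʳ-≤ _ (rank-mono q Q R (drop-∷-⊆ Q⊆R))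
rank-mono (suc q) (true ∷ Q)  (false ∷ R) Q⊆R = ⊥-elim (in⊈out {p = Q} {q = R} Q⊆R)
rank-mono (suc q) (false ∷ Q) (true ∷ R)  Q⊆R = ≤-trans (rank-≤C (suc q) Q) (m≤m+n _ _)
rank-mono (suc q) (false ∷ Q) (false ∷ R) Q⊆R = rank-mono (suc q) Q R (drop-∷-⊆ Q⊆R)

rank-∅++ : ∀ q a {b} (R : Subset b) → rank q (∅ {a} ++ᵛ R) ≡ rank q R
rank-∅++ zero    a       R = refl
rank-∅++ (suc q) zero    R = refl
rank-∅++ (suc q) (suc a) R = rank-∅++ (suc q) a R

-- An element in the upper block would by itself contribute at least `b C suc q`. The index is
-- positive because at index 0 every set has rank 0.
rank-++-< : ∀ q {a b} (Q : Subset a) (R : Subset b) → rank (suc q) (Q ++ᵛ R) < b C suc q → Q ≡ ∅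
rank-++-< q []          R h = refl
rank-++-< q {suc a} {b} (true ∷ Q) R h =
  ⊥-elim (<-irrefl refl (<-≤-trans (≤-<-trans (m≤m+n _ _) h) (C-mono (suc q) (m≤n+m b a))))
rank-++-< q (false ∷ Q) R h = cong (false ∷_) (rank-++-< q Q R h)

-- A singleton with `t` smaller elements is the test set for binomial thresholds: at each positive
-- index `q` its rank is `t C q`, so Kruskal-Katona for this one set compares such thresholds at
-- different sizes.
rank-∷∅ : ∀ q t → rank q (true ∷ ∅ {t}) ≤ t C q
rank-∷∅ zero    t = z≤n
rank-∷∅ (suc q) t = ≤-reflexive (trans (cong (t C suc q +_) (go q t)) (+-identityʳ _))
  where
  go : ∀ q t → rank q (∅ {t}) ≡ 0
  go zero    t       = refl
  go (suc q) zero    = refl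
  go (suc q) (suc t) = go (suc q) t

rank-∷∅-≥ : ∀ q t → t C suc q ≤ rank (suc q) (true ∷ ∅ {t})
rank-∷∅-≥ q t = m≤m+n _ _

ranked? : ∀ q c (R : Subset m) → Dec (∣ R ∣ ≡ q × rank q R < c)
ranked? q c R = (∣ R ∣ ≟ q) ×-dec (rank q R <? c)

-- The rank is the position in the colexicographic order. At positive size, sets without the top
-- element take the positions below `m C suc q` and sets with it those from there on, so the count
-- is split at this value.
#-ranked-≤ : ∀ m q c → # (ranked? {m} q c) ≤ c
#-ranked-≤ m zero zero = ≤-reflexive (#-none (ranked? {m} 0 0) λ { _ (_ , ()) })
#-ranked-≤ m zero (suc c) = ≤-trans (#-mono {m} (ranked? 0 (suc c)) (λ S → (S ⊆? ∅ {m}) ×-dec (∣ S ∣ ≟ 0))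
    λ S (∣S∣ , _) → (λ x∈S → ⊥-elim (∣S∣≡0⇒x∉S S ∣S∣ x∈S)) , ∣S∣)
  (≤-trans (≤-reflexive (trans (#-⊆ (∅ {m}) 0) (C-zero ∣ ∅ {m} ∣))) (s≤s z≤n))
#-ranked-≤ zero (suc q) c = z≤n
#-ranked-≤ (suc m) (suc q) c = ≤-trans (≤-reflexive (∑ˢ-suc {m} (λ R → ind (ranked? (suc q) c R)))) (go (≤-total (m C suc q) c))
  where
  open ≤-Reasoning
  go : m C suc q ≤ c ⊎ c ≤ m C suc q →
       # (λ R → ranked? {suc m} (suc q) c (true ∷ R)) + # (λ R → ranked? {suc m} (suc q) c (false ∷ R)) ≤ c
  go (inj₁ C≤c) with m≤n⇒∃[o]m+o≡n C≤c
  ... | o , refl = begin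
    # (λ R → ranked? {suc m} (suc q) (m C suc q + o) (true ∷ R)) + # (λ R → ranked? {suc m} (suc q) (m C suc q + o) (false ∷ R))
      ≤⟨ +-mono-≤ (#-mono {m} _ (ranked? q o) λ R (∣R∣ , h) → suc-injective ∣R∣ , +-cancelˡ-< (m C suc q) _ _ h)
                  (#-mono {m} _ (λ S → (S ⊆? ⊤) ×-dec (∣ S ∣ ≟ suc q)) λ R (∣R∣ , _) → ⊆-max R , ∣R∣) ⟩
    # (ranked? {m} q o) + # (λ S → (S ⊆? ⊤ {m}) ×-dec (∣ S ∣ ≟ suc q))
      ≤⟨ +-mono-≤ (#-ranked-≤ m q o) (≤-reflexive (trans (#-⊆ (⊤ {m}) (suc q)) (cong (_C suc q) (∣⊤∣≡n m)))) ⟩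
    o + m C suc q  ≡⟨ +-comm o _ ⟩
    m C suc q + o  ∎
  go (inj₂ c≤C) = +-mono-≤
    (≤-reflexive (#-none (λ R → ranked? {suc m} (suc q) c (true ∷ R)) λ R (_ , h) → <-irrefl refl (<-≤-trans (≤-<-trans (m≤m+n _ _) h) c≤C)))
    (#-ranked-≤ m (suc q) c)

#-ranked-≥ : ∀ m q c → c ≤ m C q → c ≤ # (ranked? {m} q c)
#-ranked-≥ m q zero c≤ = z≤n
#-ranked-≥ m zero (suc c) c≤ = ≤-trans c≤ (≤-trans (≤-reflexive (C-zero m)) (#-pos (ranked? 0 (suc c)) (∅ {m}) (∣⊥∣≡0 m , s≤s z≤n)))
#-ranked-≥ zero (suc q) (suc c) c≤ = ⊥-elim (n≮0 (≤-trans c≤ (≤-reflexive (C-zeroˡ q))))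
#-ranked-≥ (suc m) (suc q) c@(suc _) c≤ = ≤-trans (go (≤-total (m C suc q) c)) (≤-reflexive (sym (∑ˢ-suc {m} (λ R → ind (ranked? (suc q) c R)))))
  where
  open ≤-Reasoning
  go : m C suc q ≤ c ⊎ c ≤ m C suc q →
       c ≤ # (λ R → ranked? {suc m} (suc q) c (true ∷ R)) + # (λ R → ranked? {suc m} (suc q) c (false ∷ R))
  go (inj₂ c≤C) = ≤-trans (#-ranked-≥ m (suc q) c c≤C) (m≤n+m _ _)
  go (inj₁ C≤c) with m≤n⇒∃[o]m+o≡n C≤c
  ... | o , eq = begin
    c                         ≡⟨ trans (sym eq) (+-comm _ o) ⟩
    o + m C suc q             ≤⟨ +-mono-≤ (#-ranked-≥ m q o o≤) (#-ranked-≥ m (suc q) (m C suc q) ≤-refl) ⟩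
    # (ranked? {m} q o) + # (ranked? {m} (suc q) (m C suc q))
      ≤⟨ +-mono-≤ (#-mono {m} (ranked? q o) _ λ R (∣R∣ , h) → cong suc ∣R∣ , ≤-trans (+-monoʳ-< (m C suc q) h) (≤-reflexive eq))
                  (#-mono {m} (ranked? (suc q) (m C suc q)) _ λ R (∣R∣ , h) → ∣R∣ , <-≤-trans h C≤c) ⟩
    # (λ R → ranked? {suc m} (suc q) c (true ∷ R)) + # (λ R → ranked? {suc m} (suc q) c (false ∷ R)) ∎
    where
    o≤ : o ≤ m C q
    o≤ = +-cancelˡ-≤ (m C suc q) _ _ (≤-trans (≤-reflexive eq) (≤-trans c≤ (≤-reflexive (trans (pascal m q) (+-comm (m C q) _)))))

-- The last entry stands for the element 0; dropping it lowers all other elements by one, which is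
-- Pascal's rule in each summand of the rank.
init : Subset (suc m) → Subset m
init (_ ∷ [])        = []
init (b ∷ R@(_ ∷ _)) = b ∷ init R

rank-init-≤ : ∀ q (R : Subset (suc m)) → rank (suc q) (init R) + rank q (init R) ≤ rank (suc q) R
rank-init-≤ q (b ∷ []) = ≤-trans (≤-reflexive (rank-[] q)) z≤n
rank-init-≤ {suc m} zero (true ∷ R@(_ ∷ _)) = ≤-trans (≤-reflexive (+-identityʳ _)) (+-monoˡ-≤ 0 (C-suc m 1))
rank-init-≤ {suc m} (suc q) (true ∷ R@(_ ∷ _)) = begin
  (m C suc (suc q) + x) + (m C suc q + y)   ≡⟨ +-interchange (m C suc (suc q)) x (m C suc q) y ⟩
  (m C suc (suc q) + m C suc q) + (x + y)   ≡⟨ cong (_+ (x + y)) (trans (+-comm (m C suc (suc q)) _) (sym (pascal m (suc q)))) ⟩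
  suc m C suc (suc q) + (x + y)             ≤⟨ +-monoʳ-≤ (suc m C suc (suc q)) (rank-init-≤ q R) ⟩
  suc m C suc (suc q) + rank (suc q) R      ∎
  where
  open ≤-Reasoning
  x = rank (suc q) (init R)
  y = rank q (init R)
rank-init-≤ zero    (false ∷ R@(_ ∷ _)) = rank-init-≤ zero R
rank-init-≤ (suc q) (false ∷ R@(_ ∷ _)) = rank-init-≤ (suc q) R

-- The possible excess of one comes from the last summand: by Pascal's rule r C 1 splits off (r - 1)
-- C 0 = 1, and `rank q` has no summand for it.
rank-init-≥ : ∀ q (R : Subset (suc m)) → rank (suc q) R ≤ suc (rank (suc q) (init R) + rank q (init R))
rank-init-≥ q (true ∷ []) = ≤-trans (≤-reflexive (trans (cong (0 C suc q +_) (rank-[] q)) (trans (+-identityʳ _) (C-zeroˡ q)))) z≤n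
rank-init-≥ q (false ∷ []) = z≤n
rank-init-≥ {suc m} zero (true ∷ R@(_ ∷ _)) = ≤-reflexive (trans (+-identityʳ _)
  (trans (pascal m 0) (trans (cong (_+ m C 1) (C-zero m)) (cong suc (sym (trans (+-identityʳ _) (+-identityʳ _)))))))
rank-init-≥ {suc m} (suc q) (true ∷ R@(_ ∷ _)) = begin
  suc m C suc (suc q) + rank (suc q) R            ≤⟨ +-monoʳ-≤ (suc m C suc (suc q)) (rank-init-≥ q R) ⟩
  suc m C suc (suc q) + suc (x + y)               ≡⟨ +-suc _ _ ⟩
  suc (suc m C suc (suc q) + (x + y))             ≡⟨ cong (λ a → suc (a + (x + y))) (trans (pascal m (suc q)) (+-comm (m C suc q) _)) ⟩
  suc ((m C suc (suc q) + m C suc q) + (x + y))   ≡⟨ cong suc (+-interchange (m C suc (suc q)) (m C suc q) x y) ⟩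
  suc ((m C suc (suc q) + x) + (m C suc q + y))   ∎
  where
  open ≤-Reasoning
  x = rank (suc q) (init R)
  y = rank q (init R)
rank-init-≥ zero    (false ∷ R@(_ ∷ _)) = rank-init-≥ zero R
rank-init-≥ (suc q) (false ∷ R@(_ ∷ _)) = rank-init-≥ (suc q) R

-- Shifting to the first vertex and the Kruskal-Katona theorem

module _ (v : Fin n) (D : Subset (suc n) → Set) where

  -- The usual compression: a member that contains `v` but not the first vertex has `v` exchanged
  -- for the first vertex, unless the result is a member already.
  Shift : Subset (suc n) → Set
  Shift (true  ∷ S) = D (true ∷ S) ⊎ (v ∉ S × D (false ∷ (S ∪ ⁅ v ⁆)))
  Shift (false ∷ S) = D (false ∷ S) × (v ∉ S ⊎ D (true ∷ (S - v)))

module _ (v : Fin n) {D : Subset (suc n) → Set} (D? : ∀ S → Dec (D S)) where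

  shift? : ∀ S → Dec (Shift v D S)
  shift? (true  ∷ S) = D? (true ∷ S) ⊎-dec (¬? (v ∈? S) ×-dec D? (false ∷ (S ∪ ⁅ v ⁆)))
  shift? (false ∷ S) = D? (false ∷ S) ×-dec (¬? (v ∈? S) ⊎-dec D? (true ∷ (S - v)))

  moved? : ∀ S → Dec (D (false ∷ S) × v ∈ S × ¬ D (true ∷ (S - v)))
  moved? S = D? (false ∷ S) ×-dec (v ∈? S) ×-dec ¬? (D? (true ∷ (S - v)))

  #-shift-false : # (λ S → D? (false ∷ S)) ≡ # (λ S → shift? (false ∷ S)) + # moved?
  #-shift-false = trans (#-split (λ S → D? (false ∷ S)) (λ S → ¬? (v ∈? S) ⊎-dec D? (true ∷ (S - v))))
    (cong (# (λ S → shift? (false ∷ S)) +_) (#-cong _ moved?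
      (λ S (d , ¬h) → d , Relation.Nullary.Decidable.decidable-stable (v ∈? S) (¬h ∘ inj₁) , ¬h ∘ inj₂)
      (λ S (d , v∈S , ¬d) → d , [ (λ v∉S → v∉S v∈S) , ¬d ]′)))

  #-shift-true : # (λ S → shift? (true ∷ S)) ≡ # (λ S → D? (true ∷ S)) + # moved?
  #-shift-true = trans (#-split (λ S → shift? (true ∷ S)) (λ S → D? (true ∷ S)))
    (cong₂ _+_ (#-cong _ (λ S → D? (true ∷ S)) (λ _ → proj₂) (λ _ d → inj₁ d , d))
      (≤-antisym
        (#-inj _ moved? (_∪ ⁅ v ⁆) (_- v)
          (λ { S (inj₁ d , ¬d) → ⊥-elim (¬d d)
             ; S (inj₂ (v∉S , d) , ¬d) → d , ∈-add S v , subst (λ S → ¬ D (true ∷ S)) (sym (remove-add S v v∉S)) ¬d })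
          (λ { S (inj₁ d , ¬d) → ⊥-elim (¬d d)
             ; S (inj₂ (v∉S , d) , ¬d) → remove-add S v v∉S }))
        (#-inj moved? _ (_- v) (_∪ ⁅ v ⁆)
          (λ S (d , v∈S , ¬d) → inj₂ (x∉p-x S v , subst (λ S → D (false ∷ S)) (sym (add-remove S v v∈S)) d) , ¬d)
          (λ S (d , v∈S , ¬d) → add-remove S v v∈S))))

  #-shift : # shift? ≡ # D?
  #-shift = begin
    # shift?                                                                ≡⟨ ∑ˢ-suc (λ S → ind (shift? S)) ⟩
    # (λ S → shift? (true ∷ S)) + # (λ S → shift? (false ∷ S))              ≡⟨ cong (_+ # (λ S → shift? (false ∷ S))) #-shift-true ⟩
    # (λ S → D? (true ∷ S)) + # moved? + # (λ S → shift? (false ∷ S))       ≡⟨ +-assoc (# (λ S → D? (true ∷ S))) (# moved?) _ ⟩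
    # (λ S → D? (true ∷ S)) + (# moved? + # (λ S → shift? (false ∷ S)))     ≡⟨ cong (# (λ S → D? (true ∷ S)) +_) (trans (+-comm (# moved?) _) (sym #-shift-false)) ⟩
    # (λ S → D? (true ∷ S)) + # (λ S → D? (false ∷ S))                      ≡⟨ ∑ˢ-suc (λ S → ind (D? S)) ⟨
    # D?                                                                    ∎
    where open ≡-Reasoning

shift-uniform : ∀ (v : Fin n) {D : Subset (suc n) → Set} s → Uniform s D → Uniform s (Shift v D)
shift-uniform v s unif (true ∷ S)  (inj₁ d)         = unif _ d
shift-uniform v s unif (true ∷ S)  (inj₂ (v∉S , d)) = trans (sym (∣add∣ S v v∉S)) (unif _ d)
shift-uniform v s unif (false ∷ S) (d , _)          = unif _ d

add-remove-comm : ∀ (S : Subset n) {u v} → u ≢ v → (S ∪ ⁅ v ⁆) - u ≡ (S - u) ∪ ⁅ v ⁆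
add-remove-comm S {u} {v} u≢v = ⊆-antisym to from
  where
  to : (S ∪ ⁅ v ⁆) - u ⊆ (S - u) ∪ ⁅ v ⁆
  to {x} h with x Fin.≟ v
  ... | yes refl = ∈-add (S - u) v
  ... | no x≢v = p⊆p∪q ⁅ v ⁆ (x∈p∧x≢y⇒x∈p-y (∈-add⁻ S v (∈-remove (S ∪ ⁅ v ⁆) u h) x≢v) λ { refl → x∉p-x (S ∪ ⁅ v ⁆) u h })
  from : (S - u) ∪ ⁅ v ⁆ ⊆ (S ∪ ⁅ v ⁆) - u
  from {x} h with x Fin.≟ v
  ... | yes refl = x∈p∧x≢y⇒x∈p-y (∈-add S v) (u≢v ∘ sym)
  ... | no x≢v = let h' = ∈-add⁻ (S - u) v h x≢v in
    x∈p∧x≢y⇒x∈p-y (p⊆p∪q ⁅ v ⁆ (∈-remove S u h')) λ { refl → x∉p-x S u h' }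

ShadowIn : (B A : Subset n → Set) → Set
ShadowIn B A = ∀ S → B S → ∀ v → v ∈ S → A (S - v)

-- Both families are shifted together, so the hypothesis of Kruskal-Katona survives while both sizes
-- stay the same.
shift-shadow : ∀ (v : Fin n) {A B : Subset (suc n) → Set} → ShadowIn B A → ShadowIn (Shift v B) (Shift v A)
shift-shadow v {A} {B} sh (true ∷ S) (inj₁ b) zero h =
  sh _ b zero h , second
  where
  second : v ∉ S ─ ∅ ⊎ A (true ∷ ((S ─ ∅) - v))
  second with v ∈? S
  ... | yes v∈S = inj₂ (subst (λ S' → A (true ∷ (S' - v))) (sym (p─⊥≡p S)) (sh _ b (suc v) (there v∈S)))
  ... | no v∉S  = inj₁ (subst (v ∉_) (sym (p─⊥≡p S)) v∉S)
shift-shadow v {A} sh (true ∷ S) (inj₂ (v∉S , b)) zero h =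
  subst (λ S' → A (false ∷ S')) (trans (remove-add S v v∉S) (sym (p─⊥≡p S))) (sh _ b (suc v) (there (∈-add S v))) ,
  inj₁ (subst (v ∉_) (sym (p─⊥≡p S)) v∉S)
shift-shadow v sh (true ∷ S) (inj₁ b) (suc u) h = inj₁ (sh _ b (suc u) h)
shift-shadow v {A} sh (true ∷ S) (inj₂ (v∉S , b)) (suc u) (there u∈S) =
  inj₂ ((λ h → v∉S (∈-remove S u h)) ,
    subst (λ S' → A (false ∷ S')) (add-remove-comm S {u} {v} λ { refl → v∉S u∈S })
      (sh _ b (suc u) (there (p⊆p∪q ⁅ v ⁆ u∈S))))
shift-shadow v {A} sh (false ∷ S) (b , h') (suc u) (there u∈S) = sh _ b (suc u) (there u∈S) , second h'
  where
  second : v ∉ S ⊎ _ → v ∉ S - u ⊎ A (true ∷ ((S - u) - v))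
  second (inj₁ v∉S) = inj₁ λ h → v∉S (∈-remove S u h)
  second (inj₂ b') with u Fin.≟ v
  ... | yes refl = inj₁ (x∉p-x S v)
  ... | no u≢v   = inj₂ (subst (λ S' → A (true ∷ S')) (p─x─y≡p─y─x S v u)
                      (sh _ b' (suc u) (there (x∈p∧x≢y⇒x∈p-y u∈S u≢v))))

-- Frankl's induction on the ground set. Once no shift to the first vertex moves anything, the
-- members avoiding that vertex have their shadow in its link `B₁`. So `B₁` is large, and it enters
-- the shadow twice: as sets avoiding the vertex, and through its own shadow as sets containing it.
-- Comparing sizes with the rank of an arbitrary `R` dispenses with cascade representations.
kruskal-katona₁ : ∀ {n} s {A B : Subset n → Set} (A? : ∀ S → Dec (A S)) (B? : ∀ S → Dec (B S)) →
                  Uniform (suc s) B → ShadowIn B A → ∀ {m} (R : Subset m) → rank (suc s) R < # B? → rank s R < # A?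
kruskal-katona₁ zero A? B? unif sh R h =
  let (S , b) = #-∃ B? (≤-<-trans z≤n h)
      (v , v∈S) = nonempty S (≤-trans (s≤s z≤n) (≤-reflexive (sym (unif S b))))
  in #-pos A? (S - v) (sh S b v v∈S)
kruskal-katona₁ (suc s) A? B? unif sh [] h =
  let (S , b) = #-∃ B? (≤-<-trans z≤n h)
      (v , v∈S) = nonempty S (≤-trans (s≤s z≤n) (≤-reflexive (sym (unif S b))))
  in #-pos A? (S - v) (sh S b v v∈S)
kruskal-katona₁ {zero} (suc s) A? B? unif sh R@(_ ∷ _) h with #-∃ B? (≤-<-trans z≤n h)
... | [] , b with unif [] b
...   | ()
kruskal-katona₁ {suc n} (suc s) A? B? unif sh {suc m} R@(_ ∷ _) = go _ A? B? unif sh ≤-refl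
  where
  go : ∀ f {A B : Subset (suc n) → Set} (A? : ∀ S → Dec (A S)) (B? : ∀ S → Dec (B S)) → Uniform (suc (suc s)) B → ShadowIn B A →
       # (λ S → B? (false ∷ S)) ≤ f → rank (suc (suc s)) R < # B? → rank (suc s) R < # A?
  -- `f` bounds the number of members that avoid the first vertex, which falls with every shift that
  -- moves a set.
  go f {A} {B} A? B? unif sh ≤f h with anySubset? (λ S → Fin.any? λ v → moved? v B? S)
  ... | no stable = begin-strict
      rank (suc s) R                                          ≤⟨ rank-init-≥ s R ⟩
      -- Two strict bounds gain one unit each; one of them pays for the excess in `rank-init-≥`, the
      -- other makes the conclusion strict.
      suc (rank (suc s) (init R) + rank s (init R))           <⟨ s≤s (≤-reflexive (sym (+-suc _ _))) ⟩
      suc (rank (suc s) (init R)) + suc (rank s (init R))     ≤⟨ +-mono-≤ above-B₁ above-A₁ ⟩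
      # B₁? + # A₁?                                           ≤⟨ +-monoˡ-≤ (# A₁?) (#-mono B₁? (λ S → A? (false ∷ S))
                                                                   λ S b → subst (λ S → A (false ∷ S)) (p─⊥≡p S) (sh _ b zero here)) ⟩
      # (λ S → A? (false ∷ S)) + # A₁?                        ≡⟨ +-comm _ (# A₁?) ⟩
      # A₁? + # (λ S → A? (false ∷ S))                        ≡⟨ ∑ˢ-suc (λ S → ind (A? S)) ⟨
      # A?                                                    ∎
    where
    open ≤-Reasoning
    A₁? = λ S → A? (true ∷ S)
    B₁? = λ S → B? (true ∷ S)
    B₀? = λ S → B? (false ∷ S)
    B₁-shadow : ShadowIn (λ S → B (false ∷ S)) (λ S → B (true ∷ S))
    B₁-shadow S b v v∈S = Relation.Nullary.Decidable.decidable-stable (B₁? (S - v)) λ ¬b → stable (S , v , b , v∈S , ¬b)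
    above-B₁ : rank (suc s) (init R) < # B₁?
    above-B₁ with rank (suc s) (init R) <? # B₁?
    ... | yes lt = lt
    -- If `B₁` is small, the members avoiding the first vertex are so many that their shadow, which
    -- lies in `B₁`, is too large.
    ... | no nlt = kruskal-katona₁ (suc s) B₁? B₀? (λ S → unif (false ∷ S)) B₁-shadow (init R)
      (+-cancelʳ-< (rank (suc s) (init R)) _ _ (begin-strict
        rank (suc (suc s)) (init R) + rank (suc s) (init R)   ≤⟨ rank-init-≤ (suc s) R ⟩
        rank (suc (suc s)) R                                  <⟨ h ⟩
        # B?                                                  ≡⟨ ∑ˢ-suc (λ S → ind (B? S)) ⟩
        # B₁? + # B₀?                                         ≤⟨ +-monoˡ-≤ (# B₀?) (≮⇒≥ nlt) ⟩
        rank (suc s) (init R) + # B₀?                         ≡⟨ +-comm _ (# B₀?) ⟩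
        # B₀? + rank (suc s) (init R)                         ∎))
    above-A₁ : rank s (init R) < # A₁?
    above-A₁ = kruskal-katona₁ s A₁? B₁? (λ S b → suc-injective (unif (true ∷ S) b))
      (λ S b v v∈S → sh (true ∷ S) b (suc v) (there v∈S)) (init R) above-B₁
  ... | yes (S , v , mv) with f
  ...   | zero = ⊥-elim (n≮0 (≤-trans (#-pos (λ S → B? (false ∷ S)) S (proj₁ mv)) ≤f))
  ...   | suc f' = <-≤-trans
      (go f' (shift? v A?) (shift? v B?) (shift-uniform v (suc (suc s)) unif) (shift-shadow v sh)
        (s≤s⁻¹ (begin
          suc (# (λ S → shift? v B? (false ∷ S)))                 ≡⟨ +-comm 1 _ ⟩
          # (λ S → shift? v B? (false ∷ S)) + 1                   ≤⟨ +-monoʳ-≤ _ (#-pos (moved? v B?) S mv) ⟩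
          # (λ S → shift? v B? (false ∷ S)) + # (moved? v B?)     ≡⟨ #-shift-false v B? ⟨
          # (λ S → B? (false ∷ S))                                ≤⟨ ≤f ⟩
          suc f'                                                  ∎))
        (<-≤-trans h (≤-reflexive (sym (#-shift v B?)))))
      (≤-reflexive (#-shift v A?))
    where open ≤-Reasoning

kruskal-katona : ∀ i s {A B : Subset n → Set} (A? : ∀ S → Dec (A S)) (B? : ∀ S → Dec (B S)) → i ≤ s →
                 (∀ S → B S → Complete i A s S) → ∀ {m} (R : Subset m) → rank s R < # B? → rank i R < # A?
kruskal-katona i s {A} A? B? i≤s B⇒ R h with m≤n⇒∃[o]m+o≡n i≤s
... | o , refl = go o (<-≤-trans h (#-mono B? (complete? i A? (i + o)) B⇒))
  where
  go : ∀ o → rank (i + o) R < # (complete? i A? (i + o)) → rank i R < # A?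
  go zero    h = subst (λ s → rank s R < # A?) (+-identityʳ i)
    (<-≤-trans h (#-mono (complete? i A? (i + 0)) A? λ S (∣S∣ , a) → a S (id , trans ∣S∣ (+-identityʳ i))))
  go (suc o) h = go o (kruskal-katona₁ (i + o) (complete? i A? (i + o)) (complete? i A? (suc (i + o)))
    (λ _ → proj₁) (λ S c → proj₂ (complete-suc i (i + o) S c)) R
    (subst (λ s → rank s R < # (complete? i A? s)) (+-suc i o) h))

-- Relabelling the subsets of a set

compress : (S e : Subset n) → Subset ∣ S ∣
compress []          []      = []
compress (true ∷ S)  (b ∷ e) = b ∷ compress S e
compress (false ∷ S) (b ∷ e) = compress S e

expand : (S : Subset n) → Subset ∣ S ∣ → Subset n
expand []          []      = []
expand (true ∷ S)  (b ∷ R) = b ∷ expand S R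
expand (false ∷ S) R       = false ∷ expand S R

compress-mono : (S e f : Subset n) → (∀ {x} → x ∈ S → x ∈ e → x ∈ f) → compress S e ⊆ compress S f
compress-mono (true ∷ S) (b ∷ e) (c ∷ f) h here with h here here
... | here = here
compress-mono (true ∷ S) (b ∷ e) (c ∷ f) h (there i) =
  there (compress-mono S e f (λ x∈S x∈e → drop-there (h (there x∈S) (there x∈e))) i)
compress-mono (false ∷ S) (b ∷ e) (c ∷ f) h i =
  compress-mono S e f (λ x∈S x∈e → drop-there (h (there x∈S) (there x∈e))) i

compress-∅ : (S e : Subset n) → (∀ {x} → x ∈ S → x ∉ e) → compress S e ≡ ∅
compress-∅ []          []          h = refl
compress-∅ (true ∷ S)  (true ∷ e)  h = ⊥-elim (h here here)
compress-∅ (true ∷ S)  (false ∷ e) h = cong (false ∷_) (compress-∅ S e λ x∈S x∈e → h (there x∈S) (there x∈e))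
compress-∅ (false ∷ S) (b ∷ e)     h = compress-∅ S e λ x∈S x∈e → h (there x∈S) (there x∈e)

compress-expand : (S : Subset n) (R : Subset ∣ S ∣) → compress S (expand S R) ≡ R
compress-expand []          []      = refl
compress-expand (true ∷ S)  (b ∷ R) = cong (b ∷_) (compress-expand S R)
compress-expand (false ∷ S) R       = compress-expand S R

expand-compress : (S e : Subset n) → expand S (compress S e) ≡ e ∩ S
expand-compress []          []          = refl
expand-compress (true ∷ S)  (true ∷ e)  = cong (true ∷_) (expand-compress S e)
expand-compress (true ∷ S)  (false ∷ e) = cong (false ∷_) (expand-compress S e)
expand-compress (false ∷ S) (true ∷ e)  = cong (false ∷_) (expand-compress S e)
expand-compress (false ∷ S) (false ∷ e) = cong (false ∷_) (expand-compress S e)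

expand⊆ : (S : Subset n) (R : Subset ∣ S ∣) → expand S R ⊆ S
expand⊆ (true ∷ S)  (true ∷ R) here      = here
expand⊆ (true ∷ S)  (b ∷ R)    (there h) = there (expand⊆ S R h)
expand⊆ (false ∷ S) R          (there h) = there (expand⊆ S R h)

∣expand∣ : (S : Subset n) (R : Subset ∣ S ∣) → ∣ expand S R ∣ ≡ ∣ R ∣
∣expand∣ []          []          = refl
∣expand∣ (true ∷ S)  (true ∷ R)  = cong suc (∣expand∣ S R)
∣expand∣ (true ∷ S)  (false ∷ R) = ∣expand∣ S R
∣expand∣ (false ∷ S) R           = ∣expand∣ S R

expand-∅ : (S : Subset n) → expand S ∅ ≡ ∅
expand-∅ []          = refl
expand-∅ (true ∷ S)  = cong (false ∷_) (expand-∅ S)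
expand-∅ (false ∷ S) = cong (false ∷_) (expand-∅ S)

∣++∣ : ∀ {a b} (Q : Subset a) (R : Subset b) → ∣ Q ++ᵛ R ∣ ≡ ∣ Q ∣ + ∣ R ∣
∣++∣ []          R = refl
∣++∣ (true ∷ Q)  R = cong suc (∣++∣ Q R)
∣++∣ (false ∷ Q) R = ∣++∣ Q R

++-⊆ : ∀ {a b} {Q Q′ : Subset a} {R R′ : Subset b} → Q ⊆ Q′ → R ⊆ R′ → Q ++ᵛ R ⊆ Q′ ++ᵛ R′
++-⊆ {Q = []}    {[]}     Q⊆ R⊆ h    = R⊆ h
++-⊆ {Q = b ∷ Q} {b′ ∷ Q′} Q⊆ R⊆ here with Q⊆ here
... | here = here
++-⊆ {Q = b ∷ Q} {b′ ∷ Q′} Q⊆ R⊆ (there h) = there (++-⊆ (drop-∷-⊆ Q⊆) R⊆ h)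

∪-⊆ : {p q r : Subset n} → p ⊆ r → q ⊆ r → p ∪ q ⊆ r
∪-⊆ {p = p} {q} p⊆r q⊆r h = [ p⊆r , q⊆r ]′ (x∈p∪q⁻ p q h)

∪-⊆-∪ : {p q p′ q′ : Subset n} → p ⊆ p′ → q ⊆ q′ → p ∪ q ⊆ p′ ∪ q′
∪-⊆-∪ {p′ = p′} {q′} p⊆p′ q⊆q′ = ∪-⊆ (λ h → p⊆p∪q q′ (p⊆p′ h)) (λ h → q⊆p∪q p′ q′ (q⊆q′ h))

take-++ : ∀ {a b} (Q : Subset a) (R : Subset b) → take a (Q ++ᵛ R) ≡ Q
take-++ []      R = refl
take-++ (b ∷ Q) R = cong (b ∷_) (take-++ Q R)

drop-++ : ∀ {a b} (Q : Subset a) (R : Subset b) → drop a (Q ++ᵛ R) ≡ R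
drop-++ []      R = refl
drop-++ (b ∷ Q) R = drop-++ Q R

Disj : Subset n → Subset n → Set
Disj A B = ∀ x → x ∈ A → x ∉ B

disj? : (A B : Subset n) → Dec (Disj A B)
disj? A B = Fin.all? λ x → (x ∈? A) →-dec ¬? (x ∈? B)

-- A linear order on X ∪ Y, for the ranks, in which Y comes first and X after it

module Order (X Y : Subset n) (X#Y : Disj X Y) where

  pull : Subset n → Subset (∣ X ∣ + ∣ Y ∣)
  pull e = compress X e ++ᵛ compress Y e

  upper : Subset (∣ X ∣ + ∣ Y ∣) → Subset ∣ X ∣
  upper = take ∣ X ∣

  lower : Subset (∣ X ∣ + ∣ Y ∣) → Subset ∣ Y ∣
  lower = drop ∣ X ∣

  push : Subset (∣ X ∣ + ∣ Y ∣) → Subset n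
  push R = expand X (upper R) ∪ expand Y (lower R)

  push⊆ : ∀ R → push R ⊆ X ∪ Y
  push⊆ R = ∪-⊆-∪ (expand⊆ X (upper R)) (expand⊆ Y (lower R))

  ∣push∣ : ∀ R → ∣ push R ∣ ≡ ∣ R ∣
  ∣push∣ R = begin
    ∣ push R ∣                                                     ≡⟨ ∣p∪q∣-disjoint _ _ (λ h h' → X#Y _ (expand⊆ X _ h) (expand⊆ Y _ h')) ⟩
    ∣ expand X (upper R) ∣ + ∣ expand Y (lower R) ∣      ≡⟨ cong₂ _+_ (∣expand∣ X _) (∣expand∣ Y _) ⟩
    ∣ upper R ∣ + ∣ lower R ∣                            ≡⟨ ∣++∣ (upper R) (lower R) ⟨
    ∣ upper R ++ᵛ lower R ∣                              ≡⟨ cong ∣_∣ (take++drop≡id ∣ X ∣ R) ⟩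
    ∣ R ∣                                                          ∎
    where open ≡-Reasoning

  pull-mono : ∀ {e f} → e ⊆ f → pull e ⊆ pull f
  pull-mono {e} {f} e⊆f = ++-⊆ (compress-mono X e f λ _ h → e⊆f h) (compress-mono Y e f λ _ h → e⊆f h)

  pull-∪-push : ∀ A R → Disj A (X ∪ Y) → pull (A ∪ push R) ≡ R
  pull-∪-push A R disj = trans (cong₂ _++ᵛ_ (trans X-part (compress-expand X _)) (trans Y-part (compress-expand Y _)))
                               (take++drop≡id ∣ X ∣ R)
    where
    X' = expand X (upper R)
    Y' = expand Y (lower R)
    X-part : compress X (A ∪ push R) ≡ compress X X'
    X-part = ⊆-antisym
      (compress-mono X (A ∪ push R) X' λ {x} x∈X h →
        [ (λ x∈A → ⊥-elim (disj x x∈A (p⊆p∪q Y x∈X)))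
        , (λ h' → [ id , (λ h'' → ⊥-elim (X#Y x x∈X (expand⊆ Y _ h''))) ]′ (x∈p∪q⁻ X' Y' h')) ]′ (x∈p∪q⁻ A (push R) h))
      (compress-mono X X' (A ∪ push R) λ _ h → q⊆p∪q A (push R) (p⊆p∪q Y' h))
    Y-part : compress Y (A ∪ push R) ≡ compress Y Y'
    Y-part = ⊆-antisym
      (compress-mono Y (A ∪ push R) Y' λ {x} x∈Y h →
        [ (λ x∈A → ⊥-elim (disj x x∈A (q⊆p∪q X Y x∈Y)))
        , (λ h' → [ (λ h'' → ⊥-elim (X#Y x (expand⊆ X _ h'') x∈Y)) , id ]′ (x∈p∪q⁻ X' Y' h')) ]′ (x∈p∪q⁻ A (push R) h))
      (compress-mono Y Y' (A ∪ push R) λ _ h → q⊆p∪q A (push R) (q⊆p∪q X' Y' h))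

  push-pull : ∀ e → push (pull e) ≡ e ∩ (X ∪ Y)
  push-pull e = trans (cong₂ _∪_
      (trans (cong (expand X) (take-++ (compress X e) (compress Y e))) (expand-compress X e))
      (trans (cong (expand Y) (drop-++ (compress X e) (compress Y e))) (expand-compress Y e)))
    (sym (∩-distribˡ-∪ e X Y))

  ∣pull∣ : ∀ e → ∣ pull e ∣ ≡ ∣ e ∩ (X ∪ Y) ∣
  ∣pull∣ e = trans (sym (∣push∣ (pull e))) (cong ∣_∣ (push-pull e))

  -- A set avoiding `X` lies in the lower block, so its rank is its rank within `Y`.
  pull-Y : ∀ e → Disj e X → ∀ q → ∣ e ∩ (X ∪ Y) ∣ ≡ q → rank q (pull e) < ∣ Y ∣ C q
  pull-Y e e#X q ∣e∣ = subst (_< ∣ Y ∣ C q)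
    (sym (trans (cong (λ R → rank q (R ++ᵛ compress Y e)) empty) (rank-∅++ q ∣ X ∣ (compress Y e))))
    (rank-<C q (compress Y e) (begin
      ∣ compress Y e ∣                          ≡⟨ cong (_+ ∣ compress Y e ∣) (trans (cong ∣_∣ empty) (∣⊥∣≡0 ∣ X ∣)) ⟨
      ∣ compress X e ∣ + ∣ compress Y e ∣       ≡⟨ ∣++∣ (compress X e) (compress Y e) ⟨
      ∣ pull e ∣                                ≡⟨ ∣pull∣ e ⟩
      ∣ e ∩ (X ∪ Y) ∣                           ≡⟨ ∣e∣ ⟩
      q                                         ∎))
    where
    open ≡-Reasoning
    empty : compress X e ≡ ∅
    empty = compress-∅ X e λ x∈X x∈e → e#X _ x∈e x∈X

  push-Y : ∀ q R → rank (suc q) R < ∣ Y ∣ C suc q → push R ⊆ Y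
  push-Y q R h {x} x∈ = [ (λ h' → ⊥-elim (∉⊥ (subst (x ∈_) (trans (cong (expand X) empty) (expand-∅ X)) h'))) , expand⊆ Y _ ]′
    (x∈p∪q⁻ (expand X (upper R)) _ x∈)
    where
    empty : upper R ≡ ∅
    empty = rank-++-< q (upper R) (lower R) (subst (λ R → rank (suc q) R < ∣ Y ∣ C suc q) (sym (take++drop≡id ∣ X ∣ R)) h)

-- Moving the attachments of one clique to another one

cliquesAt : ℕ → {E : Subset n → Set} (E? : ∀ e → Dec (E e)) → ℕ → Fin n → ℕ
cliquesAt ℓ E? k v = # (λ S → (v ∈? S) ×-dec complete? ℓ E? k S)

IsClique : ℕ → (Subset n → Set) → Subset n → Set
IsClique ℓ E S = ∀ e → e ⊆ S × ∣ e ∣ ≡ ℓ → E e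

clique-covers : ∀ ℓ {E : Subset n → Set} (E? : ∀ e → Dec (E e)) k t (v : Fin n) (S : Subset n) →
                v ∈ S → suc t ≤ ∣ S ∣ → IsClique ℓ E S → t C k ≤ cliquesAt ℓ E? (suc k) v
clique-covers ℓ E? k t v S v∈S t<∣S∣ cl with m≤n⇒∃[o]m+o≡n (≤-trans (s≤s z≤n) t<∣S∣)
... | r , eq = begin
  t C k                                ≤⟨ C-mono k (s≤s⁻¹ (≤-trans t<∣S∣ (≤-reflexive (sym eq)))) ⟩
  r C k                                ≡⟨ #-between ⁅ v ⁆ S v⊆S r (trans (sym eq) (cong (_+ r) (sym (∣⁅x⁆∣≡1 v)))) k ⟨
  # (between? ⁅ v ⁆ S (∣ ⁅ v ⁆ ∣ + k)) ≤⟨ #-mono (between? ⁅ v ⁆ S (∣ ⁅ v ⁆ ∣ + k)) (λ K → (v ∈? K) ×-dec complete? ℓ E? (suc k) K)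
    (λ K (v⊆K , K⊆S , ∣K∣) → v⊆K (x∈⁅x⁆ v) , trans ∣K∣ (cong (_+ k) (∣⁅x⁆∣≡1 v)) , λ e (e⊆K , ∣e∣) → cl e ((λ h → K⊆S (e⊆K h)) , ∣e∣)) ⟩
  cliquesAt ℓ E? (suc k) v             ∎
  where
  open ≤-Reasoning
  v⊆S : ⁅ v ⁆ ⊆ S
  v⊆S h = subst (_∈ S) (sym (x∈⁅y⁆⇒x≡y v h)) v∈S

#-disjoint : {P Q R : Subset n → Set} (P? : ∀ S → Dec (P S)) (Q? : ∀ S → Dec (Q S)) (R? : ∀ S → Dec (R S)) →
             (∀ S → P S → R S) → (∀ S → Q S → R S) → (∀ S → P S → ¬ Q S) → # P? + # Q? ≤ # R?
#-disjoint P? Q? R? P⇒R Q⇒R P#Q = ≤-trans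
  (+-mono-≤ (#-mono P? (λ S → R? S ×-dec P? S) λ S p → P⇒R S p , p)
            (#-mono Q? (λ S → R? S ×-dec ¬? (P? S)) λ S q → Q⇒R S q , λ p → P#Q S p q))
  (≤-reflexive (sym (#-split R? P?)))

∩∪∩ : (e p q : Subset n) → (∀ x → x ∈ e → x ∈ p ⊎ x ∈ q) → (e ∩ p) ∪ (e ∩ q) ≡ e
∩∪∩ e p q cover = ⊆-antisym (∪-⊆ (p∩q⊆p e p) (p∩q⊆p e q)) λ {x} x∈e →
  [ (λ x∈p → p⊆p∪q (e ∩ q) (x∈p∩q⁺ (x∈e , x∈p))) , (λ x∈q → q⊆p∪q (e ∩ p) (e ∩ q) (x∈p∩q⁺ (x∈e , x∈q))) ]′ (cover x x∈e)

∣∩∣+∣∩∣ : (e p q : Subset n) → (∀ x → x ∈ e → x ∈ p ⊎ x ∈ q) → Disj p q → ∣ e ∩ p ∣ + ∣ e ∩ q ∣ ≡ ∣ e ∣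
∣∩∣+∣∩∣ e p q cover p#q = trans
  (sym (∣p∪q∣-disjoint (e ∩ p) (e ∩ q) λ h h' → p#q _ (p∩q⊆q e p h) (p∩q⊆q e q h')))
  (cong ∣_∣ (∩∪∩ e p q cover))

∪∩-left : (a b p : Subset n) → a ⊆ p → Disj b p → (a ∪ b) ∩ p ≡ a
∪∩-left a b p a⊆p b#p = ⊆-antisym
  (λ h → let (h₁ , h₂) = x∈p∩q⁻ (a ∪ b) p h in [ id , (λ h' → ⊥-elim (b#p _ h' h₂)) ]′ (x∈p∪q⁻ a b h₁))
  (λ h → x∈p∩q⁺ (p⊆p∪q b h , a⊆p h))

∪∩-right : (a b p : Subset n) → Disj a p → b ⊆ p → (a ∪ b) ∩ p ≡ b
∪∩-right a b p a#p b⊆p = ⊆-antisym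
  (λ h → let (h₁ , h₂) = x∈p∩q⁻ (a ∪ b) p h in [ (λ h' → ⊥-elim (a#p _ h' h₂)) , id ]′ (x∈p∪q⁻ a b h₁))
  (λ h → x∈p∩q⁺ (q⊆p∪q a b h , b⊆p h))

-- A covered family with at most as many edges as an extremal one is itself extremal; `fewer` and
-- `covered′` are there for this.
record Isolation (ℓ k m : ℕ) {E : Subset n → Set} (E? : ∀ e → Dec (E e)) (S : Subset n) : Set₁ where
  field
    Edge′    : Subset n → Set
    edge′?   : ∀ e → Dec (Edge′ e)
    uniform′ : Uniform ℓ Edge′
    fewer    : # edge′? ≤ # E?
    covered′ : ∀ v → m ≤ cliquesAt ℓ edge′? k v
    clique   : IsClique ℓ Edge′ S
    isolated : ∀ e → Edge′ e → e ⊆ S ⊎ Disj e S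

-- The cliques to be counted have `suc k` vertices. `H` confines the vertices of `S₁ ∪ S₂` that an
-- edge from outside can reach. Its comparison with `X ∪ S₂` provides room for extensions by at most
-- `l` vertices; if `l` is 0, the empty extension is the only one of these.
module Surgery {n : ℕ} {E : Subset n → Set} (E? : ∀ e → Dec (E e)) (l k t : ℕ) (l<k : suc l ≤ k)
  (unif : Uniform (suc (suc l)) E)
  (S₁ S₂ X : Subset n) (S₁#S₂ : Disj S₁ S₂) (X#Z : Disj X (S₁ ∪ S₂))
  (∣S₁∣ : ∣ S₁ ∣ ≡ suc t) (∣S₂∣ : ∣ S₂ ∣ ≡ suc t)
  (clique₁ : IsClique (suc (suc l)) E S₁) (clique₂ : IsClique (suc (suc l)) E S₂)
  (N : Fin n → Subset n)
  (∈N : ∀ x → x ∈ X → x ∈ N x) (∣N∣ : ∀ x → x ∈ X → ∣ N x ∣ ≡ suc t)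
  (N-clique : ∀ x → x ∈ X → IsClique (suc (suc l)) E (N x))
  (N-edges : ∀ x → x ∈ X → ∀ e → E e → x ∈ e → e ⊆ N x)
  (N#Z : ∀ x → x ∈ X → Disj (N x) (S₁ ∪ S₂))
  (H : Subset n) (attached : ∀ e → E e → ∀ y → y ∈ e → y ∉ S₁ ∪ S₂ → ∀ w → w ∈ e → w ∈ S₁ ∪ S₂ → w ∈ H)
  (H-bound : l ≡ 0 ⊎ ∣ H ∣ ≤ ∣ X ∣ + suc t)
  (covered : ∀ v → t C k ≤ cliquesAt (suc (suc l)) E? (suc k) v)
  where

  ℓ : ℕ
  ℓ = suc (suc l)

  Z W V : Subset n
  Z = S₁ ∪ S₂
  W = ∁ (Z ∪ X)
  V = X ∪ S₂

  X#S₂ : Disj X S₂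
  X#S₂ x x∈X x∈S₂ = X#Z x x∈X (q⊆p∪q S₁ S₂ x∈S₂)

  open Order X S₂ X#S₂

  W#Z : Disj W Z
  W#Z x x∈W x∈Z = x∈∁p⇒x∉p x∈W (p⊆p∪q X x∈Z)

  W#X : Disj W X
  W#X x x∈W x∈X = x∈∁p⇒x∉p x∈W (q⊆p∪q Z X x∈X)

  W#S₁ : Disj W S₁
  W#S₁ x x∈W x∈S₁ = W#Z x x∈W (p⊆p∪q S₂ x∈S₁)

  ∈W : ∀ {x} → x ∉ Z → x ∉ X → x ∈ W
  ∈W x∉Z x∉X = x∉p⇒x∈∁p λ h → [ x∉Z , x∉X ]′ (x∈p∪q⁻ Z X h)

  W#V : Disj W V
  W#V x x∈W h = [ W#X x x∈W , (λ x∈S₂ → W#Z x x∈W (q⊆p∪q S₁ S₂ x∈S₂)) ]′ (x∈p∪q⁻ X S₂ h)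

  V#S₁ : Disj V S₁
  V#S₁ x h x∈S₁ = [ (λ x∈X → X#Z x x∈X (p⊆p∪q S₂ x∈S₁)) , S₁#S₂ x x∈S₁ ]′ (x∈p∪q⁻ X S₂ h)

  W⊎V : ∀ e → Disj e S₁ → ∀ x → x ∈ e → x ∈ W ⊎ x ∈ V
  W⊎V e e#S₁ x x∈e with x ∈? V
  ... | yes x∈V = inj₂ x∈V
  ... | no x∉V = inj₁ (∈W (λ h → [ e#S₁ x x∈e , (λ x∈S₂ → x∉V (q⊆p∪q X S₂ x∈S₂)) ]′ (x∈p∪q⁻ S₁ S₂ h)) λ x∈X → x∉V (p⊆p∪q S₂ x∈X))

  W⊎Z : ∀ e → Disj e X → ∀ x → x ∈ e → x ∈ W ⊎ x ∈ Z
  W⊎Z e e#X x x∈e with x ∈? Z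
  ... | yes x∈Z = inj₂ x∈Z
  ... | no x∉Z = inj₁ (∈W x∉Z (e#X x x∈e))

  -- An edge that avoids `X` is its trace `Y` on `W` together with a subset of `Z`, so these edges
  -- correspond to the sets that are to be replaced.
  attachments? : ∀ Y e → Dec (E e × Disj e X × e ∩ W ≡ Y)
  attachments? Y e = E? e ×-dec disj? e X ×-dec ((e ∩ W) ≟ˢ Y)

  #attachments : Subset n → ℕ
  #attachments Y = # (attachments? Y)

  -- For each trace on `W` the new edges use an initial segment of the sets in `X ∪ S₂`, with `S₂`
  -- as the lower block, as long as the number of attachments allows. Edges with trace of size ℓ are
  -- taken over from `E`; with empty trace, `E′` has those inside `S₁` or `S₂` and the old ones
  -- disjoint from `Z`.
  New : Subset n → Set
  New e = Disj e S₁ × 0 < ∣ e ∩ W ∣ × ∣ e ∩ W ∣ < ℓ × rank (ℓ ∸ ∣ e ∩ W ∣) (pull e) < #attachments (e ∩ W)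

  new? : ∀ e → Dec (New e)
  new? e = disj? e S₁ ×-dec (0 <? ∣ e ∩ W ∣) ×-dec (∣ e ∩ W ∣ <? ℓ) ×-dec (rank (ℓ ∸ ∣ e ∩ W ∣) (pull e) <? #attachments (e ∩ W))

  E′ : Subset n → Set
  E′ e = ∣ e ∣ ≡ ℓ × (e ⊆ S₁ ⊎ e ⊆ S₂ ⊎ (Disj e Z × E e) ⊎ New e)

  E′? : ∀ e → Dec (E′ e)
  E′? e = (∣ e ∣ ≟ ℓ) ×-dec ((e ⊆? S₁) ⊎-dec (e ⊆? S₂) ⊎-dec (disj? e Z ×-dec E? e) ⊎-dec new? e)

  in₁? : ∀ e → Dec (e ⊆ S₁ × ∣ e ∣ ≡ ℓ)
  in₁? e = (e ⊆? S₁) ×-dec (∣ e ∣ ≟ ℓ)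
  in₂? : ∀ e → Dec (e ⊆ S₂ × ∣ e ∣ ≡ ℓ)
  in₂? e = (e ⊆? S₂) ×-dec (∣ e ∣ ≟ ℓ)
  outside? : ∀ e → Dec (Disj e Z × E e)
  outside? e = disj? e Z ×-dec E? e
  crossing? : ∀ e → Dec (E e × Disj e X × 0 < ∣ e ∩ W ∣ × ∣ e ∩ W ∣ < ℓ)
  crossing? e = E? e ×-dec disj? e X ×-dec (0 <? ∣ e ∩ W ∣) ×-dec (∣ e ∩ W ∣ <? ℓ)
  newℓ? : ∀ e → Dec (∣ e ∣ ≡ ℓ × New e)
  newℓ? e = (∣ e ∣ ≟ ℓ) ×-dec new? e

  nonempty-edge : ∀ (e : Subset n) → ∣ e ∣ ≡ ℓ → Nonempty e
  nonempty-edge e ∣e∣ = nonempty e (≤-trans (s≤s z≤n) (≤-reflexive (sym ∣e∣)))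

  meets-W : ∀ e S → Disj W S → 0 < ∣ e ∩ W ∣ → ¬ (e ⊆ S)
  meets-W e S W#S 0<e∩W e⊆S = let (x , h) = nonempty (e ∩ W) 0<e∩W
                                  (h₁ , h₂) = x∈p∩q⁻ e W h
                              in W#S x h₂ (e⊆S h₁)

  #-new : # newℓ? ≤ # crossing?
  #-new = begin
    # newℓ?                                                    ≡⟨ #-fibres newℓ? (_∩ W) ⟩
    ∑ˢ (λ Y → # (λ e → newℓ? e ×-dec ((e ∩ W) ≟ˢ Y)))          ≤⟨ ∑-mono (allSubsets n) fibre ⟩
    ∑ˢ (λ Y → # (λ e → crossing? e ×-dec ((e ∩ W) ≟ˢ Y)))      ≡⟨ #-fibres crossing? (_∩ W) ⟨
    # crossing?                                                ∎
    where
    open ≤-Reasoning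
    fibre : ∀ Y → # (λ e → newℓ? e ×-dec ((e ∩ W) ≟ˢ Y)) ≤ # (λ e → crossing? e ×-dec ((e ∩ W) ≟ˢ Y))
    fibre Y with 0 <? ∣ Y ∣ | ∣ Y ∣ <? ℓ
    ... | no Y≮ | _     = ≤-trans (≤-reflexive (#-none (λ e → newℓ? e ×-dec ((e ∩ W) ≟ˢ Y)) λ { e ((_ , _ , h , _) , refl) → Y≮ h })) z≤n
    ... | yes _ | no Y≮ = ≤-trans (≤-reflexive (#-none (λ e → newℓ? e ×-dec ((e ∩ W) ≟ˢ Y)) λ { e ((_ , _ , _ , h , _) , refl) → Y≮ h })) z≤n
    ... | yes 0<Y | yes Y<ℓ = begin
      # (λ e → newℓ? e ×-dec ((e ∩ W) ≟ˢ Y))             ≤⟨ #-inj _ (ranked? (ℓ ∸ ∣ Y ∣) (#attachments Y)) pull (λ R → Y ∪ push R) to back ⟩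
      # (ranked? {∣ X ∣ + ∣ S₂ ∣} (ℓ ∸ ∣ Y ∣) (#attachments Y))    ≤⟨ #-ranked-≤ (∣ X ∣ + ∣ S₂ ∣) (ℓ ∸ ∣ Y ∣) (#attachments Y) ⟩
      #attachments Y                                               ≤⟨ #-mono (attachments? Y) (λ e → crossing? e ×-dec ((e ∩ W) ≟ˢ Y))
                                                              (λ { e (Ee , e#X , refl) → (Ee , e#X , 0<Y , Y<ℓ) , refl }) ⟩
      # (λ e → crossing? e ×-dec ((e ∩ W) ≟ˢ Y))         ∎
      where
      to : ∀ e → (∣ e ∣ ≡ ℓ × New e) × e ∩ W ≡ Y → ∣ pull e ∣ ≡ ℓ ∸ ∣ Y ∣ × rank (ℓ ∸ ∣ Y ∣) (pull e) < #attachments Y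
      to e ((∣e∣ , e#S₁ , _ , _ , h) , refl) = trans (∣pull∣ e) (trans (sym (m+n∸m≡n ∣ e ∩ W ∣ _))
        (cong (_∸ ∣ e ∩ W ∣) (trans (∣∩∣+∣∩∣ e W V (W⊎V e e#S₁) W#V) ∣e∣))) , h
      back : ∀ e → (∣ e ∣ ≡ ℓ × New e) × e ∩ W ≡ Y → Y ∪ push (pull e) ≡ e
      back e ((∣e∣ , e#S₁ , _) , refl) = trans (cong ((e ∩ W) ∪_) (push-pull e)) (∩∪∩ e W V (W⊎V e e#S₁))

  -- A new edge may coincide with an old one outside `Z`, so for `E′` only the union bound is
  -- available. The four classes in `E` that pay for it are disjoint: an old edge that avoids both
  -- `X` and `Z` has a trace of size ℓ and is not crossing.
  #E′≤#E : # E′? ≤ # E?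
  #E′≤#E = begin
    # E′?
      ≤⟨ #-mono E′? (λ e → in₁? e ⊎-dec (in₂? e ⊎-dec (outside? e ⊎-dec newℓ? e)))
           (λ { e (∣e∣ , inj₁ h) → inj₁ (h , ∣e∣)
              ; e (∣e∣ , inj₂ (inj₁ h)) → inj₂ (inj₁ (h , ∣e∣))
              ; e (∣e∣ , inj₂ (inj₂ (inj₁ h))) → inj₂ (inj₂ (inj₁ h))
              ; e (∣e∣ , inj₂ (inj₂ (inj₂ h))) → inj₂ (inj₂ (inj₂ (∣e∣ , h))) }) ⟩
    # (λ e → in₁? e ⊎-dec (in₂? e ⊎-dec (outside? e ⊎-dec newℓ? e)))
      ≤⟨ ≤-trans (#-⊎ in₁? _) (+-monoʳ-≤ (# in₁?) (≤-trans (#-⊎ in₂? _) (+-monoʳ-≤ (# in₂?) (#-⊎ outside? newℓ?)))) ⟩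
    # in₁? + (# in₂? + (# outside? + # newℓ?))
      ≤⟨ +-monoʳ-≤ (# in₁?) (+-monoʳ-≤ (# in₂?) (+-monoʳ-≤ (# outside?) #-new)) ⟩
    # in₁? + (# in₂? + (# outside? + # crossing?))
      ≤⟨ +-monoʳ-≤ (# in₁?) (+-monoʳ-≤ (# in₂?) (#-disjoint outside? crossing? (λ e → outside? e ⊎-dec crossing? e)
           (λ _ → inj₁) (λ _ → inj₂) outside#crossing)) ⟩
    # in₁? + (# in₂? + # (λ e → outside? e ⊎-dec crossing? e))
      ≤⟨ +-monoʳ-≤ (# in₁?) (#-disjoint in₂? (λ e → outside? e ⊎-dec crossing? e) (λ e → in₂? e ⊎-dec (outside? e ⊎-dec crossing? e))
           (λ _ → inj₁) (λ _ → inj₂) (λ e → in#rest e S₂ (q⊆p∪q S₁ S₂))) ⟩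
    # in₁? + # (λ e → in₂? e ⊎-dec (outside? e ⊎-dec crossing? e))
      ≤⟨ #-disjoint in₁? (λ e → in₂? e ⊎-dec (outside? e ⊎-dec crossing? e)) E? clique₁
           (λ { e (inj₁ h) → clique₂ e h ; e (inj₂ (inj₁ (_ , h))) → h ; e (inj₂ (inj₂ (h , _))) → h })
           (λ { e h (inj₁ (e⊆S₂ , _)) → let (x , x∈e) = nonempty-edge e (proj₂ h) in S₁#S₂ x (proj₁ h x∈e) (e⊆S₂ x∈e)
              ; e h (inj₂ r) → in#rest e S₁ (p⊆p∪q S₂) h r }) ⟩
    # E? ∎
    where
    open ≤-Reasoning
    outside#crossing : ∀ e → Disj e Z × E e → ¬ (E e × Disj e X × 0 < ∣ e ∩ W ∣ × ∣ e ∩ W ∣ < ℓ)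
    outside#crossing e (e#Z , Ee) (_ , e#X , _ , <ℓ) = <-irrefl refl (<-≤-trans <ℓ
      (≤-trans (≤-reflexive (sym (unif e Ee))) (p⊆q⇒∣p∣≤∣q∣ λ {x} x∈e → x∈p∩q⁺ (x∈e , ∈W (e#Z x x∈e) (e#X x x∈e)))))
    in#rest : ∀ e S → S ⊆ Z → e ⊆ S × ∣ e ∣ ≡ ℓ → ¬ ((Disj e Z × E e) ⊎ (E e × Disj e X × 0 < ∣ e ∩ W ∣ × ∣ e ∩ W ∣ < ℓ))
    in#rest e S S⊆Z (e⊆S , ∣e∣) (inj₁ (e#Z , _)) = let (x , x∈e) = nonempty-edge e ∣e∣ in e#Z x x∈e (S⊆Z (e⊆S x∈e))
    in#rest e S S⊆Z (e⊆S , ∣e∣) (inj₂ (_ , _ , 0< , _)) = meets-W e Z W#Z 0< λ h → S⊆Z (e⊆S h)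

  E′-isolated : ∀ e → E′ e → e ⊆ S₁ ⊎ Disj e S₁
  E′-isolated e (_ , inj₁ h)                             = inj₁ h
  E′-isolated e (_ , inj₂ (inj₁ h))                      = inj₂ λ x x∈e x∈S₁ → S₁#S₂ x x∈S₁ (h x∈e)
  E′-isolated e (_ , inj₂ (inj₂ (inj₁ (e#Z , _))))       = inj₂ λ x x∈e x∈S₁ → e#Z x x∈e (p⊆p∪q S₂ x∈S₁)
  E′-isolated e (_ , inj₂ (inj₂ (inj₂ (e#S₁ , _))))      = inj₂ e#S₁

  E′-clique₁ : IsClique ℓ E′ S₁
  E′-clique₁ e (h , ∣e∣) = ∣e∣ , inj₁ h

  E′-clique₂ : IsClique ℓ E′ S₂
  E′-clique₂ e (h , ∣e∣) = ∣e∣ , inj₂ (inj₁ h)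

  E′-N-clique : ∀ x → x ∈ X → IsClique ℓ E′ (N x)
  E′-N-clique x x∈X e (e⊆N , ∣e∣) = ∣e∣ , inj₂ (inj₂ (inj₁ ((λ y y∈e → N#Z x x∈X y (e⊆N y∈e)) , N-clique x x∈X e (e⊆N , ∣e∣))))

  -- A vertex with many attachments is joined to all of S₂.
  covered-many : ∀ y → y ∈ W → suc t C suc l ≤ #attachments ⁅ y ⁆ → t C k ≤ cliquesAt ℓ E′? (suc k) y
  covered-many y y∈W many = clique-covers ℓ E′? k t y (⁅ y ⁆ ∪ S₂) (p⊆p∪q S₂ (x∈⁅x⁆ y))
    (≤-trans (≤-reflexive (sym ∣S₂∣)) (∣q∣≤∣p∪q∣ ⁅ y ⁆ S₂)) cl
    where
    S₂#W : Disj S₂ W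
    S₂#W x x∈S₂ x∈W = W#Z x x∈W (q⊆p∪q S₁ S₂ x∈S₂)
    cl : IsClique ℓ E′ (⁅ y ⁆ ∪ S₂)
    cl e (e⊆ , ∣e∣) with y ∈? e
    ... | no y∉e = ∣e∣ , inj₂ (inj₁ λ {x} x∈e → [ (λ h → ⊥-elim (y∉e (subst (_∈ e) (x∈⁅y⁆⇒x≡y y h) x∈e))) , id ]′ (x∈p∪q⁻ ⁅ y ⁆ S₂ (e⊆ x∈e)))
    ... | yes y∈e = ∣e∣ , inj₂ (inj₂ (inj₂ (e#S₁ , subst (0 <_) (sym ∣e∩W∣) (s≤s z≤n) , subst (_< ℓ) (sym ∣e∩W∣) (s≤s (s≤s z≤n)) ,
        subst₂ (λ a Y → rank (ℓ ∸ a) (pull e) < #attachments Y) (sym ∣e∩W∣) (sym e∩W≡) (<-≤-trans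
          (pull-Y e (λ x x∈e x∈X → [ (λ h → W#X x (subst (_∈ W) (sym (x∈⁅y⁆⇒x≡y y h)) y∈W) x∈X) , X#S₂ x x∈X ]′ (x∈p∪q⁻ ⁅ y ⁆ S₂ (e⊆ x∈e)))
            (suc l) (suc-injective (trans (cong (_+ ∣ e ∩ V ∣) (sym ∣e∩W∣)) (trans (∣∩∣+∣∩∣ e W V (W⊎V e e#S₁) W#V) ∣e∣))))
          (≤-trans (≤-reflexive (cong (_C suc l) ∣S₂∣)) many)))))
      where
      e#S₁ : Disj e S₁
      e#S₁ x x∈e x∈S₁ = [ (λ h → W#S₁ x (subst (_∈ W) (sym (x∈⁅y⁆⇒x≡y y h)) y∈W) x∈S₁) , S₁#S₂ x x∈S₁ ]′ (x∈p∪q⁻ ⁅ y ⁆ S₂ (e⊆ x∈e))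
      e∩W≡ : e ∩ W ≡ ⁅ y ⁆
      e∩W≡ = ⊆-antisym
        (λ {x} h → let (x∈e , x∈W) = x∈p∩q⁻ e W h in [ id , (λ x∈S₂ → ⊥-elim (S₂#W x x∈S₂ x∈W)) ]′ (x∈p∪q⁻ ⁅ y ⁆ S₂ (e⊆ x∈e)))
        (λ {x} h → subst (_∈ e ∩ W) (sym (x∈⁅y⁆⇒x≡y y h)) (x∈p∩q⁺ (y∈e , y∈W)))
      ∣e∩W∣ : ∣ e ∩ W ∣ ≡ 1
      ∣e∩W∣ = trans (cong ∣_∣ e∩W≡) (∣⁅x⁆∣≡1 y)

  -- Every old clique through `y` avoids `X`: a vertex `x` of `X` in it would share an edge with
  -- `y`, and the edges at `x` stay in `N x`. So a clique is determined by its trace on `W` and its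
  -- part in `Z`, and old and new cliques are compared for each trace separately.
  module Few (y : Fin n) (y∈W : y ∈ W) (y∉N : ∀ x → x ∈ X → y ∉ N x) (few : #attachments ⁅ y ⁆ < suc t C suc l) where

    inE : ∀ Y → ∀ K → Dec ((y ∈ K × Complete ℓ E (suc k) K) × K ∩ W ≡ Y)
    inE Y K = ((y ∈? K) ×-dec complete? ℓ E? (suc k) K) ×-dec ((K ∩ W) ≟ˢ Y)

    inE′ : ∀ Y → ∀ K → Dec ((y ∈ K × Complete ℓ E′ (suc k) K) × K ∩ W ≡ Y)
    inE′ Y K = ((y ∈? K) ×-dec complete? ℓ E′? (suc k) K) ×-dec ((K ∩ W) ≟ˢ Y)

    edge-through : ∀ K → y ∈ K → Complete ℓ E (suc k) K → ∀ w → w ∈ K → ∃ λ e → E e × y ∈ e × w ∈ e × e ⊆ K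
    edge-through K y∈K (∣K∣ , cl) w w∈K =
      let (e , yw⊆e , e⊆K , ∣e∣) = between (⁅ y ⁆ ∪ ⁅ w ⁆) K yw⊆K ℓ yw≤ℓ (≤-trans (s≤s l<k) (≤-reflexive (sym ∣K∣)))
      in e , cl e (e⊆K , ∣e∣) , yw⊆e (p⊆p∪q ⁅ w ⁆ (x∈⁅x⁆ y)) , yw⊆e (q⊆p∪q ⁅ y ⁆ ⁅ w ⁆ (x∈⁅x⁆ w)) , e⊆K
      where
      yw⊆K : ⁅ y ⁆ ∪ ⁅ w ⁆ ⊆ K
      yw⊆K = ∪-⊆ (λ h → subst (_∈ K) (sym (x∈⁅y⁆⇒x≡y y h)) y∈K) (λ h → subst (_∈ K) (sym (x∈⁅y⁆⇒x≡y w h)) w∈K)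
      yw≤ℓ : ∣ ⁅ y ⁆ ∪ ⁅ w ⁆ ∣ ≤ ℓ
      yw≤ℓ = ≤-trans (m≤m+n _ _) (≤-trans (≤-reflexive (trans (∣p∪q∣+∣p∩q∣ ⁅ y ⁆ ⁅ w ⁆) (cong₂ _+_ (∣⁅x⁆∣≡1 y) (∣⁅x⁆∣≡1 w)))) (s≤s (s≤s z≤n)))

    K#X : ∀ K → y ∈ K → Complete ℓ E (suc k) K → Disj K X
    K#X K y∈K c x x∈K x∈X = let (e , Ee , y∈e , x∈e , _) = edge-through K y∈K c x x∈K in y∉N x x∈X (N-edges x x∈X e Ee x∈e y∈e)

    K∩Z⊆H : ∀ K → y ∈ K → Complete ℓ E (suc k) K → K ∩ Z ⊆ H
    K∩Z⊆H K y∈K c {w} h = let (w∈K , w∈Z) = x∈p∩q⁻ K Z h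
                              (e , Ee , y∈e , w∈e , _) = edge-through K y∈K c w w∈K
                          in attached e Ee y y∈e (W#Z y y∈W) w w∈e w∈Z

    module Fibre (Y : Subset n) (y∈Y : y ∈ Y) (Y⊆W : Y ⊆ W) (s : ℕ) (Y+s : ∣ Y ∣ + s ≡ suc k) where

      Ext : Subset n → Set
      Ext R = ∣ R ∣ ≡ s × R ⊆ Z × Complete ℓ E (suc k) (Y ∪ R)

      ext? : ∀ R → Dec (Ext R)
      ext? R = (∣ R ∣ ≟ s) ×-dec (R ⊆? Z) ×-dec complete? ℓ E? (suc k) (Y ∪ R)

      inE≤ext : # (inE Y) ≤ # ext?
      inE≤ext = #-inj (inE Y) ext? (_∩ Z) (Y ∪_)
          (λ { K ((y∈K , c) , refl) →
               +-cancelˡ-≡ ∣ K ∩ W ∣ _ _ (trans (trans (∣∩∣+∣∩∣ K W Z (W⊎Z K (K#X K y∈K c)) W#Z) (proj₁ c)) (sym Y+s)) ,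
               p∩q⊆q K Z , subst (Complete ℓ E (suc k)) (sym (∩∪∩ K W Z (W⊎Z K (K#X K y∈K c)))) c })
          (λ { K ((y∈K , c) , refl) → ∩∪∩ K W Z (W⊎Z K (K#X K y∈K c)) })

      Y#Z : Disj Y Z
      Y#Z x x∈Y = W#Z x (Y⊆W x∈Y)

      -- Every subset of size `i` of an extension of `Y` completes `Y′` to an edge, so
      -- Kruskal-Katona bounds the attachments of `Y′` from below. Since this holds for all traces
      -- `Y′` at once, a set `R` early enough for the extensions of `Y` is early enough for each of
      -- the edges required.
      ext-rank : ∀ Y′ → Y′ ⊆ Y → 0 < ∣ Y′ ∣ → ∀ i → ∣ Y′ ∣ + i ≡ ℓ → i ≤ s → ∀ {m} (R : Subset m) → rank s R < # ext? → rank i R < #attachments Y′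
      ext-rank Y′ Y′⊆Y 0<Y′ i Y′+i i≤s R h = <-≤-trans (kruskal-katona i s att? ext? i≤s
          (λ R (∣R∣ , R⊆Z , (_ , cl)) → ∣R∣ , λ T (T⊆R , ∣T∣) → (λ x∈T → R⊆Z (T⊆R x∈T)) ,
             cl (Y′ ∪ T) (∪-⊆-∪ Y′⊆Y T⊆R , trans (∣p∪q∣-disjoint Y′ T (λ h h' → Y#Z _ (Y′⊆Y h) (R⊆Z (T⊆R h'))))
                                                 (trans (cong (∣ Y′ ∣ +_) ∣T∣) Y′+i))) R h)
        (#-inj att? (attachments? Y′) (Y′ ∪_) (_∩ Z)
          (λ Q (Q⊆Z , Ee) → Ee ,
             (λ x h x∈X → [ (λ h' → W#X x (Y⊆W (Y′⊆Y h')) x∈X) , (λ x∈Q → X#Z x x∈X (Q⊆Z x∈Q)) ]′ (x∈p∪q⁻ Y′ Q h)) ,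
             ∪∩-left Y′ Q W (λ h → Y⊆W (Y′⊆Y h)) (λ x x∈Q x∈W → W#Z x x∈W (Q⊆Z x∈Q)))
          (λ Q (Q⊆Z , Ee) → ∪∩-right Y′ Q Z (λ x h → Y#Z x (Y′⊆Y h)) Q⊆Z))
        where
        att? : ∀ Q → Dec (Q ⊆ Z × E (Y′ ∪ Q))
        att? Q = (Q ⊆? Z) ×-dec E? (Y′ ∪ Q)

      y⊆Y : ⁅ y ⁆ ⊆ Y
      y⊆Y h = subst (_∈ Y) (sym (x∈⁅y⁆⇒x≡y y h)) y∈Y

      ext-rank-y : suc l ≤ s → ∀ {m} (R : Subset m) → rank s R < # ext? → rank (suc l) R < suc t C suc l
      ext-rank-y l<s R h = <-trans (ext-rank ⁅ y ⁆ y⊆Y (≤-reflexive (sym (∣⁅x⁆∣≡1 y))) (suc l) (cong (_+ suc l) (∣⁅x⁆∣≡1 y)) l<s R h) few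

      ext≤C : # ext? ≤ (∣ X ∣ + ∣ S₂ ∣) C s
      ext≤C with suc l ≤? s
      -- The singleton `true ∷ ∅ {suc t}` has rank `suc t C s` at index `s` and `suc t C suc l` at
      -- index `suc l`. More than `suc t C s` extensions would therefore give `y` too many
      -- attachments for `few`.
      ... | yes l<s = ≤-trans (≮⇒≥ λ h → <-irrefl refl (≤-<-trans (rank-∷∅-≥ l (suc t))
              (ext-rank-y l<s (true ∷ ∅ {suc t}) (≤-<-trans (rank-∷∅ s (suc t)) h))))
            (C-mono s (≤-trans (≤-reflexive (sym ∣S₂∣)) (m≤n+m _ _)))
      -- Kruskal-Katona passes to smaller sets only, so `few` says nothing about extensions by at
      -- most `l` vertices; they are counted as subsets of `H`.
      ... | no l≮s = ≤-trans (#-mono ext? (λ R → (R ⊆? H) ×-dec (∣ R ∣ ≟ s))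
            (λ R (∣R∣ , R⊆Z , c) → (λ x∈R → K∩Z⊆H (Y ∪ R) (p⊆p∪q R y∈Y) c (x∈p∩q⁺ (q⊆p∪q Y R x∈R , R⊆Z x∈R))) , ∣R∣))
            (≤-trans (≤-reflexive (#-⊆ H s)) (bound H-bound))
        where
        bound : l ≡ 0 ⊎ ∣ H ∣ ≤ ∣ X ∣ + suc t → ∣ H ∣ C s ≤ (∣ X ∣ + ∣ S₂ ∣) C s
        -- Here `s` is below 1, and both coefficients are those of the empty extension.
        bound (inj₁ refl) = subst (λ s → ∣ H ∣ C s ≤ (∣ X ∣ + ∣ S₂ ∣) C s) (sym (n<1⇒n≡0 (≰⇒> l≮s)))
                              (≤-reflexive (trans (C-zero ∣ H ∣) (sym (C-zero (∣ X ∣ + ∣ S₂ ∣)))))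
        bound (inj₂ h) = C-mono s (≤-trans h (≤-reflexive (cong (∣ X ∣ +_) (sym ∣S₂∣))))

      Y#V : Disj Y V
      Y#V x x∈Y = W#V x (Y⊆W x∈Y)

      push#W : ∀ R → Disj (push R) W
      push#W R x h x∈W = W#V x x∈W (push⊆ R h)

      -- By the size of the trace of an edge on `W`: a full trace lies in `Y`, hence in an old
      -- clique, which exists as the fibre is nonempty; a proper trace gives a new edge by
      -- `ext-rank`; an empty trace is possible only if `s` is at least ℓ, and then `few` forces
      -- `push R` into `S₂`.
      new-clique : 0 < # (inE Y) → ∀ (R : Subset (∣ X ∣ + ∣ S₂ ∣)) → ∣ R ∣ ≡ s → rank s R < # ext? → IsClique ℓ E′ (Y ∪ push R)
      new-clique 0<inE R ∣R∣ h e (e⊆ , ∣e∣) = ∣e∣ , go (0 <? ∣ e ∩ W ∣) (∣ e ∩ W ∣ <? ℓ)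
        where
        e#S₁ : Disj e S₁
        e#S₁ x x∈e x∈S₁ = [ (λ x∈Y → W#S₁ x (Y⊆W x∈Y) x∈S₁) , (λ h → V#S₁ x (push⊆ R h) x∈S₁) ]′ (x∈p∪q⁻ Y (push R) (e⊆ x∈e))
        ∩W⊆Y : e ∩ W ⊆ Y
        ∩W⊆Y {x} h = let (x∈e , x∈W) = x∈p∩q⁻ e W h in [ id , (λ h' → ⊥-elim (push#W R x h' x∈W)) ]′ (x∈p∪q⁻ Y (push R) (e⊆ x∈e))
        pull⊆R : pull e ⊆ R
        pull⊆R {i} i∈ = subst (i ∈_) (pull-∪-push Y R Y#V) (pull-mono e⊆ i∈)
        ∣W∣+∣pull∣ : ∣ e ∩ W ∣ + ∣ pull e ∣ ≡ ℓ
        ∣W∣+∣pull∣ = trans (cong (∣ e ∩ W ∣ +_) (∣pull∣ e)) (trans (∣∩∣+∣∩∣ e W V (W⊎V e e#S₁) W#V) ∣e∣)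
        ∣pull∣≤s : ∣ pull e ∣ ≤ s
        ∣pull∣≤s = ≤-trans (p⊆q⇒∣p∣≤∣q∣ pull⊆R) (≤-reflexive ∣R∣)
        go : Dec (0 < ∣ e ∩ W ∣) → Dec (∣ e ∩ W ∣ < ℓ) → e ⊆ S₁ ⊎ e ⊆ S₂ ⊎ (Disj e Z × E e) ⊎ New e
        go (yes 0<) (yes <ℓ) = inj₂ (inj₂ (inj₂ (e#S₁ , 0< , <ℓ ,
          subst (λ i → rank i (pull e) < #attachments (e ∩ W)) (trans (sym (m+n∸m≡n ∣ e ∩ W ∣ _)) (cong (_∸ ∣ e ∩ W ∣) ∣W∣+∣pull∣))
            (≤-<-trans (rank-mono ∣ pull e ∣ (pull e) R pull⊆R)
              (ext-rank (e ∩ W) ∩W⊆Y 0< ∣ pull e ∣ ∣W∣+∣pull∣ ∣pull∣≤s R h)))))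
        go (yes _) (no ≮ℓ) = inj₂ (inj₂ (inj₁ ((λ x x∈e → W#Z x (e⊆W x∈e)) , Ee)))
          where
          e⊆e∩W : e ⊆ e ∩ W
          e⊆e∩W = ⊆∧∣∣≥⇒⊇ (e ∩ W) e (p∩q⊆p e W) (≤-trans (≤-reflexive ∣e∣) (≮⇒≥ ≮ℓ))
          e⊆W : e ⊆ W
          e⊆W x∈e = p∩q⊆q e W (e⊆e∩W x∈e)
          Ee : E e
          Ee with #-∃ (inE Y) 0<inE
          ... | K , (_ , (_ , cl)) , refl = cl e ((λ x∈e → p∩q⊆p K W (∩W⊆Y (e⊆e∩W x∈e))) , ∣e∣)
        go (no ≮0) _ = inj₂ (inj₁ λ {x} x∈e → [ (λ x∈Y → ⊥-elim (∣S∣≡0⇒x∉S (e ∩ W) e∩W≡0 (x∈p∩q⁺ (x∈e , Y⊆W x∈Y)))) ,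
              push-Y l R (<-≤-trans (ext-rank-y l<s R h) (≤-reflexive (cong (_C suc l) (sym ∣S₂∣)))) ]′ (x∈p∪q⁻ Y (push R) (e⊆ x∈e)))
          where
          e∩W≡0 : ∣ e ∩ W ∣ ≡ 0
          e∩W≡0 = n≤0⇒n≡0 (≮⇒≥ ≮0)
          l<s : suc l ≤ s
          l<s = ≤-trans (n≤1+n (suc l)) (≤-trans (≤-reflexive (trans (sym ∣W∣+∣pull∣) (cong (_+ ∣ pull e ∣) e∩W≡0))) ∣pull∣≤s)

      fibre : # (inE Y) ≤ # (inE′ Y)
      fibre with 0 <? # (inE Y)
      ... | no ≮0 = ≤-trans (≮⇒≥ ≮0) z≤n
      ... | yes 0< = begin
        # (inE Y)                                            ≤⟨ #-ranked-≥ (∣ X ∣ + ∣ S₂ ∣) s (# (inE Y)) (≤-trans inE≤ext ext≤C) ⟩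
        # (ranked? {∣ X ∣ + ∣ S₂ ∣} s (# (inE Y)))           ≤⟨ #-inj (ranked? s (# (inE Y))) (inE′ Y) (λ R → Y ∪ push R) pull
            (λ R (∣R∣ , h) → (p⊆p∪q (push R) y∈Y ,
                (trans (∣p∪q∣-disjoint Y (push R) (λ h h' → push#W R _ h' (Y⊆W h))) (trans (cong (∣ Y ∣ +_) (trans (∣push∣ R) ∣R∣)) Y+s) ,
                 new-clique 0< R ∣R∣ (<-≤-trans h inE≤ext))) ,
              ∪∩-left Y (push R) W Y⊆W (push#W R))
            (λ R _ → pull-∪-push Y R Y#V) ⟩
        # (inE′ Y)                                           ∎
        where open ≤-Reasoning

    covered-few : t C k ≤ cliquesAt ℓ E′? (suc k) y
    covered-few = begin
      t C k                                     ≤⟨ covered y ⟩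
      cliquesAt ℓ E? (suc k) y                  ≡⟨ #-fibres (λ K → (y ∈? K) ×-dec complete? ℓ E? (suc k) K) (_∩ W) ⟩
      ∑ˢ (λ Y → # (inE Y))                      ≤⟨ ∑-mono (allSubsets n) fibre ⟩
      ∑ˢ (λ Y → # (inE′ Y))                     ≡⟨ #-fibres (λ K → (y ∈? K) ×-dec complete? ℓ E′? (suc k) K) (_∩ W) ⟨
      cliquesAt ℓ E′? (suc k) y                 ∎
      where
      open ≤-Reasoning
      fibre : ∀ Y → # (inE Y) ≤ # (inE′ Y)
      fibre Y with 0 <? # (inE Y)
      ... | no ≮0 = ≤-trans (≮⇒≥ ≮0) z≤n
      ... | yes 0< with #-∃ (inE Y) 0<
      ...   | K , (y∈K , (∣K∣ , _)) , refl with m≤n⇒∃[o]m+o≡n (≤-trans (∣p∩q∣≤∣p∣ K W) (≤-reflexive ∣K∣))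
      ...     | s , eq = Fibre.fibre (K ∩ W) (x∈p∩q⁺ (y∈K , y∈W)) (p∩q⊆q K W) s eq

  E′-covered : ∀ v → t C k ≤ cliquesAt ℓ E′? (suc k) v
  E′-covered v with v ∈? Z
  ... | yes v∈Z = [ (λ v∈S₁ → clique-covers ℓ E′? k t v S₁ v∈S₁ (≤-reflexive (sym ∣S₁∣)) E′-clique₁)
                  , (λ v∈S₂ → clique-covers ℓ E′? k t v S₂ v∈S₂ (≤-reflexive (sym ∣S₂∣)) E′-clique₂) ]′ (x∈p∪q⁻ S₁ S₂ v∈Z)
  ... | no v∉Z with Fin.any? (λ x → (x ∈? X) ×-dec (v ∈? N x))
  ...   | yes (x , x∈X , v∈N) = clique-covers ℓ E′? k t v (N x) v∈N (≤-reflexive (sym (∣N∣ x x∈X))) (E′-N-clique x x∈X)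
  ...   | no v∉N with suc t C suc l ≤? #attachments ⁅ v ⁆
  ...     | yes many = covered-many v v∈W many
    where v∈W = ∈W v∉Z λ v∈X → v∉N (v , v∈X , ∈N v v∈X)
  ...     | no ¬many = Few.covered-few v (∈W v∉Z λ v∈X → v∉N (v , v∈X , ∈N v v∈X)) (λ x x∈X h → v∉N (x , x∈X , h)) (≰⇒> ¬many)

  isolation : Isolation ℓ (suc k) (t C k) E? S₁
  isolation = record
    { Edge′    = E′
    ; edge′?   = E′?
    ; uniform′ = λ _ → proj₁
    ; fewer    = #E′≤#E
    ; covered′ = E′-covered
    ; clique   = E′-clique₁
    ; isolated = E′-isolated
    }

-- Vertices of least degree

record Home (ℓ : ℕ) (E : Subset n → Set) (t : ℕ) (v : Fin n) (S : Subset n) : Set where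
  field
    size   : ∣ S ∣ ≡ suc t
    v∈S    : v ∈ S
    clique : IsClique ℓ E S
    edges  : ∀ e → E e → v ∈ e → e ⊆ S

module LeastDegree {n : ℕ} {E : Subset n → Set} (E? : ∀ e → Dec (E e)) (l k t : ℕ) (l<k : suc l < k) (k≤t : k ≤ t)
  (unif : Uniform (suc (suc l)) E) (v : Fin n) (covered : t C k ≤ cliquesAt (suc (suc l)) E? (suc k) v) where

  ℓ : ℕ
  ℓ = suc (suc l)

  link-uniform : Uniform (suc l) (Link v E)
  link-uniform S (v∉S , e) = suc-injective (trans (sym (∣add∣ S v v∉S)) (unif _ e))

  ClV : Subset n → Set
  ClV K = v ∉ K × Complete ℓ E (suc k) (K ∪ ⁅ v ⁆)

  clV? : ∀ K → Dec (ClV K)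
  clV? K = ¬? (v ∈? K) ×-dec complete? ℓ E? (suc k) (K ∪ ⁅ v ⁆)

  #ClV : t C k ≤ # clV?
  #ClV = ≤-trans covered (≤-reflexive (#-link (complete? ℓ E? (suc k)) v))

  ClV-size : ∀ K → ClV K → ∣ K ∣ ≡ k
  ClV-size K (v∉K , ∣K∣ , _) = suc-injective (trans (sym (∣add∣ K v v∉K)) ∣K∣)

  ClV-link : ∀ K → ClV K → Complete (suc l) (Link v E) k K
  ClV-link K c@(v∉K , _ , cl) = ClV-size K c , λ T (T⊆K , ∣T∣) → (λ v∈T → v∉K (T⊆K v∈T)) ,
    cl (T ∪ ⁅ v ⁆) (∪-⊆-∪ T⊆K id , trans (∣add∣ T v λ v∈T → v∉K (T⊆K v∈T)) (cong suc ∣T∣))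

  #link : t C k ≤ # (complete? (suc l) (link? E? v) k)
  #link = ≤-trans #ClV (#-mono clV? (complete? (suc l) (link? E? v) k) ClV-link)

  deg≥ : t C suc l ≤ # (link? E? v)
  deg≥ = ≮⇒≥ λ deg< → <-irrefl refl (≤-<-trans #link
    (#-complete-< (suc l) k t (link? E? v) (<⇒≤ l<k) k≤t link-uniform deg<))

  -- Equality in Kruskal-Katona makes the link complete on `U` but yields no edge that misses `v`.
  -- For these the cliques are counted a second time: those through `v` lie in `U ∪ ⁅ v ⁆` and
  -- number at least `t C k`, so every subset of `U` of size `k` forms one with `v`; as ℓ ≤ `k`, any
  -- candidate edge in `U` fits into such a subset.
  home : # (link? E? v) ≡ t C suc l → ∃ (Home ℓ E t v)
  home deg≡ with lovász l k t (link? E? v) l<k k≤t link-uniform deg≡ #link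
  ... | U , ∣U∣ , link⊆U , ⊆U⇒link = U ∪ ⁅ v ⁆ , record
    { size   = trans (∣add∣ U v v∉U) (cong suc ∣U∣)
    ; v∈S    = ∈-add U v
    ; clique = clique
    ; edges  = λ e Ee v∈e → subst (_⊆ U ∪ ⁅ v ⁆) (add-remove e v v∈e)
                 (∪-⊆-∪ (link⊆U (e - v) (x∉p-x e v , subst E (sym (add-remove e v v∈e)) Ee)) id) }
    where
    through : ∀ K w → w ∈ K → suc l ≤ ∣ K ∣ → ∃ λ T → w ∈ T × T ⊆ K × ∣ T ∣ ≡ suc l
    through K w w∈K l<K = let (T , w⊆T , T⊆K , ∣T∣) = between ⁅ w ⁆ K (λ h → subst (_∈ K) (sym (x∈⁅y⁆⇒x≡y w h)) w∈K) (suc l)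
                                                          (≤-trans (≤-reflexive (∣⁅x⁆∣≡1 w)) (s≤s z≤n)) l<K
                          in T , w⊆T (x∈⁅x⁆ w) , T⊆K , ∣T∣
    v∉U : v ∉ U
    v∉U v∈U = let (T , v∈T , T⊆U , ∣T∣) = through U v v∈U (≤-trans (<⇒≤ (<-≤-trans l<k k≤t)) (≤-reflexive (sym ∣U∣)))
              in proj₁ (⊆U⇒link T T⊆U ∣T∣) v∈T
    ClV⊆U : ∀ K → ClV K → K ⊆ U
    ClV⊆U K c {w} w∈K = let (T , w∈T , T⊆K , ∣T∣) = through K w w∈K (≤-trans (<⇒≤ l<k) (≤-reflexive (sym (ClV-size K c))))
                        in link⊆U T (proj₂ (ClV-link K c) T (T⊆K , ∣T∣)) w∈T
    ⊆U⇒ClV : ∀ K → K ⊆ U × ∣ K ∣ ≡ k → ClV K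
    ⊆U⇒ClV = #-full clV? (λ K → (K ⊆? U) ×-dec (∣ K ∣ ≟ k)) (λ K c → (λ {x} → ClV⊆U K c {x}) , ClV-size K c)
      (≤-trans (≤-reflexive (trans (#-⊆ U k) (cong (_C k) ∣U∣))) #ClV)
    clique : IsClique ℓ E (U ∪ ⁅ v ⁆)
    clique e (e⊆ , ∣e∣) with v ∈? e
    ... | yes v∈e = subst E (add-remove e v v∈e) (proj₂ (⊆U⇒link (e - v)
            (λ {x} h → ∈-add⁻ U v (e⊆ (∈-remove e v h)) λ { refl → x∉p-x e v h })
            (suc-injective (trans (∣remove∣ e v v∈e) ∣e∣))))
    ... | no v∉e = let (K , e⊆K , K⊆U , ∣K∣) = between e U (λ {x} x∈e → ∈-add⁻ U v (e⊆ x∈e) λ { refl → v∉e x∈e }) k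
                                                 (≤-trans (≤-reflexive ∣e∣) l<k) (≤-trans k≤t (≤-reflexive (sym ∣U∣)))
                   in proj₂ (proj₂ (⊆U⇒ClV K (K⊆U , ∣K∣))) e ((λ h → p⊆p∪q ⁅ v ⁆ (e⊆K h)) , ∣e∣)

-- Counting the vertices of least degree

∑-split : {P : Fin n → Set} (P? : ∀ v → Dec (P v)) (f : Fin n → ℕ) →
          ∑ᵛ f ≡ ∑ᵛ (λ v → ind (P? v) * f v) + ∑ᵛ (λ v → ind (¬? (P? v)) * f v)
∑-split {n} P? f = trans (∑-cong (vertices n) λ v → go v (P? v)) (∑-+ (vertices n) _ _)
  where
  go : ∀ v (p? : Dec _) → f v ≡ ind p? * f v + ind (¬? p?) * f v
  go v (yes _) = sym (trans (+-identityʳ _) (+-identityʳ _))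
  go v (no _)  = sym (+-identityʳ _)

∑-1 : ∀ n → ∑ᵛ {n} (λ _ → 1) ≡ n
∑-1 zero    = refl
∑-1 (suc n) = trans (∑ᵛ-suc {n} (λ _ → 1)) (cong suc (∑-1 n))

clique-codeg : ∀ l {E : Subset n → Set} (E? : ∀ e → Dec (E e)) t (w x : Fin n) (S : Subset n) → IsClique (suc (suc l)) E S →
               ∣ S ∣ ≡ suc (suc t) → w ∈ S → x ∈ S → x ≢ w → t C l ≤ # (λ T → (x ∈? T) ×-dec link? E? w T)
clique-codeg l {E} E? t w x S cl ∣S∣ w∈S x∈S x≢w = begin
  t C l                                          ≡⟨ #-between ⁅ x ⁆ (S - w) x⊆ t (trans (suc-injective (trans (∣remove∣ S w w∈S) ∣S∣)) (cong (_+ t) (sym (∣⁅x⁆∣≡1 x)))) l ⟨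
  # (between? ⁅ x ⁆ (S - w) (∣ ⁅ x ⁆ ∣ + l))     ≤⟨ #-mono (between? ⁅ x ⁆ (S - w) (∣ ⁅ x ⁆ ∣ + l)) (λ T → (x ∈? T) ×-dec link? E? w T)
    (λ T (x⊆T , T⊆ , ∣T∣) → let w∉T = λ h → x∉p-x S w (T⊆ h) in
      x⊆T (x∈⁅x⁆ x) , w∉T , cl (T ∪ ⁅ w ⁆)
        (∪-⊆ (λ h → ∈-remove S w (T⊆ h)) (λ h → subst (_∈ S) (sym (x∈⁅y⁆⇒x≡y w h)) w∈S) ,
         trans (∣add∣ T w w∉T) (cong suc (trans ∣T∣ (cong (_+ l) (∣⁅x⁆∣≡1 x)))))) ⟩
  # (λ T → (x ∈? T) ×-dec link? E? w T)          ∎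
  where
  open ≤-Reasoning
  x⊆ : ⁅ x ⁆ ⊆ S - w
  x⊆ h = subst (_∈ S - w) (sym (x∈⁅y⁆⇒x≡y x h)) (x∈p∧x≢y⇒x∈p-y x∈S x≢w)

-- `c` is the number of edges through two given vertices of a clique on t + 1 vertices, where t is
-- `suc t′`. It is used with `Z` empty, one such clique, and two disjoint ones.
module Excess {n : ℕ} {E : Subset n → Set} (E? : ∀ e → Dec (E e)) (l t′ : ℕ) (unif : Uniform (suc (suc l)) E)
  (deg≥ : ∀ v → suc t′ C suc l ≤ # (link? E? v))
  (N : Fin n → Subset n) (home : ∀ v → # (link? E? v) ≡ suc t′ C suc l → Home (suc (suc l)) E (suc t′) v (N v))
  (Z : Subset n)
  (cliques : ∀ w → w ∈ Z → ∃ λ S → S ⊆ Z × w ∈ S × ∣ S ∣ ≡ suc (suc t′) × IsClique (suc (suc l)) E S)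
  where

  D c : ℕ
  D = suc t′ C suc l
  c = t′ C l

  deg : Fin n → ℕ
  deg v = # (link? E? v)

  Low : Fin n → Set
  Low v = deg v ≡ D

  low? : ∀ v → Dec (Low v)
  low? v = deg v ≟ D

  out? : ∀ v → Dec (v ∉ Z)
  out? v = ¬? (v ∈? Z)

  near? : ∀ v → Dec ((v ∉ Z × Low v) × ¬ Disj (N v) Z)
  near? v = (out? v ×-dec low? v) ×-dec ¬? (disj? (N v) Z)

  far? : ∀ v → Dec ((v ∉ Z × Low v) × Disj (N v) Z)
  far? v = (out? v ×-dec low? v) ×-dec disj? (N v) Z

  near far highIn highOut degIn degOut : ℕ
  near    = ∑ᵛ λ v → ind (near? v)
  far     = ∑ᵛ λ v → ind (far? v)
  highIn  = ∑ᵛ λ v → ind ((v ∈? Z) ×-dec ¬? (low? v))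
  highOut = ∑ᵛ λ v → ind (out? v ×-dec ¬? (low? v))
  degIn   = ∑ᵛ λ v → ind (v ∈? Z) * deg v
  degOut  = ∑ᵛ λ v → ind (out? v) * deg v

  deg-sum : suc (suc l) * # E? ≡ degIn + degOut
  deg-sum = trans (sym (∑-deg E? (suc (suc l)) unif)) (∑-split (_∈? Z) deg)

  n-sum : n ≡ ∣ Z ∣ + (near + far + highOut)
  n-sum = begin
    n                                                              ≡⟨ ∑-1 n ⟨
    ∑ᵛ {n} (λ _ → 1)                                               ≡⟨ ∑-cong (vertices n) pt ⟩
    ∑ᵛ (λ v → ind (v ∈? Z) + (ind (near? v) + ind (far? v) + ind (out? v ×-dec ¬? (low? v))))
                                                                   ≡⟨ ∑-+ (vertices n) _ _ ⟩
    ∑ᵛ (λ v → ind (v ∈? Z)) + ∑ᵛ (λ v → ind (near? v) + ind (far? v) + ind (out? v ×-dec ¬? (low? v)))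
                                                                   ≡⟨ cong₂ _+_ (∑ᵛ-∈ Z) (trans (∑-+ (vertices n) _ _) (cong (_+ highOut) (∑-+ (vertices n) _ _))) ⟩
    ∣ Z ∣ + (near + far + highOut)                                 ∎
    where
    open ≡-Reasoning
    pt : ∀ v → 1 ≡ ind (v ∈? Z) + (ind (near? v) + ind (far? v) + ind (out? v ×-dec ¬? (low? v)))
    pt v with v ∈? Z
    ... | yes _ = refl
    ... | no _ with low? v
    ...   | no _ = refl
    ...   | yes _ with disj? (N v) Z
    ...     | yes _ = refl
    ...     | no _  = refl

  deg-high : ∀ v → D + ind (¬? (low? v)) ≤ deg v
  deg-high v with low? v
  ... | yes low = ≤-reflexive (trans (+-identityʳ D) (sym low))
  ... | no high = ≤-trans (≤-reflexive (+-comm D 1)) (≤∧≢⇒< (deg≥ v) (high ∘ sym))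

  part : {P : Fin n → Set} (P? : ∀ v → Dec (P v)) →
         ∑ᵛ (λ v → ind (P? v)) * D + ∑ᵛ (λ v → ind (P? v ×-dec ¬? (low? v))) ≤ ∑ᵛ (λ v → ind (P? v) * deg v)
  part P? = begin
    ∑ᵛ (λ v → ind (P? v)) * D + ∑ᵛ (λ v → ind (P? v ×-dec ¬? (low? v)))
      ≡⟨ cong₂ _+_ (trans (*-comm _ D) (sym (∑-*ˡ (vertices n) D _))) (∑-cong (vertices n) λ v → ind-× (P? v) (¬? (low? v))) ⟩
    ∑ᵛ (λ v → D * ind (P? v)) + ∑ᵛ (λ v → ind (P? v) * ind (¬? (low? v)))
      ≡⟨ ∑-+ (vertices n) _ _ ⟨
    ∑ᵛ (λ v → D * ind (P? v) + ind (P? v) * ind (¬? (low? v)))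
      ≤⟨ ∑-mono (vertices n) (λ v → ≤-trans (≤-reflexive (trans (cong (_+ ind (P? v) * ind (¬? (low? v))) (*-comm D (ind (P? v)))) (sym (*-distribˡ-+ (ind (P? v)) D _))))
                                            (*-monoʳ-≤ (ind (P? v)) (deg-high v))) ⟩
    ∑ᵛ (λ v → ind (P? v) * deg v) ∎
    where open ≤-Reasoning

  degIn≥high : ∣ Z ∣ * D + highIn ≤ degIn
  degIn≥high = ≤-trans (≤-reflexive (cong (λ z → z * D + highIn) (sym (∑ᵛ-∈ Z)))) (part (_∈? Z))

  degOut≥ : (near + far + highOut) * D + highOut ≤ degOut
  degOut≥ = ≤-trans (≤-reflexive (cong (λ z → z * D + highOut) (sym out≡))) (part out?)
    where
    open ≡-Reasoning
    out≡ : ∑ᵛ (λ v → ind (out? v)) ≡ near + far + highOut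
    out≡ = +-cancelˡ-≡ ∣ Z ∣ _ _ (begin
      ∣ Z ∣ + ∑ᵛ (λ v → ind (out? v))                      ≡⟨ cong (_+ ∑ᵛ (λ v → ind (out? v))) (∑ᵛ-∈ Z) ⟨
      ∑ᵛ (λ v → ind (v ∈? Z)) + ∑ᵛ (λ v → ind (out? v))    ≡⟨ cong₂ _+_ (∑-cong (vertices n) λ v → sym (*-identityʳ _)) (∑-cong (vertices n) λ v → sym (*-identityʳ _)) ⟩
      ∑ᵛ (λ v → ind (v ∈? Z) * 1) + ∑ᵛ (λ v → ind (out? v) * 1) ≡⟨ ∑-split (_∈? Z) (λ _ → 1) ⟨
      ∑ᵛ {n} (λ _ → 1)                                     ≡⟨ ∑-1 n ⟩
      n                                                    ≡⟨ n-sum ⟩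
      ∣ Z ∣ + (near + far + highOut)                       ∎)

  lowOut? : ∀ w x → Dec ((x ∉ Z × Low x) × w ∈ N x)
  lowOut? w x = (out? x ×-dec low? x) ×-dec (w ∈? N x)

  -- Every vertex outside Z of least degree whose clique contains w adds c to the sum of the codegrees of w.
  excess-at : ∀ w → w ∈ Z → suc l * D + c * ∑ᵛ (λ x → ind (lowOut? w x)) ≤ suc l * deg w
  excess-at w w∈Z with cliques w w∈Z
  ... | S , S⊆Z , w∈S , ∣S∣ , cl = begin
    suc l * D + c * ∑ᵛ (λ x → ind (lowOut? w x))
      -- By absorption `suc l * D` equals `suc t′ * c`, the contribution of the clique `S` alone to
      -- the codegrees at `w`.
      ≡⟨ cong (_+ c * ∑ᵛ (λ x → ind (lowOut? w x))) (trans (absorption t′ l) (trans (*-comm (suc t′) c) (cong (c *_) (sym (trans (∑ᵛ-∈ (S - w)) ∣S-w∣))))) ⟩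
    c * ∑ᵛ (λ x → ind (x ∈? (S - w))) + c * ∑ᵛ (λ x → ind (lowOut? w x))
      ≡⟨ *-distribˡ-+ c _ _ ⟨
    c * (∑ᵛ (λ x → ind (x ∈? (S - w))) + ∑ᵛ (λ x → ind (lowOut? w x)))
      ≡⟨ cong (c *_) (∑-+ (vertices n) _ _) ⟨
    c * ∑ᵛ (λ x → ind (x ∈? (S - w)) + ind (lowOut? w x))
      ≡⟨ ∑-*ˡ (vertices n) c _ ⟨
    ∑ᵛ (λ x → c * (ind (x ∈? (S - w)) + ind (lowOut? w x)))
      ≤⟨ ∑-mono (vertices n) codeg ⟩
    ∑ᵛ (λ x → # (λ T → (x ∈? T) ×-dec link? E? w T))
      ≡⟨ ∑ᵛ-∋ (link? E? w) (suc l) (λ T (w∉T , e) → suc-injective (trans (sym (∣add∣ T w w∉T)) (unif _ e))) ⟩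
    suc l * deg w ∎
    where
    open ≤-Reasoning
    ∣S-w∣ : ∣ S - w ∣ ≡ suc t′
    ∣S-w∣ = suc-injective (trans (∣remove∣ S w w∈S) ∣S∣)
    codeg : ∀ x → c * (ind (x ∈? (S - w)) + ind (lowOut? w x)) ≤ # (λ T → (x ∈? T) ×-dec link? E? w T)
    codeg x with x ∈? (S - w) | lowOut? w x
    ... | no _ | no _ = ≤-trans (≤-reflexive (*-zeroʳ c)) z≤n
    ... | yes x∈ | yes ((x∉Z , _) , _) = ⊥-elim (x∉Z (S⊆Z (∈-remove S w x∈)))
    ... | yes x∈ | no _ = ≤-trans (≤-reflexive (*-identityʳ c))
      (clique-codeg l E? t′ w x S cl ∣S∣ w∈S (∈-remove S w x∈) λ { refl → x∉p-x S w x∈ })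
    ... | no _ | yes ((x∉Z , low) , w∈N) = ≤-trans (≤-reflexive (*-identityʳ c))
      (clique-codeg l E? t′ w x (N x) (Home.clique (home x low)) (Home.size (home x low)) w∈N (Home.v∈S (home x low)) λ { refl → x∉Z w∈Z })

  degIn≥near : suc l * (∣ Z ∣ * D) + c * near ≤ suc l * degIn
  degIn≥near = begin
    suc l * (∣ Z ∣ * D) + c * near
      ≤⟨ +-mono-≤ (≤-reflexive (trans (sym (*-assoc (suc l) ∣ Z ∣ D)) (trans (cong (_* D) (*-comm (suc l) ∣ Z ∣)) (*-assoc ∣ Z ∣ (suc l) D))))
                  (*-monoʳ-≤ c near≤) ⟩
    ∣ Z ∣ * (suc l * D) + c * ∑ᵛ (λ w → ind (w ∈? Z) * ∑ᵛ (λ x → ind (lowOut? w x)))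
      ≡⟨ cong₂ _+_ (trans (*-comm ∣ Z ∣ _) (trans (cong (suc l * D *_) (sym (∑ᵛ-∈ Z))) (sym (∑-*ˡ (vertices n) (suc l * D) _)))) (sym (∑-*ˡ (vertices n) c _)) ⟩
    ∑ᵛ (λ w → suc l * D * ind (w ∈? Z)) + ∑ᵛ (λ w → c * (ind (w ∈? Z) * ∑ᵛ (λ x → ind (lowOut? w x))))
      ≡⟨ ∑-+ (vertices n) _ _ ⟨
    ∑ᵛ (λ w → suc l * D * ind (w ∈? Z) + c * (ind (w ∈? Z) * ∑ᵛ (λ x → ind (lowOut? w x))))
      ≤⟨ ∑-mono (vertices n) (λ w → ≤-trans (≤-reflexive (arith (suc l * D) (ind (w ∈? Z)) c _)) (≤-trans (ind-*-≤ (w ∈? Z) (excess-at w))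
           (≤-reflexive (*-swap (ind (w ∈? Z)) (suc l) (deg w))))) ⟩
    ∑ᵛ (λ w → suc l * (ind (w ∈? Z) * deg w))
      ≡⟨ ∑-*ˡ (vertices n) (suc l) _ ⟩
    suc l * degIn ∎
    where
    open ≤-Reasoning
    arith : ∀ a i c s → a * i + c * (i * s) ≡ i * (a + c * s)
    arith = solve 4 (λ a i c s → a :* i :+ c :* (i :* s) := i :* (a :+ c :* s)) refl
      where open +-*-Solver
    near≤ : near ≤ ∑ᵛ (λ w → ind (w ∈? Z) * ∑ᵛ (λ x → ind (lowOut? w x)))
    near≤ = begin
      near                                                                ≤⟨ ∑-mono (vertices n) pt ⟩
      ∑ᵛ (λ x → ∑ᵛ (λ w → ind (w ∈? Z) * ind (lowOut? w x)))              ≡⟨ ∑-swap (vertices n) (vertices n) _ ⟩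
      ∑ᵛ (λ w → ∑ᵛ (λ x → ind (w ∈? Z) * ind (lowOut? w x)))              ≡⟨ ∑-cong (vertices n) (λ w → ∑-*ˡ (vertices n) (ind (w ∈? Z)) _) ⟩
      ∑ᵛ (λ w → ind (w ∈? Z) * ∑ᵛ (λ x → ind (lowOut? w x)))              ∎
      where
      pt : ∀ x → ind (near? x) ≤ ∑ᵛ (λ w → ind (w ∈? Z) * ind (lowOut? w x))
      pt x with near? x
      ... | no _ = z≤n
      ... | yes (lo , ¬disj) with Fin.any? (λ w → (w ∈? N x) ×-dec (w ∈? Z))
      ...   | no h = ⊥-elim (¬disj λ w w∈N w∈Z → h (w , w∈N , w∈Z))
      ...   | yes (w , w∈N , w∈Z) = begin
        1                                                    ≡⟨ ∑ᵛ-single w ⟨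
        ∑ᵛ (λ w′ → ind (w Fin.≟ w′))                         ≤⟨ ∑-mono (vertices n) (λ w′ → ≤-trans
          (ind-mono (w Fin.≟ w′) ((w′ ∈? Z) ×-dec lowOut? w′ x) λ { refl → w∈Z , lo , w∈N })
          (≤-reflexive (ind-× (w′ ∈? Z) (lowOut? w′ x)))) ⟩
        ∑ᵛ (λ w′ → ind (w′ ∈? Z) * ind (lowOut? w′ x))       ∎

  module _ (E₀ : ℕ) (few-edges : suc (suc l) * # E? ≤ n * D + E₀) where

    few : degIn + highOut ≤ ∣ Z ∣ * D + E₀
    few = +-cancelˡ-≤ ((near + far + highOut) * D) _ _ (begin
      o * D + (degIn + highOut)             ≡⟨ solve 3 (λ a b c → a :+ (b :+ c) := b :+ (a :+ c)) refl (o * D) degIn highOut ⟩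
      degIn + (o * D + highOut)             ≤⟨ +-monoʳ-≤ degIn degOut≥ ⟩
      degIn + degOut                        ≡⟨ deg-sum ⟨
      suc (suc l) * # E?                    ≤⟨ few-edges ⟩
      n * D + E₀                            ≡⟨ cong (λ n → n * D + E₀) n-sum ⟩
      (∣ Z ∣ + o) * D + E₀                  ≡⟨ solve 4 (λ z o d e → (z :+ o) :* d :+ e := o :* d :+ (z :* d :+ e)) refl ∣ Z ∣ o D E₀ ⟩
      o * D + (∣ Z ∣ * D + E₀)              ∎)
      where
      open ≤-Reasoning
      open +-*-Solver
      o = near + far + highOut

    excess : ℕ
    excess = degIn ∸ ∣ Z ∣ * D

    degIn≡ : ∣ Z ∣ * D + excess ≡ degIn
    degIn≡ = m+[n∸m]≡n (≤-trans (m≤m+n (∣ Z ∣ * D) highIn) degIn≥high)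

    highIn≤excess : highIn ≤ excess
    highIn≤excess = +-cancelˡ-≤ (∣ Z ∣ * D) _ _ (≤-trans degIn≥high (≤-reflexive (sym degIn≡)))

    excess+highOut≤ : excess + highOut ≤ E₀
    excess+highOut≤ = +-cancelˡ-≤ (∣ Z ∣ * D) _ _ (≤-trans (≤-reflexive (trans (sym (+-assoc (∣ Z ∣ * D) excess highOut)) (cong (_+ highOut) degIn≡))) few)

    near≤excess : c * near ≤ suc l * excess
    near≤excess = +-cancelˡ-≤ (suc l * (∣ Z ∣ * D)) _ _ (≤-trans degIn≥near
      (≤-reflexive (trans (cong (suc l *_) (sym degIn≡)) (*-distribˡ-+ (suc l) (∣ Z ∣ * D) excess))))

    excess≤ : ∀ a → a + E₀ ≤ n → a + excess ≤ ∣ Z ∣ + (near + far)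
    excess≤ a h = +-cancelʳ-≤ highOut _ _ (begin
      a + excess + highOut                   ≡⟨ +-assoc a excess highOut ⟩
      a + (excess + highOut)                 ≤⟨ +-monoʳ-≤ a excess+highOut≤ ⟩
      a + E₀                                 ≤⟨ h ⟩
      n                                      ≡⟨ trans n-sum (sym (+-assoc ∣ Z ∣ (near + far) highOut)) ⟩
      ∣ Z ∣ + (near + far) + highOut         ∎)
      where open ≤-Reasoning

    module _ (n-large : E₀ + 2 * suc t′ < n) where

      excess≤′ : ∀ z → ∣ Z ∣ ≡ z → suc (2 * suc t′) + excess ≤ z + (near + far)
      excess≤′ _ refl = excess≤ (suc (2 * suc t′)) (≤-trans (≤-reflexive (cong suc (+-comm (2 * suc t′) E₀))) n-large)

      -- Each near vertex costs at least one unit of excess, which the bound on `n` allows for. Of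
      -- the margin 2t + 1 the set `Z` absorbs t + 1, so at least t far vertices remain.
      far-positive : ∣ Z ∣ ≡ suc (suc t′) → suc l ≤ c → 0 < far
      far-positive ∣Z∣ l<c = ≤-trans (s≤s z≤n) (+-cancelˡ-≤ (suc (suc t′) + excess) _ _ (begin
        suc (suc t′) + excess + suc t′       ≡⟨ solve 2 (λ t e → con 2 :+ t :+ e :+ (con 1 :+ t) := con 1 :+ con 2 :* (con 1 :+ t) :+ e) refl t′ excess ⟩
        suc (2 * suc t′) + excess            ≤⟨ excess≤′ (suc (suc t′)) ∣Z∣ ⟩
        suc (suc t′) + (near + far)          ≤⟨ +-monoʳ-≤ (suc (suc t′)) (+-monoˡ-≤ far near≤) ⟩
        suc (suc t′) + (excess + far)        ≡⟨ +-assoc (suc (suc t′)) excess far ⟨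
        suc (suc t′) + excess + far          ∎))
        where
        open ≤-Reasoning
        open +-*-Solver
        near≤ : near ≤ excess
        near≤ = *-cancelˡ-≤ (suc l) (≤-trans (*-monoˡ-≤ near l<c) near≤excess)

      -- With at most t near vertices the excess is at most far + t + 1. Otherwise the factor 3
      -- gives 3 near ≤ excess ≤ far + 1 + near, hence 2 near ≤ far + 1, and even the whole of `Z`,
      -- with 2 (t + 1) vertices, is small enough.
      highIn≤far : ∣ Z ∣ ≡ suc (suc t′) + suc (suc t′) → 3 * suc l ≤ c → highIn ≤ far + suc (suc t′)
      highIn≤far ∣Z∣ 3l<c with near ≤? suc t′
      ... | yes near≤ = begin
        highIn                          ≤⟨ highIn≤excess ⟩
        excess                          ≤⟨ excess≤1 ⟩
        suc (near + far)                ≤⟨ s≤s (+-monoˡ-≤ far near≤) ⟩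
        suc (suc t′) + far              ≡⟨ +-comm (suc (suc t′)) far ⟩
        far + suc (suc t′)              ∎
        where
        open ≤-Reasoning
        open +-*-Solver
        excess≤1 : excess ≤ suc (near + far)
        excess≤1 = +-cancelˡ-≤ (suc (2 * suc t′)) _ _ (≤-trans (excess≤′ _ ∣Z∣) (≤-reflexive
          (solve 2 (λ t x → (con 2 :+ t) :+ (con 2 :+ t) :+ x := con 1 :+ con 2 :* (con 1 :+ t) :+ (con 1 :+ x)) refl t′ (near + far))))
      ... | no near≰ = begin
        highIn                          ≤⟨ ∑-mono (vertices n) (λ v → ind-mono ((v ∈? Z) ×-dec ¬? (low? v)) (v ∈? Z) proj₁) ⟩
        ∑ᵛ (λ v → ind (v ∈? Z))         ≡⟨ trans (∑ᵛ-∈ Z) ∣Z∣ ⟩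
        suc (suc t′) + suc (suc t′)     ≤⟨ +-mono-≤ (≰⇒> near≰) (≰⇒> near≰) ⟩
        near + near                     ≤⟨ +-cancelʳ-≤ near _ _ (begin
          near + near + near              ≡⟨ solve 1 (λ x → x :+ x :+ x := con 3 :* x) refl near ⟩
          3 * near                        ≤⟨ *-cancelˡ-≤ (suc l) (≤-trans (≤-reflexive (sym (trans (cong (_* near) (*-comm 3 (suc l))) (*-assoc (suc l) 3 near))))
                                               (≤-trans (*-monoˡ-≤ near 3l<c) near≤excess)) ⟩
          excess                          ≤⟨ +-cancelˡ-≤ (suc (2 * suc t′)) _ _ (≤-trans (excess≤′ _ ∣Z∣) (≤-reflexive
            (solve 3 (λ t x f → (con 2 :+ t) :+ (con 2 :+ t) :+ (x :+ f) := con 1 :+ con 2 :* (con 1 :+ t) :+ ((f :+ con 1) :+ x)) refl t′ near far))) ⟩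
          far + 1 + near                  ∎) ⟩
        far + 1                         ≤⟨ +-monoʳ-≤ far (s≤s z≤n) ⟩
        far + suc (suc t′)              ∎
        where
        open ≤-Reasoning
        open +-*-Solver

-- Disjoint cliques, the last two of which may overlap

4rm≤ : ∀ r m → 4 * (r * m) ≤ (r + m) * (r + m)
4rm≤ r m with ≤-total r m
... | inj₁ r≤m with m≤n⇒∃[o]m+o≡n r≤m
...   | d , refl = ≤-trans (m≤m+n _ (d * d)) (≤-reflexive
          (solve 2 (λ r d → con 4 :* (r :* (r :+ d)) :+ d :* d := (r :+ (r :+ d)) :* (r :+ (r :+ d))) refl r d))
  where open +-*-Solver
4rm≤ r m | inj₂ m≤r with m≤n⇒∃[o]m+o≡n m≤r
...   | d , refl = ≤-trans (m≤m+n _ (d * d)) (≤-reflexive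
          (solve 2 (λ m d → con 4 :* ((m :+ d) :* m) :+ d :* d := ((m :+ d) :+ m) :* ((m :+ d) :+ m)) refl m d))
  where open +-*-Solver

-- Pascal's rule makes each of the `r` steps from `m` to `m + r` cost at most `T C l`.
C-increment : ∀ l T r m → m + r ≤ suc T → (m + r) C suc l ≤ r * (T C l) + m C suc l
C-increment l T zero    m h = ≤-reflexive (cong (_C suc l) (+-identityʳ m))
C-increment l T (suc r) m h = begin
  (m + suc r) C suc l                     ≡⟨ cong (_C suc l) (+-suc m r) ⟩
  suc (m + r) C suc l                     ≡⟨ pascal (m + r) l ⟩
  (m + r) C l + (m + r) C suc l           ≤⟨ +-mono-≤ (C-mono l (s≤s⁻¹ h′)) (C-increment l T r m (≤-trans (n≤1+n _) h′)) ⟩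
  T C l + (r * (T C l) + m C suc l)       ≡⟨ +-assoc (T C l) _ _ ⟨
  suc r * (T C l) + m C suc l             ∎
  where
  open ≤-Reasoning
  h′ : suc (m + r) ≤ suc T
  h′ = ≤-trans (≤-reflexive (sym (+-suc m r))) h

∣─∣ : (W B : Subset n) → B ⊆ W → ∣ B ∣ + ∣ W ─ B ∣ ≡ ∣ W ∣
∣─∣ W B B⊆W = trans (sym (∣p∪q∣-disjoint B (W ─ B) λ x∈B h → x∈p─q⇒x∉q W B h x∈B)) (cong ∣_∣ (⊆-antisym
  (∪-⊆ B⊆W (p─q⊆p W B))
  λ {x} x∈W → cover x x∈W (x ∈? B)))
  where
  cover : ∀ x → x ∈ W → Dec (x ∈ B) → x ∈ B ∪ (W ─ B)
  cover x x∈W (yes x∈B) = p⊆p∪q (W ─ B) x∈B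
  cover x x∈W (no x∉B)  = q⊆p∪q B (W ─ B) (x∈p∧x∉q⇒x∈p─q x∈W x∉B)

-- `rest` counts the vertices left for the last clique and `shared` those it borrows from another
-- one. Their product times `t′ C l` bounds the surplus of the degree sum over the least conceivable
-- one.
record Packing (l t′ : ℕ) (V : Subset n) : Set₁ where
  field
    Edge     : Subset n → Set
    edge?    : ∀ e → Dec (Edge e)
    uniform  : Uniform (suc (suc l)) Edge
    cliques  : ∀ v → v ∈ V → ∃ λ S → v ∈ S × ∣ S ∣ ≡ suc (suc t′) × IsClique (suc (suc l)) Edge S
    rest shared : ℕ
    rest+shared : rest + shared ≡ suc (suc t′)
    few      : suc (suc l) * # edge? ≤ ∣ V ∣ * (suc t′ C suc l) + rest * shared * (t′ C l)

module _ {n : ℕ} (l t′ : ℕ) where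

  private
    ℓ D c : ℕ
    ℓ = suc (suc l)
    D = suc t′ C suc l
    c = t′ C l

  in? : (S : Subset n) → ∀ e → Dec (e ⊆ S × ∣ e ∣ ≡ ℓ)
  in? S e = (e ⊆? S) ×-dec (∣ e ∣ ≟ ℓ)

  #-in : (S : Subset n) → ∀ m → ∣ S ∣ ≡ suc m → ℓ * # (in? S) ≡ suc m * (m C suc l)
  #-in S m ∣S∣ = trans (cong (ℓ *_) (trans (#-⊆ S ℓ) (cong (_C ℓ) ∣S∣))) (absorption m (suc l))

  -- Edges inside the overlap `B′` are counted once instead of twice. So the surplus is at most that
  -- of the `suc m` vertices of `B′`, each bounded by D - C(m, l + 1) ≤ r c through `C-increment`.
  overlapping : (B W : Subset n) → ∣ B ∣ ≡ suc (suc t′) → Disj B W → ∣ W ∣ ≤ suc t′ → Packing l t′ (B ∪ W)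
  overlapping B W ∣B∣ B#W W≤ with m≤n⇒∃[o]m+o≡n W≤
  ... | m , eq = record
    { Edge    = λ e → (e ⊆ B × ∣ e ∣ ≡ ℓ) ⊎ (e ⊆ S × ∣ e ∣ ≡ ℓ)
    ; edge?   = λ e → in? B e ⊎-dec in? S e
    ; uniform = λ e → [ proj₂ , proj₂ ]′
    ; cliques = λ v v∈ → [ (λ v∈B → B , v∈B , ∣B∣ , λ e → inj₁) , (λ v∈W → S , q⊆p∪q B′ W v∈W , ∣S∣ , λ e → inj₂) ]′ (x∈p∪q⁻ B W v∈)
    ; rest = r
    ; shared = suc m
    ; rest+shared = r+m
    ; few = few
    }
    where
    r = ∣ W ∣
    r+m : r + suc m ≡ suc (suc t′)
    r+m = trans (+-suc r m) (cong suc eq)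
    pick = between ∅ B (⊆-min B) (suc m) (≤-trans (≤-reflexive (∣⊥∣≡0 n)) z≤n) (≤-trans (m≤n+m (suc m) r) (≤-reflexive (trans r+m (sym ∣B∣))))
    B′ S : Subset n
    B′ = proj₁ pick
    B′⊆B : B′ ⊆ B
    B′⊆B = proj₁ (proj₂ (proj₂ pick))
    ∣B′∣ : ∣ B′ ∣ ≡ suc m
    ∣B′∣ = proj₂ (proj₂ (proj₂ pick))
    S = B′ ∪ W
    ∣S∣ : ∣ S ∣ ≡ suc (suc t′)
    ∣S∣ = trans (∣p∪q∣-disjoint B′ W λ h → B#W _ (B′⊆B h)) (trans (cong (_+ r) ∣B′∣) (trans (+-comm (suc m) r) r+m))
    edges : # (λ e → in? B e ⊎-dec in? S e) + # (in? B′) ≤ # (in? B) + # (in? S)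
    edges = begin
      # (λ e → in? B e ⊎-dec in? S e) + # (in? B′)
        ≤⟨ +-monoˡ-≤ (# (in? B′)) (≤-trans (#-mono (λ e → in? B e ⊎-dec in? S e) (λ e → in? B e ⊎-dec (in? S e ×-dec ¬? (in? B e))) sep)
             (#-⊎ (in? B) (λ e → in? S e ×-dec ¬? (in? B e)))) ⟩
      # (in? B) + # (λ e → in? S e ×-dec ¬? (in? B e)) + # (in? B′)
        ≡⟨ +-assoc (# (in? B)) _ _ ⟩
      # (in? B) + (# (λ e → in? S e ×-dec ¬? (in? B e)) + # (in? B′))
        ≤⟨ +-monoʳ-≤ (# (in? B)) (#-disjoint (λ e → in? S e ×-dec ¬? (in? B e)) (in? B′) (in? S)
             (λ _ → proj₁) (λ e (h , q) → (λ x∈e → p⊆p∪q W (h x∈e)) , q) (λ e (_ , ¬b) (h , q) → ¬b ((λ x∈e → B′⊆B (h x∈e)) , q))) ⟩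
      # (in? B) + # (in? S) ∎
      where
      open ≤-Reasoning
      sep : ∀ e → (e ⊆ B × ∣ e ∣ ≡ ℓ) ⊎ (e ⊆ S × ∣ e ∣ ≡ ℓ) → (e ⊆ B × ∣ e ∣ ≡ ℓ) ⊎ ((e ⊆ S × ∣ e ∣ ≡ ℓ) × ¬ (e ⊆ B × ∣ e ∣ ≡ ℓ))
      sep e (inj₁ h) = inj₁ h
      sep e (inj₂ h) with in? B e
      ... | yes b = inj₁ b
      ... | no ¬b = inj₂ (h , ¬b)
    few : ℓ * # (λ e → in? B e ⊎-dec in? S e) ≤ ∣ B ∪ W ∣ * D + r * suc m * c
    few = +-cancelʳ-≤ (suc m * (m C suc l)) _ _ (begin
      ℓ * # (λ e → in? B e ⊎-dec in? S e) + suc m * (m C suc l)   ≡⟨ cong (ℓ * # (λ e → in? B e ⊎-dec in? S e) +_) (#-in B′ m ∣B′∣) ⟨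
      ℓ * # (λ e → in? B e ⊎-dec in? S e) + ℓ * # (in? B′)        ≡⟨ *-distribˡ-+ ℓ (# (λ e → in? B e ⊎-dec in? S e)) (# (in? B′)) ⟨
      ℓ * (# (λ e → in? B e ⊎-dec in? S e) + # (in? B′))          ≤⟨ *-monoʳ-≤ ℓ edges ⟩
      ℓ * (# (in? B) + # (in? S))                                 ≡⟨ *-distribˡ-+ ℓ (# (in? B)) _ ⟩
      ℓ * # (in? B) + ℓ * # (in? S)                               ≡⟨ cong₂ _+_ (#-in B (suc t′) ∣B∣) (#-in S (suc t′) ∣S∣) ⟩
      suc (suc t′) * D + suc (suc t′) * D                         ≡⟨ cong (λ x → suc (suc t′) * D + x * D) r+m ⟨
      suc (suc t′) * D + (r + suc m) * D                          ≡⟨ solve 4 (λ a r m d → a :* d :+ (r :+ m) :* d := (a :+ r) :* d :+ m :* d) refl (suc (suc t′)) r (suc m) D ⟩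
      (suc (suc t′) + r) * D + suc m * D                          ≤⟨ +-monoʳ-≤ ((suc (suc t′) + r) * D) (*-monoʳ-≤ (suc m)
        (≤-trans (≤-reflexive (cong (_C suc l) (trans (sym eq) (+-comm r m)))) (C-increment l t′ r m (≤-reflexive (trans (+-comm m r) eq))))) ⟩
      (suc (suc t′) + r) * D + suc m * (r * c + m C suc l)        ≡⟨ solve 5 (λ x r m c y → x :+ m :* (r :* c :+ y) := x :+ r :* m :* c :+ m :* y) refl ((suc (suc t′) + r) * D) r (suc m) c (m C suc l) ⟩
      (suc (suc t′) + r) * D + r * suc m * c + suc m * (m C suc l)
        ≡⟨ cong (λ x → x * D + r * suc m * c + suc m * (m C suc l)) (trans (cong (_+ r) (sym ∣B∣)) (sym (∣p∪q∣-disjoint B W (λ h → B#W _ h)))) ⟩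
      ∣ B ∪ W ∣ * D + r * suc m * c + suc m * (m C suc l)         ∎)
      where
      open ≤-Reasoning
      open +-*-Solver

  add-clique : (B V : Subset n) → ∣ B ∣ ≡ suc (suc t′) → Disj B V → Packing l t′ V → Packing l t′ (B ∪ V)
  add-clique B V ∣B∣ B#V P = record
    { Edge    = λ e → (e ⊆ B × ∣ e ∣ ≡ ℓ) ⊎ P.Edge e
    ; edge?   = λ e → in? B e ⊎-dec P.edge? e
    ; uniform = λ e → [ proj₂ , P.uniform e ]′
    ; cliques = λ v v∈ → [ (λ v∈B → B , v∈B , ∣B∣ , λ e → inj₁)
                         , (λ v∈V → let (S , v∈S , ∣S∣ , cl) = P.cliques v v∈V in S , v∈S , ∣S∣ , λ e h → inj₂ (cl e h)) ]′ (x∈p∪q⁻ B V v∈)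
    ; rest = P.rest
    ; shared = P.shared
    ; rest+shared = P.rest+shared
    ; few = begin
        ℓ * # (λ e → in? B e ⊎-dec P.edge? e)               ≤⟨ *-monoʳ-≤ ℓ (#-⊎ (in? B) P.edge?) ⟩
        ℓ * (# (in? B) + # P.edge?)                         ≡⟨ *-distribˡ-+ ℓ (# (in? B)) _ ⟩
        ℓ * # (in? B) + ℓ * # P.edge?                       ≤⟨ +-mono-≤ (≤-reflexive (#-in B (suc t′) ∣B∣)) P.few ⟩
        suc (suc t′) * D + (∣ V ∣ * D + P.rest * P.shared * c)      ≡⟨ solve 4 (λ a v d x → a :* d :+ (v :* d :+ x) := (a :+ v) :* d :+ x) refl (suc (suc t′)) ∣ V ∣ D (P.rest * P.shared * c) ⟩
        (suc (suc t′) + ∣ V ∣) * D + P.rest * P.shared * c          ≡⟨ cong (λ x → x * D + P.rest * P.shared * c) (trans (cong (_+ ∣ V ∣) (sym ∣B∣)) (sym (∣p∪q∣-disjoint B V (λ h → B#V _ h)))) ⟩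
        ∣ B ∪ V ∣ * D + P.rest * P.shared * c                       ∎
    }
    where
    module P = Packing P
    open ≤-Reasoning
    open +-*-Solver

  -- `B` is a clique already split off from `W`, so that the final remainder always finds one to
  -- overlap. `f` bounds the size of `W` for the recursion.
  packing : ∀ f (B W : Subset n) → ∣ W ∣ ≤ f → ∣ B ∣ ≡ suc (suc t′) → Disj B W → Packing l t′ (B ∪ W)
  packing f B W W≤f ∣B∣ B#W with suc (suc t′) ≤? ∣ W ∣
  ... | no W≱ = overlapping B W ∣B∣ B#W (s≤s⁻¹ (≰⇒> W≱))
  ... | yes W≥ with between ∅ W (⊆-min W) (suc (suc t′)) (≤-trans (≤-reflexive (∣⊥∣≡0 n)) z≤n) W≥
  ...   | B′ , _ , B′⊆W , ∣B′∣ with f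
  ...     | zero   = ⊥-elim (n≮0 (≤-trans W≥ W≤f))
  ...     | suc f′ = subst (λ V → Packing l t′ (B ∪ V)) W≡
    (add-clique B (B′ ∪ (W ─ B′)) ∣B∣ (subst (Disj B) (sym W≡) B#W)
      (packing f′ B′ (W ─ B′) (s≤s⁻¹ (≤-trans smaller W≤f)) ∣B′∣ λ x x∈B′ h → x∈p─q⇒x∉q W B′ h x∈B′))
    where
    smaller : suc ∣ W ─ B′ ∣ ≤ ∣ W ∣
    smaller = ≤-trans (+-monoˡ-≤ ∣ W ─ B′ ∣ (≤-trans (s≤s z≤n) (≤-reflexive (sym ∣B′∣)))) (≤-reflexive (∣─∣ W B′ B′⊆W))
    W≡ : B′ ∪ (W ─ B′) ≡ W
    W≡ = ⊆-antisym (∪-⊆ B′⊆W (p─q⊆p W B′)) (⊆∧∣∣≥⇒⊇ _ _ (∪-⊆ B′⊆W (p─q⊆p W B′))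
      (≤-reflexive (trans (sym (∣─∣ W B′ B′⊆W)) (sym (∣p∪q∣-disjoint B′ (W ─ B′) λ x∈B′ h → x∈p─q⇒x∉q W B′ h x∈B′)))))

  complete-packing : suc (suc t′) ≤ n → Packing l t′ (⊤ {n})
  complete-packing t<n with between ∅ (⊤ {n}) (⊆-min ⊤) (suc (suc t′)) (≤-trans (≤-reflexive (∣⊥∣≡0 n)) z≤n) (≤-trans t<n (≤-reflexive (sym (∣⊤∣≡n n))))
  ... | B , _ , B⊆⊤ , ∣B∣ = subst (Packing l t′) (p∪∁p≡⊤ B) (packing _ B (∁ B) ≤-refl ∣B∣ λ x x∈B h → x∈∁p⇒x∉p h x∈B)

-- Graphs as decidable families

length-filter : {P : A → Set} (P? : ∀ x → Dec (P x)) (xs : List A) → length (filter P? xs) ≡ ∑ xs (λ x → ind (P? x))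
length-filter P? []       = refl
length-filter P? (x ∷ xs) with P? x
... | yes _ = cong suc (length-filter P? xs)
... | no _  = length-filter P? xs

T-∧⁺ : ∀ {a b} → T a → T b → T (a ∧ b)
T-∧⁺ {true} {true} _ _ = tt

T-∧⁻ : ∀ {a b} → T (a ∧ b) → T a × T b
T-∧⁻ {true} {true} _ = tt , tt

T-not⁺ : ∀ {a} → ¬ T a → T (not a)
T-not⁺ {true}  h = ⊥-elim (h tt)
T-not⁺ {false} h = tt

T-⇒⁺ : ∀ {a b} → (T a → T b) → T (not a ∨ b)
T-⇒⁺ {true}  h = h tt
T-⇒⁺ {false} h = tt

T-⇒⁻ : ∀ {a b} → T (not a ∨ b) → T a → T b
T-⇒⁻ {true} h _ = h

allSubsets-complete : (S : Subset n) → S ∈ˡ allSubsets n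
allSubsets-complete []          = hereˡ refl
allSubsets-complete (true ∷ S)  = ∈-++⁺ˡ (∈-map⁺ (true ∷_) (allSubsets-complete S))
allSubsets-complete (false ∷ S) = ∈-++⁺ʳ _ (∈-map⁺ (false ∷_) (allSubsets-complete S))

allᵇ⁺ : (p : A → Bool) (xs : List A) → (∀ x → T (p x)) → T (allᵇ p xs)
allᵇ⁺ p []       h = tt
allᵇ⁺ p (x ∷ xs) h = T-∧⁺ (h x) (allᵇ⁺ p xs h)

allᵇ⁻ : (p : A → Bool) (xs : List A) → T (allᵇ p xs) → ∀ {x} → x ∈ˡ xs → T (p x)
allᵇ⁻ p (x ∷ xs) h (hereˡ refl) = proj₁ (T-∧⁻ h)
allᵇ⁻ p (x ∷ xs) h (thereˡ x∈) = allᵇ⁻ p xs (proj₂ (T-∧⁻ {p x} h)) x∈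

⊆ᵇ⁺ : (S U : Subset n) → S ⊆ U → T (S ⊆ᵇ U)
⊆ᵇ⁺ []      []      _   = tt
⊆ᵇ⁺ (b ∷ S) (c ∷ U) S⊆U = T-∧⁺ (T-⇒⁺ {b} (head b S⊆U)) (⊆ᵇ⁺ S U (drop-∷-⊆ S⊆U))
  where
  head : ∀ b → b ∷ S ⊆ c ∷ U → T b → T c
  head true h _ with h here
  ... | here = tt

⊆ᵇ⁻ : (S U : Subset n) → T (S ⊆ᵇ U) → S ⊆ U
⊆ᵇ⁻ (true ∷ S) (true ∷ U) h here      = here
⊆ᵇ⁻ (b ∷ S)    (c ∷ U)    h (there i) = there (⊆ᵇ⁻ S U (proj₂ (T-∧⁻ {not b ∨ c} h)) i)

lookup⁺ : (S : Subset n) {v : Fin n} → v ∈ S → T (lookup S v)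
lookup⁺ S v∈S = subst T (sym ([]=⇒lookup v∈S)) tt

lookup⁻ : (S : Subset n) {v : Fin n} → T (lookup S v) → v ∈ S
lookup⁻ S {v} h = lookup⇒[]= v S (T⇒≡true (lookup S v) h)
  where
  T⇒≡true : ∀ b → T b → b ≡ true
  T⇒≡true true _ = refl

meets⁻ : (S U : Subset n) → T (meets S U) → ∃ λ x → x ∈ S × x ∈ U
meets⁻ []          []          ()
meets⁻ (true ∷ S)  (true ∷ U)  h = zero , here , here
meets⁻ (true ∷ S)  (false ∷ U) h = let (x , a , b) = meets⁻ S U h in suc x , there a , there b
meets⁻ (false ∷ S) (c ∷ U)     h = let (x , a , b) = meets⁻ S U h in suc x , there a , there b

complement⁻ : (S : Subset n) {x : Fin n} → x ∈ complement S → x ∉ S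
complement⁻ (false ∷ S) here      = λ ()
complement⁻ (b ∷ S)     (there i) (there j) = complement⁻ S i j

module _ {ℓ : ℕ} (G : Graph ℓ n) where

  Edge : Subset n → Set
  Edge e = T (edge G e)

  edge? : ∀ e → Dec (Edge e)
  edge? e = T? (edge G e)

  numEdges≡ : numEdges G ≡ # edge?
  numEdges≡ = length-filter edge? (allSubsets n)

  isClique⁺ : (S : Subset n) → IsClique ℓ Edge S → T (isClique G S)
  isClique⁺ S cl = allᵇ⁺ _ (allSubsets n) λ e → T-⇒⁺ {(e ⊆ᵇ S) ∧ (∣ e ∣ ≡ᵇ ℓ)} λ h →
    let (h₁ , h₂) = T-∧⁻ {e ⊆ᵇ S} h in cl e (⊆ᵇ⁻ e S h₁ , ≡ᵇ⇒≡ ∣ e ∣ ℓ h₂)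

  isClique⁻ : (S : Subset n) → T (isClique G S) → IsClique ℓ Edge S
  isClique⁻ S h e (e⊆S , ∣e∣) = T-⇒⁻ (allᵇ⁻ _ (allSubsets n) h (allSubsets-complete e))
    (T-∧⁺ (⊆ᵇ⁺ e S e⊆S) (≡⇒≡ᵇ ∣ e ∣ ℓ ∣e∣))

  cliqueCount≡ : ∀ k v → cliqueCount G k v ≡ cliquesAt ℓ edge? k v
  cliqueCount≡ k v = trans (length-filter _ (allSubsets n))
    (#-cong _ (λ S → (v ∈? S) ×-dec complete? ℓ edge? k S)
      (λ S h → let (h₁ , h′) = T-∧⁻ {∣ S ∣ ≡ᵇ k} h
                   (h₂ , h₃) = T-∧⁻ {lookup S v} h′
               in lookup⁻ S h₂ , ≡ᵇ⇒≡ ∣ S ∣ k h₁ , isClique⁻ S h₃)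
      (λ S (v∈S , ∣S∣ , cl) → T-∧⁺ (≡⇒≡ᵇ ∣ S ∣ k ∣S∣) (T-∧⁺ (lookup⁺ S v∈S) (isClique⁺ S cl))))

cliquesAt-mono : ∀ ℓ {E F : Subset n → Set} (E? : ∀ e → Dec (E e)) (F? : ∀ e → Dec (F e)) → (∀ e → E e → F e) →
                 ∀ k v → cliquesAt ℓ E? k v ≤ cliquesAt ℓ F? k v
cliquesAt-mono ℓ E? F? E⇒F k v = #-mono (λ S → (v ∈? S) ×-dec complete? ℓ E? k S) (λ S → (v ∈? S) ×-dec complete? ℓ F? k S)
  λ S (v∈S , ∣S∣ , cl) → v∈S , ∣S∣ , λ e h → E⇒F e (cl e h)

does⁺ : (a? : Dec A) → A → T (does a?)
does⁺ (yes _) a = tt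
does⁺ (no ¬a) a = ⊥-elim (¬a a)

does⁻ : (a? : Dec A) → T (does a?) → A
does⁻ (yes a) _ = a

module FromFamily {ℓ : ℕ} {E : Subset n → Set} (E? : ∀ e → Dec (E e)) (unif : Uniform ℓ E) where

  graph : Graph ℓ n
  graph = record { edge = λ e → does (E? e) ; uniform = λ e h → unif e (does⁻ (E? e) h) }

  numEdges-graph : numEdges graph ≡ # E?
  numEdges-graph = trans (numEdges≡ graph) (#-cong (edge? graph) E? (λ e → does⁻ (E? e)) (λ e → does⁺ (E? e)))

  covered-graph : ∀ k m → (∀ v → m ≤ cliquesAt ℓ E? k v) → Covered k m graph
  covered-graph k m h v = ≤-trans (h v) (≤-trans (cliquesAt-mono ℓ E? (edge? graph) (λ e → does⁺ (E? e)) k v)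
    (≤-reflexive (sym (cliqueCount≡ graph k v))))

-- Existence of an extremal graph below a given covered one

families : ∀ n → List (Subset n → Bool)
families zero    = (λ _ → true) ∷ (λ _ → false) ∷ []
families (suc n) = cartesianProductWith (λ f g → λ { (true ∷ S) → f S ; (false ∷ S) → g S }) (families n) (families n)

-- The Boolean families are listed up to pointwise equality only, which is enough to preserve edge
-- and clique counts.
families-complete : ∀ n (p : Subset n → Bool) → ∃ λ f → f ∈ˡ families n × (∀ S → f S ≡ p S)
families-complete zero p with p [] in eq
... | true  = _ , hereˡ refl , λ { [] → sym eq }
... | false = _ , thereˡ (hereˡ refl) , λ { [] → sym eq }
families-complete (suc n) p =
  let (f , f∈ , f≡) = families-complete n (λ S → p (true ∷ S))
      (g , g∈ , g≡) = families-complete n (λ S → p (false ∷ S))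
  in _ , ∈-cartesianProductWith⁺ _ f∈ g∈ , λ { (true ∷ S) → f≡ S ; (false ∷ S) → g≡ S }

-- `x₀` may lie outside the list; it makes the search succeed and is itself one of the competitors.
minimum : {P : A → Set} (P? : ∀ x → Dec (P x)) (μ : A → ℕ) (xs : List A) (x₀ : A) → P x₀ →
          ∃ λ x → P x × μ x ≤ μ x₀ × (∀ {y} → y ∈ˡ xs → P y → μ x ≤ μ y)
minimum P? μ []       x₀ p₀ = x₀ , p₀ , ≤-refl , λ ()
minimum P? μ (y ∷ xs) x₀ p₀ with minimum P? μ xs x₀ p₀
... | x , p , x≤x₀ , x≤ with P? y
...   | no ¬py = x , p , x≤x₀ , λ { (hereˡ refl) py → ⊥-elim (¬py py) ; (thereˡ h) → x≤ h }
...   | yes py with ≤-total (μ x) (μ y)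
...     | inj₁ x≤y = x , p , x≤x₀ , λ { (hereˡ refl) _ → x≤y ; (thereˡ h) → x≤ h }
...     | inj₂ y≤x = y , py , ≤-trans y≤x x≤x₀ , λ { (hereˡ refl) _ → ≤-refl ; (thereˡ h) p → ≤-trans y≤x (x≤ h p) }

module _ {ℓ : ℕ} where

  restrict? : (f : Subset n → Bool) → ∀ e → Dec (∣ e ∣ ≡ ℓ × T (f e))
  restrict? f e = (∣ e ∣ ≟ ℓ) ×-dec T? (f e)

  fromBool : (Subset n → Bool) → Graph ℓ n
  fromBool f = FromFamily.graph (restrict? f) (λ _ → proj₁)

  -- The comparison with `G₀` brings the degree sum of the packing to the extremal graph.
  extremal-exists : ∀ k m (G₀ : Graph ℓ n) → Covered k m G₀ → ∃ λ G → Extremal k ℓ n m G × numEdges G ≤ numEdges G₀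
  extremal-exists {n} k m G₀ cov₀ with minimum {P = Covered k m} (λ G → Fin.all? λ v → m ≤? cliqueCount G k v) numEdges
      (Data.List.map fromBool (families n)) G₀ cov₀
  ... | G , cov , G≤G₀ , G≤ = G , (cov , least) , G≤G₀
    where
    least : ∀ H → Covered k m H → numEdges G ≤ numEdges H
    least H covH with families-complete n (edge H)
    ... | f , f∈ , f≡ = ≤-trans (G≤ (∈-map⁺ fromBool f∈) (F.covered-graph k m λ v →
        ≤-trans (covH v) (≤-trans (≤-reflexive (cliqueCount≡ H k v)) (cliquesAt-mono ℓ (edge? H) (restrict? f) to k v))))
      (≤-reflexive (trans F.numEdges-graph (trans (#-cong (restrict? f) (edge? H) from to) (sym (numEdges≡ H)))))
      where
      module F = FromFamily (restrict? f) (λ _ → proj₁)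
      to : ∀ e → Edge H e → ∣ e ∣ ≡ ℓ × T (f e)
      to e h = uniform H e h , subst T (sym (f≡ e)) h
      from : ∀ e → ∣ e ∣ ≡ ℓ × T (f e) → Edge H e
      from e (_ , h) = subst T (f≡ e) h

-- Two disjoint cliques in an extremal graph

∑ᵛ-∃ : {P : Fin n → Set} (P? : ∀ v → Dec (P v)) → 0 < ∑ᵛ (λ v → ind (P? v)) → ∃ P
∑ᵛ-∃ {n} P? 0<∑ with Fin.any? P?
... | yes h = h
... | no ¬h = ⊥-elim (<-irrefl (sym (trans (∑-cong (vertices n) λ v → ind-no (P? v) λ p → ¬h (v , p)) (∑-0 (vertices n)))) 0<∑)

C-large : ∀ l r → suc r ≤ (suc l + r) C suc l
C-large zero    r = ≤-reflexive (sym (nC1≡n (suc r)))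
C-large (suc l) r = ≤-trans (C-large l r) (≤-trans (m≤m+n _ _) (≤-reflexive (sym (pascal (suc l + r) (suc l)))))

-- For `l` equal to 0 the coefficient is 1 whatever `t` is; the alternatives match those of the
-- bound on `H` in `Surgery`.
C-≥3l : ∀ l t → suc l + 3 * suc l ≤ t → l ≡ 0 ⊎ 3 * suc l ≤ t C l
C-≥3l zero    t h = inj₁ refl
C-≥3l (suc l) t h = inj₂ (≤-trans (n≤1+n _) (≤-trans (C-large l (3 * suc (suc l))) (C-mono (suc l) (≤-trans (n≤1+n _) h))))

choose : {P : Fin n → Set} {Q : Fin n → Subset n → Set} → (∀ v → Dec (P v)) → (∀ v → P v → ∃ (Q v)) →
         ∃ λ (N : Fin n → Subset n) → ∀ v → P v → Q v (N v)
choose {n} {P} {Q} P? q = (λ v → N v (P? v)) , λ v → N-spec v (P? v)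
  where
  N : ∀ v → Dec (P v) → Subset n
  N v (yes p) = proj₁ (q v p)
  -- A default value; `N-spec` speaks only of vertices that satisfy `P`.
  N v (no _)  = ∅
  N-spec : ∀ v (p? : Dec (P v)) → P v → Q v (N v p?)
  N-spec v (yes p) _ = proj₂ (q v p)
  N-spec v (no ¬p) p = ⊥-elim (¬p p)

module Isolate {n : ℕ} {E : Subset n → Set} (E? : ∀ e → Dec (E e)) (l k t′ E₀ : ℕ) (l<k : suc l < k) (k≤t : k ≤ suc t′)
  (t-large : suc l + 3 * suc l ≤ t′)
  (unif : Uniform (suc (suc l)) E) (covered : ∀ v → suc t′ C k ≤ cliquesAt (suc (suc l)) E? (suc k) v)
  (few-edges : suc (suc l) * # E? ≤ n * (suc t′ C suc l) + E₀) (n-large : E₀ + 2 * suc t′ < n)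
  (deg≥ : ∀ v → suc t′ C suc l ≤ # (link? E? v))
  (N : Fin n → Subset n) (home : ∀ v → # (link? E? v) ≡ suc t′ C suc l → Home (suc (suc l)) E (suc t′) v (N v)) where

  Low : Fin n → Set
  Low v = # (link? E? v) ≡ suc t′ C suc l

  low? : ∀ v → Dec (Low v)
  low? v = # (link? E? v) ≟ suc t′ C suc l

  module X (Z : Subset n) = Excess E? l t′ unif deg≥ N home Z

  3l≤c : l ≡ 0 ⊎ 3 * suc l ≤ t′ C l
  3l≤c = C-≥3l l t′ t-large

  1+l≤c : suc l ≤ t′ C l
  1+l≤c = [ (λ l≡0 → subst (λ l → suc l ≤ t′ C l) (sym l≡0) (≤-reflexive (sym (C-zero t′)))) , ≤-trans (m≤m+n _ _) ]′ 3l≤c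

  cliques₀ : ∀ w → w ∈ ∅ → ∃ λ S → S ⊆ ∅ × w ∈ S × ∣ S ∣ ≡ suc (suc t′) × IsClique (suc (suc l)) E S
  cliques₀ w h = ⊥-elim (∉⊥ h)

  -- The count with `Z` empty: at least 2t + 1 vertices are near or far, and all of these have least
  -- degree.
  some-low : ∃ Low
  some-low with Fin.any? low?
  ... | yes h = h
  ... | no ¬h = ⊥-elim (n≮0 (≤-trans (s≤s z≤n) (≤-trans (X.excess≤′ ∅ cliques₀ E₀ few-edges n-large 0 (∣⊥∣≡0 n))
      (≤-reflexive (cong₂ _+_ (none (X.near? ∅ cliques₀) λ v h → ¬h (v , proj₂ (proj₁ h))) (none (X.far? ∅ cliques₀) λ v h → ¬h (v , proj₂ (proj₁ h))))))))
    where
    none : {P : Fin n → Set} (P? : ∀ v → Dec (P v)) → (∀ v → ¬ P v) → ∑ᵛ (λ v → ind (P? v)) ≡ 0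
    none P? ¬P = trans (∑-cong (vertices n) λ v → ind-no (P? v) (¬P v)) (∑-0 (vertices n))

  module Disjoint (s₁ : Fin n) (low₁ : Low s₁) (s₂ : Fin n) (low₂ : Low s₂) (S₂#S₁ : Disj (N s₂) (N s₁)) where

    home₁ : Home (suc (suc l)) E (suc t′) s₁ (N s₁)
    home₁ = home s₁ low₁

    home₂ : Home (suc (suc l)) E (suc t′) s₂ (N s₂)
    home₂ = home s₂ low₂

    S₁ S₂ Z : Subset n
    S₁ = N s₁
    S₂ = N s₂
    Z  = S₁ ∪ S₂

    S₁#S₂ : Disj S₁ S₂
    S₁#S₂ x x∈S₁ x∈S₂ = S₂#S₁ x x∈S₂ x∈S₁

    cliques₂ : ∀ w → w ∈ Z → ∃ λ S → S ⊆ Z × w ∈ S × ∣ S ∣ ≡ suc (suc t′) × IsClique (suc (suc l)) E S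
    cliques₂ w w∈Z with x∈p∪q⁻ S₁ S₂ w∈Z
    ... | inj₁ w∈S₁ = S₁ , p⊆p∪q S₂ , w∈S₁ , Home.size home₁ , Home.clique home₁
    ... | inj₂ w∈S₂ = S₂ , q⊆p∪q S₁ S₂ , w∈S₂ , Home.size home₂ , Home.clique home₂

    module Y = X Z cliques₂

    ∣Z∣ : ∣ Z ∣ ≡ suc (suc t′) + suc (suc t′)
    ∣Z∣ = trans (∣p∪q∣-disjoint S₁ S₂ λ h → S₁#S₂ _ h) (cong₂ _+_ (Home.size home₁) (Home.size home₂))

    H? : ∀ v → Dec (v ∈ Z × ¬ Low v)
    H? v = (v ∈? Z) ×-dec ¬? (low? v)

    far-set H : Subset n
    far-set = ⟪ Y.far? ⟫
    H       = ⟪ H? ⟫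

    far∈ : ∀ {x} → x ∈ far-set → (x ∉ Z × Low x) × Disj (N x) Z
    far∈ = ∈⟪⟫⁻ Y.far?

    -- Every vertex of `S` shares an edge inside `S` with `w`, hence lies in `N w`, and the sizes
    -- agree. So no edge at a vertex of least degree in `S₁ ∪ S₂` leaves its clique, and edges from
    -- outside reach only `H`.
    same-home : ∀ S → ∣ S ∣ ≡ suc (suc t′) → IsClique (suc (suc l)) E S → ∀ w → w ∈ S → Low w → N w ⊆ S
    same-home S ∣S∣ cl w w∈S low = ⊆∧∣∣≥⇒⊇ S (N w) S⊆N (≤-reflexive (trans (Home.size (home w low)) (sym ∣S∣)))
      where
      S⊆N : S ⊆ N w
      S⊆N {x} x∈S = let (e , wx⊆e , e⊆S , ∣e∣) = between (⁅ w ⁆ ∪ ⁅ x ⁆) S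
                            (∪-⊆ (λ h → subst (_∈ S) (sym (x∈⁅y⁆⇒x≡y w h)) w∈S) (λ h → subst (_∈ S) (sym (x∈⁅y⁆⇒x≡y x h)) x∈S))
                            (suc (suc l)) (≤-trans (m≤m+n _ _) (≤-trans (≤-reflexive (trans (∣p∪q∣+∣p∩q∣ ⁅ w ⁆ ⁅ x ⁆) (cong₂ _+_ (∣⁅x⁆∣≡1 w) (∣⁅x⁆∣≡1 x)))) (s≤s (s≤s z≤n))))
                            (≤-trans (≤-trans (s≤s (≤-trans (n≤1+n _) l<k)) (s≤s k≤t)) (≤-reflexive (sym ∣S∣)))
                    in Home.edges (home w low) e (cl e (e⊆S , ∣e∣)) (wx⊆e (p⊆p∪q ⁅ x ⁆ (x∈⁅x⁆ w))) (wx⊆e (q⊆p∪q ⁅ w ⁆ ⁅ x ⁆ (x∈⁅x⁆ x)))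

    attached : ∀ e → E e → ∀ y → y ∈ e → y ∉ Z → ∀ w → w ∈ e → w ∈ Z → w ∈ H
    attached e Ee y y∈e y∉Z w w∈e w∈Z = ∈⟪⟫⁺ H? (w∈Z , λ low →
      let (S , S⊆Z , w∈S , ∣S∣ , cl) = cliques₂ w w∈Z
      in y∉Z (S⊆Z (same-home S ∣S∣ cl w w∈S low (Home.edges (home w low) e Ee w∈e y∈e))))

    H-bound : l ≡ 0 ⊎ ∣ H ∣ ≤ ∣ far-set ∣ + suc (suc t′)
    H-bound = [ inj₁ , (λ h → inj₂ (≤-trans (≤-reflexive (∣⟪⟫∣ H?)) (≤-trans (Y.highIn≤far E₀ few-edges n-large ∣Z∣ h)
      (≤-reflexive (cong (_+ suc (suc t′)) (sym (∣⟪⟫∣ Y.far?))))))) ]′ 3l≤c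

    isolation : Isolation (suc (suc l)) (suc k) (suc t′ C k) E? S₁
    isolation = Surgery.isolation E? l k (suc t′) (<⇒≤ l<k) unif S₁ S₂ far-set S₁#S₂ (λ x h → proj₁ (proj₁ (far∈ h))) (Home.size home₁) (Home.size home₂)
      (Home.clique home₁) (Home.clique home₂) N
      (λ x h → Home.v∈S (home x (proj₂ (proj₁ (far∈ h))))) (λ x h → Home.size (home x (proj₂ (proj₁ (far∈ h)))))
      (λ x h → Home.clique (home x (proj₂ (proj₁ (far∈ h))))) (λ x h → Home.edges (home x (proj₂ (proj₁ (far∈ h)))))
      (λ x h → proj₂ (far∈ h)) H attached H-bound covered

  far-clique : ∀ s₁ → Low s₁ → ∃ λ s₂ → Low s₂ × Disj (N s₂) (N s₁)
  far-clique s₁ low₁ =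
    let (s₂ , (_ , low₂) , disj) = ∑ᵛ-∃ (X.far? (N s₁) own) (X.far-positive (N s₁) own E₀ few-edges n-large (Home.size home₁) 1+l≤c)
    in s₂ , low₂ , disj
    where
    home₁ = home s₁ low₁
    own : ∀ w → w ∈ N s₁ → ∃ λ S → S ⊆ N s₁ × w ∈ S × ∣ S ∣ ≡ suc (suc t′) × IsClique (suc (suc l)) E S
    own w w∈ = N s₁ , id , w∈ , Home.size home₁ , Home.clique home₁

  isolate : ∃ λ S → ∣ S ∣ ≡ suc (suc t′) × Isolation (suc (suc l)) (suc k) (suc t′ C k) E? S
  isolate =
    unpack some-low λ s₁ low₁ →
    unpack (far-clique s₁ low₁) λ s₂ (low₂ , disj) →
    N s₁ , Home.size (home s₁ low₁) , Disjoint.isolation s₁ low₁ s₂ low₂ disj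

-- From the extremal graph to the isolated copy

isolating : ∀ {n} {E : Subset n → Set} (E? : ∀ e → Dec (E e)) l k t′ E₀ → suc l < k → k ≤ suc t′ → suc l + 3 * suc l ≤ t′ →
            Uniform (suc (suc l)) E → (∀ v → suc t′ C k ≤ cliquesAt (suc (suc l)) E? (suc k) v) →
            suc (suc l) * # E? ≤ n * (suc t′ C suc l) + E₀ → E₀ + 2 * suc t′ < n →
            ∃ λ S → ∣ S ∣ ≡ suc (suc t′) × Isolation (suc (suc l)) (suc k) (suc t′ C k) E? S
isolating E? l k t′ E₀ l<k k≤t t-large unif covered few-edges n-large =
  unpack (choose (λ v → # (link? E? v) ≟ suc t′ C suc l) (λ v → LeastDegree.home E? l k (suc t′) l<k k≤t unif v (covered v)))
    (Isolate.isolate E? l k t′ E₀ l<k k≤t t-large unif covered few-edges n-large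
      (λ v → LeastDegree.deg≥ E? l k (suc t′) l<k k≤t unif v (covered v)))

isolated-graph : ∀ {n ℓ k m s} (G : Graph ℓ n) (S : Subset n) → ∣ S ∣ ≡ s → Isolation ℓ k m (edge? G) S →
                 ∃ λ (G′ : Graph ℓ n) → Covered k m G′ × numEdges G′ ≤ numEdges G × IsolatedCopy G′ s S
isolated-graph {n} {ℓ} {k} {m} G S ∣S∣ iso = F.graph , F.covered-graph k m I.covered′ ,
    ≤-trans (≤-reflexive F.numEdges-graph) (≤-trans I.fewer (≤-reflexive (sym (numEdges≡ G)))) ,
    ∣S∣ , isClique⁺ F.graph S (λ e h → does⁺ (I.edge′? e) (I.clique e h)) , isolated
  where
  module I = Isolation iso
  module F = FromFamily I.edge′? I.uniform′
  isolated : ∀ e → T (does (I.edge′? e)) → T (not (meets e S ∧ meets e (complement S)))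
  isolated e h = T-not⁺ {meets e S ∧ meets e (complement S)} λ m →
    let (m₁ , m₂) = T-∧⁻ {meets e S} m
        (x , x∈e , x∈S) = meets⁻ e S m₁
        (y , y∈e , y∈c) = meets⁻ e (complement S) m₂
    in [ (λ e⊆S → complement⁻ S y∈c (e⊆S y∈e)) , (λ e#S → e#S x x∈e x∈S) ]′ (I.isolated e (does⁻ (I.edge′? e) h))

sparse-graph : ∀ n l t′ k → ((suc t′ + 1) ^ 2) * (t′ C l) + 8 * suc t′ < 4 * n →
               ∃ λ (G : Graph (suc (suc l)) n) → Covered (suc k) (suc t′ C k) G ×
               ∃ λ E₀ → suc (suc l) * numEdges G ≤ n * (suc t′ C suc l) + E₀ × E₀ + 2 * suc t′ < n
sparse-graph n l t′ k n> = F.graph , F.covered-graph (suc k) (suc t′ C k) covers , E₀ , few , n-large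
  where
  open ≤-Reasoning
  open +-*-Solver
  t<n : suc (suc t′) ≤ n
  t<n = *-cancelˡ-≤ 4 (begin
    4 * suc (suc t′)                                   ≤⟨ m≤m+n _ _ ⟩
    4 * suc (suc t′) + 4 * t′                          ≡⟨ solve 1 (λ x → con 4 :* (con 2 :+ x) :+ con 4 :* x := con 8 :* (con 1 :+ x)) refl t′ ⟩
    8 * suc t′                                         ≤⟨ m≤n+m (8 * suc t′) _ ⟩
    ((suc t′ + 1) ^ 2) * (t′ C l) + 8 * suc t′         ≤⟨ <⇒≤ n> ⟩
    4 * n                                              ∎)
  packed : Packing l t′ (⊤ {n})
  packed = complete-packing l t′ t<n
  module P = Packing packed
  module F = FromFamily P.edge? P.uniform
  E₀ : ℕ
  E₀ = P.rest * P.shared * (t′ C l)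
  n-large : E₀ + 2 * suc t′ < n
  n-large = *-cancelˡ-< 4 _ _ (begin-strict
    4 * (E₀ + 2 * suc t′)
      ≡⟨ solve 3 (λ a c t → con 4 :* (a :* c :+ con 2 :* t) := con 4 :* a :* c :+ con 8 :* t) refl (P.rest * P.shared) (t′ C l) (suc t′) ⟩
    4 * (P.rest * P.shared) * (t′ C l) + 8 * suc t′
      -- The product of two numbers with sum t + 1 is at most (t + 1)² / 4, whence the quarter in
      -- the bound on `n`.
      ≤⟨ +-monoˡ-≤ (8 * suc t′) (*-monoˡ-≤ (t′ C l) (4rm≤ P.rest P.shared)) ⟩
    (P.rest + P.shared) * (P.rest + P.shared) * (t′ C l) + 8 * suc t′
      ≡⟨ cong (λ x → x * (t′ C l) + 8 * suc t′) (trans (cong (λ x → x * x) (trans P.rest+shared (+-comm 1 (suc t′)))) (cong ((suc t′ + 1) *_) (sym (*-identityʳ (suc t′ + 1))))) ⟩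
    ((suc t′ + 1) ^ 2) * (t′ C l) + 8 * suc t′
      <⟨ n> ⟩
    4 * n ∎)
  covers : ∀ v → suc t′ C k ≤ cliquesAt (suc (suc l)) P.edge? (suc k) v
  covers v = let (S , v∈S , ∣S∣ , cl) = P.cliques v ∈⊤ in clique-covers (suc (suc l)) P.edge? k (suc t′) v S v∈S (≤-reflexive (sym ∣S∣)) cl
  few : suc (suc l) * numEdges F.graph ≤ n * (suc t′ C suc l) + E₀
  few = ≤-trans (≤-reflexive (cong (suc (suc l) *_) F.numEdges-graph))
    (≤-trans P.few (≤-reflexive (cong (λ x → x * (suc t′ C suc l) + E₀) (∣⊤∣≡n n))))

theorem9 : (k ℓ : ℕ) → 2 ≤ ℓ → ℓ < k →
    ∃ λ (t₀ : ℕ) → ∀ (t n : ℕ) → t₀ ≤ t →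
    (t + 1) ^ 2 * ((t ∸ 1) C (ℓ ∸ 2)) + 8 * t < 4 * n →
    Σ (Graph ℓ n) λ G → Extremal k ℓ n (t C (k ∸ 1)) G ×
    ∃ λ (S : Subset n) → IsolatedCopy G (t + 1) S
-- The part `suc (suc l + 3 * suc l)` of t₀ gives t - 1 ≥ 4 (ℓ - 1), from which `C-≥3l` follows; the
-- summand `k`, one less than the clique size, ensures `k ≤ t` for the clique counts in the links.
theorem9 (suc k) (suc (suc l)) (s≤s (s≤s z≤n)) (s≤s l<k) = suc (suc l + 3 * suc l) + k , main
  where
  ℓ : ℕ
  ℓ = suc (suc l)
  main : ∀ (t n : ℕ) → suc (suc l + 3 * suc l) + k ≤ t →
    (t + 1) ^ 2 * ((t ∸ 1) C l) + 8 * t < 4 * n →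
    Σ (Graph ℓ n) λ G → Extremal (suc k) ℓ n (t C k) G ×
    ∃ λ (S : Subset n) → IsolatedCopy G (t + 1) S
  main (suc t′) n (s≤s t≥) n> =
    unpack (sparse-graph n l t′ k n>) λ G₀ (cov₀ , E₀ , few₀ , n-large) →
    unpack (extremal-exists (suc k) (suc t′ C k) G₀ cov₀) λ G ((cov , least) , G≤G₀) →
    unpack (isolating (edge? G) l k t′ E₀ l<k (≤-trans (m≤n+m k _) (≤-trans t≥ (n≤1+n t′))) (≤-trans (m≤m+n _ k) t≥) (uniform G)
        (λ v → ≤-trans (cov v) (≤-reflexive (cliqueCount≡ G (suc k) v)))
        (≤-trans (*-monoʳ-≤ ℓ (≤-trans (≤-reflexive (sym (numEdges≡ G))) G≤G₀)) few₀) n-large) λ S (∣S∣ , iso) →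
    unpack (isolated-graph G S (trans ∣S∣ (+-comm 1 (suc t′))) iso) λ G′ (cov′ , G′≤G , copy) →
    G′ , (cov′ , λ H covH → ≤-trans G′≤G (least H covH)) , S , copy
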